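{- Let $L$ be the quinary $\mathbb{Z}$-lattice $\langle 1,2\rangle\perp N$, where $N$ is the ternary lattice with Gram matrix $\begin{pmatrix}2&-1&0\\-1&2&-1\\0&-1&3\end{pmatrix}$ (in Conway–Sloane notation $N=A_2\,21[1\,\tfrac13]$). Then $L$ is an isolation of $I_2$, and no lattice of rank less than $5$ is an isolation of $I_2$. Hence $\mathrm{Iso}(I_2)=5$.
   Context: All $\mathbb{Z}$-lattices are positive definite with integral Gram matrix. $M$ is represented by $L$ if there is a linear map $\sigma:M\to L$ preserving the quadratic form. $\langle a_1,\dots,a_k\rangle$ denotes the diagonal lattice and $\perp$ the orthogonal sum; $I_n=\langle 1,\dots,1\rangle$ ($n$ ones). A lattice $L$ is an isolation of $\ell$ if $L$ represents every sublattice of $\ell$ except $\ell$ itself, and does not represent $\ell$. $\mathrm{Iso}(\ell)$ is the minimum rank of an isolation of $\ell$. -}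

module Defs where

open import Data.Nat using (ℕ; zero; suc; _<_)
open import Data.Integer using (ℤ; +_; -[1+_]; _+_; _*_; _>_)
open import Data.Fin using (Fin; zero; suc)
open import Data.Product using (Σ; _×_; ∃; ∃-syntax)
open import Relation.Binary.PropositionalEquality using (_≡_)
open import Relation.Nullary using (¬_)

Vec : ℕ → Set
Vec n = Fin n → ℤ

Mat : ℕ → ℕ → Set
Mat m n = Fin m → Fin n → ℤ

∑ : (n : ℕ) → (Fin n → ℤ) → ℤ
∑ zero    f = + 0
∑ (suc n) f = f zero + ∑ n (λ i → f (suc i))

transpose : ∀ {m n} → Mat m n → Mat n m
transpose A i j = A j i

_·_ : ∀ {m k n} → Mat m k → Mat k n → Mat m n
_·_ {k = k} A B i j = ∑ k (λ l → A i l * B l j)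

_⊙_ : ∀ {m n} → Mat m n → Vec n → Vec m
_⊙_ {n = n} A x i = ∑ n (λ j → A i j * x j)

Q : ∀ {n} → Mat n n → Vec n → ℤ
Q {n} G x = ∑ n (λ i → x i * ∑ n (λ j → G i j * x j))

_≈ᵥ_ : ∀ {n} → Vec n → Vec n → Set
x ≈ᵥ y = ∀ i → x i ≡ y i

_≈ₘ_ : ∀ {m n} → Mat m n → Mat m n → Set
A ≈ₘ B = ∀ i j → A i j ≡ B i j

0ᵥ : ∀ {n} → Vec n
0ᵥ _ = + 0

-- A Z-lattice of rank n, given by its Gram matrix w.r.t. a basis:
-- integral, symmetric and positive definite.
-- (Positivity on all nonzero integer vectors is equivalent to positive
--  definiteness over ℝ for an integral matrix.)
IsLattice : ∀ {n} → Mat n n → Set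
IsLattice {n} G = (∀ i j → G i j ≡ G j i) × (∀ (x : Vec n) → ¬ (x ≈ᵥ 0ᵥ) → Q G x > + 0)

-- M (rank m, Gram GM) is represented by L (rank n, Gram GL):
-- there is a Z-linear map σ : M → L, given by the integer matrix T whose
-- columns are the images of the basis of M, preserving the form,
-- i.e. Tᵀ GL T = GM.
Represents : ∀ {n m} → Mat n n → Mat m m → Set
Represents {n} {m} GL GM = Σ (Mat n m) λ T → (transpose T · (GL · T)) ≈ₘ GM

-- A sublattice of ℓ (rank r, Gram Gℓ) of rank k is given by an injective
-- Z-linear map B : Z^k → Z^r (columns = a basis of the sublattice);
-- its Gram matrix is Bᵀ Gℓ B.  Every sublattice arises so (subgroups of
-- free abelian groups are free).
InjectiveMap : ∀ {r k} → Mat r k → Set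
InjectiveMap {r} {k} B = ∀ (x : Vec k) → (B ⊙ x) ≈ᵥ 0ᵥ → x ≈ᵥ 0ᵥ

-- The sublattice is ℓ itself iff B is surjective onto Z^r.
SurjectiveMap : ∀ {r k} → Mat r k → Set
SurjectiveMap {r} {k} B = ∀ (v : Vec r) → Σ (Vec k) λ x → (B ⊙ x) ≈ᵥ v

sublatticeGram : ∀ {r k} → Mat r r → Mat r k → Mat k k
sublatticeGram Gℓ B = transpose B · (Gℓ · B)

IsIsolation : ∀ {n r} → Mat n n → Mat r r → Set
IsIsolation {n} {r} GL Gℓ =
  (∀ (k : ℕ) (B : Mat r k) → InjectiveMap B → ¬ SurjectiveMap B →
     Represents GL (sublatticeGram Gℓ B))
  × ¬ Represents GL Gℓ

IsoEq : ∀ {r} → Mat r r → ℕ → Set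
IsoEq {r} Gℓ m =
  (Σ (Mat m m) λ G → IsLattice G × IsIsolation G Gℓ)
  × (∀ (n : ℕ) → n < m → (G : Mat n n) → IsLattice G → ¬ IsIsolation G Gℓ)

I₂ : Mat 2 2
I₂ zero    zero    = + 1
I₂ zero    (suc _) = + 0
I₂ (suc _) zero    = + 0
I₂ (suc _) (suc _) = + 1

Lrows : Fin 5 → Fin 5 → ℤ
Lrows zero zero = + 1
Lrows (suc zero) (suc zero) = + 2
Lrows (suc (suc zero)) (suc (suc zero)) = + 2
Lrows (suc (suc zero)) (suc (suc (suc zero))) = -[1+ 0 ]
Lrows (suc (suc (suc zero))) (suc (suc zero)) = -[1+ 0 ]
Lrows (suc (suc (suc zero))) (suc (suc (suc zero))) = + 2
Lrows (suc (suc (suc zero))) (suc (suc (suc (suc zero)))) = -[1+ 0 ]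
Lrows (suc (suc (suc (suc zero)))) (suc (suc (suc zero))) = -[1+ 0 ]
Lrows (suc (suc (suc (suc zero)))) (suc (suc (suc (suc zero)))) = + 3
Lrows _ _ = + 0

Lgram : Mat 5 5
Lgram = Lrows

{-# OPTIONS --safe #-}
module Submission where

{-
Upper bound. Identify I₂ with ℤ[i]. Up to exchanging coordinates, a proper sublattice lies in
M = ℤ(t + i) + ℤp for a prime p. Let O = ℤ[i] + ℤ[i]ω be the quaternion order of discriminant 7,
whose norm form is |a|² + Re(a b̄) + 2|b|². By Hermitian reduction over ℤ[i], every positive form
a|x|² + Re(e x ȳ) + c|y|² with e odd and 4ac - |e|² = 7 is equivalent to it, so left ideals of norm p
are principal, say generated by α and β; for suitable ideals m ↦ α m β⁻¹ maps M isometrically into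
O, but not into ℤ[i]. (If p divides t² + 1, then M is similar to ℤ[i] and embeds in O directly.)
The genus of L consists of L and K = I₂ ⊥ T, where T = ⟨1⟩ ⊥ (3 1; 1 5). Depending on M modulo 2,
either a half-integral map O → L is integral on M, or M maps to K with nonzero component in T.
In the latter case the isotropic lines of T modulo 3 yield isometries of T ⊗ ℚ that make this
component nonzero modulo 3, and then a 3-neighbour of K isometric to L contains M.

Lower bound. An isolation of I₂ of rank at most 4 represents ⟨1,9⟩ and ⟨2,2⟩. This gives vectors
e, h of norms 1, 9 and f₁, f₂ of norms 2, where only the products p, q of h with f₁, f₂ can be
nonzero, and 0 ≤ p, q ≤ 4. With g = 2h - p f₁ - q f₂ they span the lattice rationally, so vectors are
determined by their products with an orthogonal basis. In each case either there are two orthogonal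
vectors of norm 1, or one of the proper sublattices (2 1; 1 5), ⟨5,5⟩, (2 1; 1 13), ⟨1,25⟩ of I₂
is not represented.
-}

open import Defs
open import Data.Nat using (ℕ; _<_)
open import Data.Product using (_×_)
open import Relation.Nullary using (¬_)

open import Data.Bool.Base using (Bool; true; false; _∧_; _∨_; not; T)
open import Data.Empty using (⊥)
open import Data.Fin.Base using (Fin; zero; suc; toℕ; fromℕ<; splitAt; punchIn; punchOut)
import Data.Fin.Base as Fin
open import Data.Fin.Patterns using (0F; 1F; 2F; 3F; 4F)
import Data.Fin.Properties as Fin
open import Data.Integer.Base using (ℤ; +_; -[1+_]; _+_; _*_; _-_; -_; 0ℤ; 1ℤ; ∣_∣)
import Data.Integer.Base as ℤ
import Data.Integer.DivMod as ℤ
open import Data.Integer.Divisibility.Signed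
  using (_∣_; divides; ∣ᵤ⇒∣; ∣⇒∣ᵤ; ∣m∣n⇒∣m+n; ∣m∣n⇒∣m-n; ∣m⇒∣m*n; ∣n⇒∣m*n; ∣m⇒∣-m; ∣-refl; _∣?_)
import Data.Integer.Properties as ℤ
open import Data.Integer.Properties
  using (+-identityˡ; *-zeroʳ; *-comm; *-assoc; *-distribˡ-+; *-distribʳ-+)
open import Data.Integer.Solver using (module +-*-Solver)
open import Data.Integer.Tactic.RingSolver using (solve-∀)
open import Data.List.Base using ([]; _∷_)
open import Data.List.Relation.Unary.All using (All; []; _∷_)
open import Data.Nat.Base using (zero; suc; _≤_; s≤s; z≤n; _≡ᵇ_; _≤ᵇ_)
import Data.Nat.Base as ℕ
open import Data.Nat.Coprimality using (prime⇒coprime; coprime-Bézout)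
import Data.Nat.DivMod as ℕ
import Data.Nat.Divisibility as ℕ
open import Data.Nat.GCD using (module Bézout)
open import Data.Nat.Induction using (Acc; acc; <-wellFounded)
import Data.Nat.ListAction as ℕ
open import Data.Nat.Primality
  using (Prime; prime?; euclidsLemma; prime⇒nonZero; prime⇒nonTrivial; prime⇒irreducible)
open import Data.Nat.Primality.Factorisation using (factorise; PrimeFactorisation)
import Data.Nat.Properties as ℕ
import Data.Nat.Tactic.RingSolver as ℕ-Ring
open import Data.Product using (_,_; proj₁; proj₂; ∃; ∃₂; Σ)
open import Data.Sum.Base using (_⊎_; inj₁; inj₂)
open import Data.Unit.Base using (tt)
import Data.Vec.Base as V
open V using ([]; _∷_)
open import Relation.Binary.Definitions using (tri<; tri≈; tri>)
open import Relation.Binary.PropositionalEquality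
open import Relation.Nullary using (Dec; yes; no; contradiction; ¬?; _×-dec_)
open import Relation.Nullary.Decidable using (from-yes)

open +-*-Solver using (Polynomial; solve; _:=_; _:+_; _:*_; _:-_; :-_; con)

-- The obstacle is that K contains I₂: an embedding of M into the I₂ of K gives the neighbour step
-- nothing to work with. So every embedding into O must be shown to leave ℤ[i]. Elements of norm 1
-- in O all lie in ℤ[i], so I₂ itself has no such embedding; for M of prime index there is room,
-- because two different ideals of norm p can be intertwined. The number 7 comes from T: the vectors
-- (2, 1, 0) and (1, -1, 1) are orthogonal of norm 7, so ⟨1, 1, 7, 7⟩, the rational norm form of O,
-- lies in K ⊗ ℚ, which is isometric to L ⊗ ℚ. Three primes fall outside the construction and are
-- settled by explicit vectors: 2, because congruences modulo p are combined with parities; 3,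
-- because the neighbour step uses that det M = p² is 1 modulo 3; and 7, for which the test that the
-- image leaves ℤ[i] can fail.

-- Finite sums and the bilinear form of a Gram matrix

∑-cong : ∀ n {f g : Fin n → ℤ} → (∀ i → f i ≡ g i) → ∑ n f ≡ ∑ n g
∑-cong zero    f≗g = refl
∑-cong (suc n) f≗g = cong₂ _+_ (f≗g zero) (∑-cong n (λ i → f≗g (suc i)))

+-interchange : ∀ a b c d → (a + b) + (c + d) ≡ (a + c) + (b + d)
+-interchange = solve-∀

∑-zero : ∀ n → ∑ n (λ _ → 0ℤ) ≡ 0ℤ
∑-zero zero    = refl
∑-zero (suc n) = trans (+-identityˡ _) (∑-zero n)

∑-+ : ∀ n (f g : Fin n → ℤ) → ∑ n (λ i → f i + g i) ≡ ∑ n f + ∑ n g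
∑-+ zero    f g = refl
∑-+ (suc n) f g =
  trans (cong (_+_ (f zero + g zero)) (∑-+ n (λ i → f (suc i)) (λ i → g (suc i))))
        (+-interchange (f zero) (g zero) _ _)

∑-*ˡ : ∀ n c (f : Fin n → ℤ) → ∑ n (λ i → c * f i) ≡ c * ∑ n f
∑-*ˡ zero    c f = sym (*-zeroʳ c)
∑-*ˡ (suc n) c f =
  trans (cong (_+_ (c * f zero)) (∑-*ˡ n c (λ i → f (suc i)))) (sym (*-distribˡ-+ c _ _))

∑-*ʳ : ∀ n c (f : Fin n → ℤ) → ∑ n (λ i → f i * c) ≡ ∑ n f * c
∑-*ʳ n c f =
  trans (∑-cong n (λ i → *-comm (f i) c)) (trans (∑-*ˡ n c f) (*-comm c _))

∑-swap : ∀ m n (f : Fin m → Fin n → ℤ) →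
         ∑ m (λ i → ∑ n (λ j → f i j)) ≡ ∑ n (λ j → ∑ m (λ i → f i j))
∑-swap zero    n f = sym (∑-zero n)
∑-swap (suc m) n f =
  trans (cong (_+_ (∑ n (f zero))) (∑-swap m n (λ i → f (suc i))))
        (sym (∑-+ n (f zero) _))

infixl 6 _+ᵥ_
infixr 7 _*ᵥ_

_+ᵥ_ : ∀ {n} → Vec n → Vec n → Vec n
(x +ᵥ y) i = x i + y i

_*ᵥ_ : ∀ {n} → ℤ → Vec n → Vec n
(c *ᵥ x) i = c * x i

⟪_⟫ : ∀ {n} → Mat n n → Vec n → Vec n → ℤ
⟪_⟫ {n} G x y = ∑ n (λ i → x i * ∑ n (λ j → G i j * y j))

Symmetric : ∀ {n} → Mat n n → Set
Symmetric G = ∀ i j → G i j ≡ G j i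

module _ {n : ℕ} (G : Mat n n) where

  ⟪⟫-cong : ∀ {x x′ y y′} → x ≈ᵥ x′ → y ≈ᵥ y′ → ⟪ G ⟫ x y ≡ ⟪ G ⟫ x′ y′
  ⟪⟫-cong x≈ y≈ =
    ∑-cong n (λ i → cong₂ _*_ (x≈ i) (∑-cong n (λ j → cong (G i j *_) (y≈ j))))

  ⟪⟫-+ˡ : ∀ x x′ y → ⟪ G ⟫ (x +ᵥ x′) y ≡ ⟪ G ⟫ x y + ⟪ G ⟫ x′ y
  ⟪⟫-+ˡ x x′ y = trans (∑-cong n (λ i → *-distribʳ-+ _ (x i) (x′ i))) (∑-+ n _ _)

  ⟪⟫-*ˡ : ∀ c x y → ⟪ G ⟫ (c *ᵥ x) y ≡ c * ⟪ G ⟫ x y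
  ⟪⟫-*ˡ c x y = trans (∑-cong n (λ i → *-assoc c (x i) _)) (∑-*ˡ n c _)

  ⟪⟫-+ʳ : ∀ x y y′ → ⟪ G ⟫ x (y +ᵥ y′) ≡ ⟪ G ⟫ x y + ⟪ G ⟫ x y′
  ⟪⟫-+ʳ x y y′ =
    trans (∑-cong n (λ i → trans
      (cong (x i *_) (trans (∑-cong n (λ j → *-distribˡ-+ (G i j) (y j) (y′ j))) (∑-+ n _ _)))
      (*-distribˡ-+ (x i) _ _))) (∑-+ n _ _)

  ⟪⟫-*ʳ : ∀ c x y → ⟪ G ⟫ x (c *ᵥ y) ≡ c * ⟪ G ⟫ x y
  ⟪⟫-*ʳ c x y =
    trans (∑-cong n (λ i → trans
      (cong (x i *_) (trans (∑-cong n (λ j → swap (G i j) c (y j))) (∑-*ˡ n c _)))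
      (swap (x i) c _))) (∑-*ˡ n c _)
    where
    swap : ∀ a b d → a * (b * d) ≡ b * (a * d)
    swap = solve-∀

  ⟪⟫-sym : Symmetric G → ∀ x y → ⟪ G ⟫ x y ≡ ⟪ G ⟫ y x
  ⟪⟫-sym G-sym x y = begin
    ∑ n (λ i → x i * ∑ n (λ j → G i j * y j))
      ≡⟨ ∑-cong n (λ i → sym (∑-*ˡ n (x i) _)) ⟩
    ∑ n (λ i → ∑ n (λ j → x i * (G i j * y j)))
      ≡⟨ ∑-swap n n _ ⟩
    ∑ n (λ j → ∑ n (λ i → x i * (G i j * y j)))
      ≡⟨ ∑-cong n (λ j → ∑-cong n (λ i → trans (rearrange (x i) (G i j) (y j))
                                                (cong (λ g → y j * (g * x i)) (G-sym i j)))) ⟩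
    ∑ n (λ j → ∑ n (λ i → y j * (G j i * x i)))
      ≡⟨ ∑-cong n (λ j → ∑-*ˡ n (y j) _) ⟩
    ∑ n (λ j → y j * ∑ n (λ i → G j i * x i)) ∎
    where
    open ≡-Reasoning
    rearrange : ∀ a g b → a * (g * b) ≡ b * (g * a)
    rearrange = solve-∀

  module _ {k : ℕ} (U : Mat n k) where

    ⟪⟫-⊙ˡ : ∀ x v → ⟪ G ⟫ (U ⊙ x) v ≡ ∑ k (λ a → x a * ⟪ G ⟫ (λ i → U i a) v)
    ⟪⟫-⊙ˡ x v = begin
      ∑ n (λ i → ∑ k (λ a → U i a * x a) * w i)
        ≡⟨ ∑-cong n (λ i → sym (∑-*ʳ k (w i) _)) ⟩
      ∑ n (λ i → ∑ k (λ a → U i a * x a * w i))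
        ≡⟨ ∑-swap n k _ ⟩
      ∑ k (λ a → ∑ n (λ i → U i a * x a * w i))
        ≡⟨ ∑-cong k (λ a → trans (∑-cong n (λ i → rearrange (U i a) (x a) (w i)))
                                 (∑-*ˡ n (x a) _)) ⟩
      ∑ k (λ a → x a * ∑ n (λ i → U i a * w i)) ∎
      where
      open ≡-Reasoning
      w : Vec n
      w i = ∑ n (λ j → G i j * v j)
      rearrange : ∀ t s u → t * s * u ≡ s * (t * u)
      rearrange = solve-∀

    ⟪⟫-⊙ʳ : ∀ v y → ⟪ G ⟫ v (U ⊙ y) ≡ ∑ k (λ b → ⟪ G ⟫ v (λ i → U i b) * y b)
    ⟪⟫-⊙ʳ v y = begin
      ∑ n (λ i → v i * ∑ n (λ j → G i j * ∑ k (λ b → U j b * y b)))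
        ≡⟨ ∑-cong n (λ i → trans (cong (v i *_) (inner i)) (sym (∑-*ˡ k (v i) _))) ⟩
      ∑ n (λ i → ∑ k (λ b → v i * (∑ n (λ j → G i j * U j b) * y b)))
        ≡⟨ ∑-swap n k _ ⟩
      ∑ k (λ b → ∑ n (λ i → v i * (∑ n (λ j → G i j * U j b) * y b)))
        ≡⟨ ∑-cong k (λ b → trans (∑-cong n (λ i → sym (*-assoc (v i) _ (y b))))
                                 (∑-*ʳ n (y b) _)) ⟩
      ∑ k (λ b → ⟪ G ⟫ v (λ i → U i b) * y b) ∎
      where
      open ≡-Reasoning
      inner : ∀ i → ∑ n (λ j → G i j * ∑ k (λ b → U j b * y b))
                    ≡ ∑ k (λ b → ∑ n (λ j → G i j * U j b) * y b)
      inner i =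
        trans (∑-cong n (λ j → trans (sym (∑-*ˡ k (G i j) _))
                                     (∑-cong k (λ b → sym (*-assoc (G i j) (U j b) (y b))))))
        (trans (∑-swap n k _) (∑-cong k (λ b → ∑-*ʳ n (y b) _)))

    ⟪⟫-⊙ : ∀ x y → ⟪ G ⟫ (U ⊙ x) (U ⊙ y) ≡ ⟪ transpose U · (G · U) ⟫ x y
    ⟪⟫-⊙ x y = trans (⟪⟫-⊙ˡ x (U ⊙ y))
                     (∑-cong k (λ a → cong (x a *_) (⟪⟫-⊙ʳ (λ i → U i a) y)))

⟪⟫-congₘ : ∀ {n} {G H : Mat n n} → G ≈ₘ H → ∀ x y → ⟪ G ⟫ x y ≡ ⟪ H ⟫ x y
⟪⟫-congₘ {n} G≈H x y =
  ∑-cong n (λ i → cong (x i *_) (∑-cong n (λ j → cong (_* y j) (G≈H i j))))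

⟪⟫-scale : ∀ {n} c (G : Mat n n) x y → ⟪ (λ i j → c * G i j) ⟫ x y ≡ c * ⟪ G ⟫ x y
⟪⟫-scale {n} c G x y =
  trans (∑-cong n (λ i → trans
    (cong (x i *_) (trans (∑-cong n (λ j → *-assoc c (G i j) (y j))) (∑-*ˡ n c _)))
    (swap (x i) c _))) (∑-*ˡ n c _)
  where
  swap : ∀ a b d → a * (b * d) ≡ b * (a * d)
  swap = solve-∀

2-cases : ∀ {P : Fin 2 → Set} → P 0F → P 1F → ∀ i → P i
2-cases p₀ p₁ 0F = p₀
2-cases p₀ p₁ 1F = p₁

3-cases : ∀ {P : Fin 3 → Set} → P 0F → P 1F → P 2F → ∀ i → P i
3-cases p₀ p₁ p₂ 0F = p₀
3-cases p₀ p₁ p₂ 1F = p₁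
3-cases p₀ p₁ p₂ 2F = p₂

4-cases : ∀ {P : Fin 4 → Set} → P 0F → P 1F → P 2F → P 3F → ∀ i → P i
4-cases p₀ p₁ p₂ p₃ 0F = p₀
4-cases p₀ p₁ p₂ p₃ 1F = p₁
4-cases p₀ p₁ p₂ p₃ 2F = p₂
4-cases p₀ p₁ p₂ p₃ 3F = p₃

5-cases : ∀ {P : Fin 5 → Set} → P 0F → P 1F → P 2F → P 3F → P 4F → ∀ i → P i
5-cases p₀ p₁ p₂ p₃ p₄ 0F = p₀
5-cases p₀ p₁ p₂ p₃ p₄ 1F = p₁
5-cases p₀ p₁ p₂ p₃ p₄ 2F = p₂
5-cases p₀ p₁ p₂ p₃ p₄ 3F = p₃
5-cases p₀ p₁ p₂ p₃ p₄ 4F = p₄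

-- Hermitian forms over ℤ[i]

-- a|x|² + Re((e + if) x ȳ) + c|y|² at x = x₁ + ix₂ and y = y₁ + iy₂.
hermitian : ℤ → ℤ → ℤ → ℤ → ℤ → ℤ → ℤ → ℤ → ℤ
hermitian a e f c x₁ x₂ y₁ y₂ =
  a * (x₁ * x₁ + x₂ * x₂) + (e * (x₁ * y₁ + x₂ * y₂) + f * (x₁ * y₂ - x₂ * y₁))
  + c * (y₁ * y₁ + y₂ * y₂)


hermitianₚ : ∀ {n} → (a e f c x₁ x₂ y₁ y₂ : Polynomial n) → Polynomial n
hermitianₚ a e f c x₁ x₂ y₁ y₂ =
  a :* (x₁ :* x₁ :+ x₂ :* x₂) :+ (e :* (x₁ :* y₁ :+ x₂ :* y₂) :+ f :* (x₁ :* y₂ :- x₂ :* y₁))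
  :+ c :* (y₁ :* y₁ :+ y₂ :* y₂)


complex-square : ∀ a e f c x₁ x₂ y₁ y₂ →
  + 4 * c * hermitian a e f c x₁ x₂ y₁ y₂ ≡
    (+ 2 * c * y₁ + (e * x₁ - f * x₂)) * (+ 2 * c * y₁ + (e * x₁ - f * x₂))
  + (+ 2 * c * y₂ + (e * x₂ + f * x₁)) * (+ 2 * c * y₂ + (e * x₂ + f * x₁))
  + (+ 4 * c * a - e * e - f * f) * (x₁ * x₁ + x₂ * x₂)
complex-square = solve 8 (λ a e f c x₁ x₂ y₁ y₂ →
  con (+ 4) :* c :* hermitianₚ a e f c x₁ x₂ y₁ y₂ :=
    (con (+ 2) :* c :* y₁ :+ (e :* x₁ :- f :* x₂)) :* (con (+ 2) :* c :* y₁ :+ (e :* x₁ :- f :* x₂))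
  :+ (con (+ 2) :* c :* y₂ :+ (e :* x₂ :+ f :* x₁)) :* (con (+ 2) :* c :* y₂ :+ (e :* x₂ :+ f :* x₁))
  :+ (con (+ 4) :* c :* a :- e :* e :- f :* f) :* (x₁ :* x₁ :+ x₂ :* x₂)) refl

⟨_,_,_,_⟩ : ℤ → ℤ → ℤ → ℤ → Vec 4
⟨ x₁ , x₂ , y₁ , y₂ ⟩ 0F = x₁
⟨ x₁ , x₂ , y₁ , y₂ ⟩ 1F = x₂
⟨ x₁ , x₂ , y₁ , y₂ ⟩ 2F = y₁
⟨ x₁ , x₂ , y₁ , y₂ ⟩ 3F = y₂

Hermitian : ℤ → ℤ → ℤ → ℤ → Vec 4 → ℤ
Hermitian a e f c u = hermitian a e f c (u 0F) (u 1F) (u 2F) (u 3F)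

-- The reduced norm of x + yω in the order ℤ[i] + ℤ[i]ω of discriminant 7, where ω² = ω - 2 and iω = (1 - ω)i.
Norm : Vec 4 → ℤ
Norm = Hermitian (+ 1) (+ 1) 0ℤ (+ 2)

-- Proportionality over ℤ[i].
_∥_ : Vec 4 → Vec 4 → Set
u ∥ v = (u 0F * v 2F - u 1F * v 3F ≡ v 0F * u 2F - v 1F * u 3F)
      × (u 0F * v 3F + u 1F * v 2F ≡ v 0F * u 3F + v 1F * u 2F)

InFirstAxis : Vec 4 → Set
InFirstAxis u = u 2F ≡ 0ℤ × u 3F ≡ 0ℤ

-- Every `φ` constructed below is a ℤ[i]-linear change of basis. `φ-axis` keeps the consequence of
-- linearity that matters later: the preimage of the line ℤ[i] is contained in a line. When the form
-- comes from a left ideal, `one` corresponds to a generator.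
record Standardisation (a e f c : ℤ) : Set where
  field
    φ        : Vec 4 → Vec 4
    φ-cong   : ∀ {u v} → u ≈ᵥ v → φ u ≈ᵥ φ v
    φ-+      : ∀ u v → φ (u +ᵥ v) ≈ᵥ (φ u +ᵥ φ v)
    φ-norm   : ∀ u → Norm (φ u) ≡ Hermitian a e f c u
    φ-axis   : ∀ u v → InFirstAxis (φ u) → InFirstAxis (φ v) → u ∥ v
    one      : Vec 4
    one-norm : Hermitian a e f c one ≡ 1ℤ

module _ where
  open Standardisation

  ≡-via : ∀ {a b c d} → a ≡ b → a - b ≡ c - d → c ≡ d
  ≡-via a≡b eq = ℤ.i-j≡0⇒i≡j _ _ (trans (sym eq) (ℤ.i≡j⇒i-j≡0 a≡b))

  standard⁺ : Standardisation (+ 1) (+ 1) 0ℤ (+ 2)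
  standard⁺ .φ u = u
  standard⁺ .φ-cong u≈v = u≈v
  standard⁺ .φ-+ u v i = refl
  standard⁺ .φ-norm u = refl
  standard⁺ .φ-axis u v (u₂≡0 , u₃≡0) (v₂≡0 , v₃≡0) rewrite u₂≡0 | u₃≡0 | v₂≡0 | v₃≡0 =
    vanish (u 0F) (u 1F) (v 0F) (v 1F) , vanish′ (u 0F) (u 1F) (v 0F) (v 1F)
    where
    vanish : ∀ a b c d → a * + 0 - b * + 0 ≡ c * + 0 - d * + 0
    vanish = solve-∀
    vanish′ : ∀ a b c d → a * + 0 + b * + 0 ≡ c * + 0 + d * + 0
    vanish′ = solve-∀
  standard⁺ .one = ⟨ 1ℤ , 0ℤ , 0ℤ , 0ℤ ⟩
  standard⁺ .one-norm = refl

  module _ {a e f c : ℤ} (s t : ℤ)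
    (S : Standardisation a (e + + 2 * a * s) (f + + 2 * a * t)
                         (c + a * (s * s + t * t) + e * s + f * t)) where

    -- In complex notation x ↦ x ∓ (s - it)y with y fixed; the substitution changes the middle
    -- coefficient e + if by 2a(s + it).
    shift unshift : Vec 4 → Vec 4
    shift   u = ⟨ u 0F - (s * u 2F + t * u 3F) , u 1F - (s * u 3F - t * u 2F) , u 2F , u 3F ⟩
    unshift u = ⟨ u 0F + (s * u 2F + t * u 3F) , u 1F + (s * u 3F - t * u 2F) , u 2F , u 3F ⟩

    translate : Standardisation a e f c
    translate .φ u = φ S (shift u)
    translate .φ-cong u≈v = φ-cong S (4-cases
      (cong₂ _-_ (u≈v 0F) (cong₂ _+_ (cong (s *_) (u≈v 2F)) (cong (t *_) (u≈v 3F))))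
      (cong₂ _-_ (u≈v 1F) (cong₂ _-_ (cong (s *_) (u≈v 3F)) (cong (t *_) (u≈v 2F))))
      (u≈v 2F) (u≈v 3F))
    translate .φ-+ u v i = trans
      (φ-cong S (4-cases (split⁻ s t (u 0F) (u 2F) (u 3F) (v 0F) (v 2F) (v 3F))
                         (split⁺ s t (u 1F) (u 3F) (u 2F) (v 1F) (v 3F) (v 2F)) refl refl) i)
      (φ-+ S (shift u) (shift v) i)
      where
      split⁻ : ∀ s t a b c a′ b′ c′ →
        a + a′ - (s * (b + b′) + t * (c + c′)) ≡ a - (s * b + t * c) + (a′ - (s * b′ + t * c′))
      split⁻ = solve-∀
      split⁺ : ∀ s t a b c a′ b′ c′ →
        a + a′ - (s * (b + b′) - t * (c + c′)) ≡ a - (s * b - t * c) + (a′ - (s * b′ - t * c′))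
      split⁺ = solve-∀
    translate .φ-norm u = trans (φ-norm S (shift u)) (solve 10 (λ a e f c s t x₁ x₂ y₁ y₂ →
      hermitianₚ a (e :+ con (+ 2) :* a :* s) (f :+ con (+ 2) :* a :* t)
        (c :+ a :* (s :* s :+ t :* t) :+ e :* s :+ f :* t)
        (x₁ :- (s :* y₁ :+ t :* y₂)) (x₂ :- (s :* y₂ :- t :* y₁)) y₁ y₂
      := hermitianₚ a e f c x₁ x₂ y₁ y₂) refl
      a e f c s t (u 0F) (u 1F) (u 2F) (u 3F))
    translate .φ-axis u v φu φv with re , im ← φ-axis S (shift u) (shift v) φu φv =
        ≡-via re (re-invariant s t (u 0F) (u 1F) (u 2F) (u 3F) (v 0F) (v 1F) (v 2F) (v 3F))
      , ≡-via im (im-invariant s t (u 0F) (u 1F) (u 2F) (u 3F) (v 0F) (v 1F) (v 2F) (v 3F))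
      where
      re-invariant : ∀ s t a b c d a′ b′ c′ d′ →
        (a - (s * c + t * d)) * c′ - (b - (s * d - t * c)) * d′
          - ((a′ - (s * c′ + t * d′)) * c - (b′ - (s * d′ - t * c′)) * d)
        ≡ a * c′ - b * d′ - (a′ * c - b′ * d)
      re-invariant = solve-∀
      im-invariant : ∀ s t a b c d a′ b′ c′ d′ →
        (a - (s * c + t * d)) * d′ + (b - (s * d - t * c)) * c′
          - ((a′ - (s * c′ + t * d′)) * d + (b′ - (s * d′ - t * c′)) * c)
        ≡ a * d′ + b * c′ - (a′ * d + b′ * c)
      im-invariant = solve-∀
    translate .one = unshift (one S)
    translate .one-norm = trans (sym (solve 10 (λ a e f c s t x₁ x₂ y₁ y₂ →
      hermitianₚ a (e :+ con (+ 2) :* a :* s) (f :+ con (+ 2) :* a :* t)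
        (c :+ a :* (s :* s :+ t :* t) :+ e :* s :+ f :* t) x₁ x₂ y₁ y₂
      := hermitianₚ a e f c (x₁ :+ (s :* y₁ :+ t :* y₂)) (x₂ :+ (s :* y₂ :- t :* y₁)) y₁ y₂) refl
      a e f c s t (one S 0F) (one S 1F) (one S 2F) (one S 3F))) (one-norm S)

  module _ {a e f c : ℤ} (S : Standardisation c e (- f) a) where

    transposed : Vec 4 → Vec 4
    transposed u = ⟨ u 2F , u 3F , u 0F , u 1F ⟩

    exchange : Standardisation a e f c
    exchange .φ u = φ S (transposed u)
    exchange .φ-cong u≈v = φ-cong S (4-cases (u≈v 2F) (u≈v 3F) (u≈v 0F) (u≈v 1F))
    exchange .φ-+ u v i = trans
      (φ-cong S (4-cases refl refl refl refl) i) (φ-+ S (transposed u) (transposed v) i)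
    exchange .φ-norm u = trans (φ-norm S (transposed u)) (solve 8 (λ a e f c x₁ x₂ y₁ y₂ →
      hermitianₚ c e (:- f) a y₁ y₂ x₁ x₂ := hermitianₚ a e f c x₁ x₂ y₁ y₂) refl
      a e f c (u 0F) (u 1F) (u 2F) (u 3F))
    exchange .φ-axis u v φu φv with re , im ← φ-axis S (transposed u) (transposed v) φu φv =
        ≡-via (sym re) (re-swap (u 0F) (u 1F) (u 2F) (u 3F) (v 0F) (v 1F) (v 2F) (v 3F))
      , ≡-via (sym im) (im-swap (u 0F) (u 1F) (u 2F) (u 3F) (v 0F) (v 1F) (v 2F) (v 3F))
      where
      re-swap : ∀ a b c d a′ b′ c′ d′ →
        c′ * a - d′ * b - (c * a′ - d * b′) ≡ a * c′ - b * d′ - (a′ * c - b′ * d)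
      re-swap = solve-∀
      im-swap : ∀ a b c d a′ b′ c′ d′ →
        c′ * b + d′ * a - (c * b′ + d * a′) ≡ a * d′ + b * c′ - (a′ * d + b′ * c)
      im-swap = solve-∀
    exchange .one = transposed (one S)
    exchange .one-norm = trans (sym (solve 8 (λ a e f c x₁ x₂ y₁ y₂ →
      hermitianₚ c e (:- f) a x₁ x₂ y₁ y₂ := hermitianₚ a e f c y₁ y₂ x₁ x₂) refl
      a e f c (one S 0F) (one S 1F) (one S 2F) (one S 3F))) (one-norm S)

  standard⁻ : Standardisation (+ 1) -[1+ 0 ] 0ℤ (+ 2)
  standard⁻ .φ u = ⟨ - u 0F , - u 1F , u 2F , u 3F ⟩
  standard⁻ .φ-cong u≈v = 4-cases (cong -_ (u≈v 0F)) (cong -_ (u≈v 1F)) (u≈v 2F) (u≈v 3F)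
  standard⁻ .φ-+ u v = 4-cases (ℤ.neg-distrib-+ (u 0F) (v 0F)) (ℤ.neg-distrib-+ (u 1F) (v 1F)) refl refl
  standard⁻ .φ-norm u = solve 4 (λ x₁ x₂ y₁ y₂ →
      hermitianₚ (con (+ 1)) (con (+ 1)) (con 0ℤ) (con (+ 2)) (:- x₁) (:- x₂) y₁ y₂
      := hermitianₚ (con (+ 1)) (con -[1+ 0 ]) (con 0ℤ) (con (+ 2)) x₁ x₂ y₁ y₂) refl
      (u 0F) (u 1F) (u 2F) (u 3F)
  standard⁻ .φ-axis u v = φ-axis standard⁺ u v
  standard⁻ .one = ⟨ 1ℤ , 0ℤ , 0ℤ , 0ℤ ⟩
  standard⁻ .one-norm = refl

data Odd (e : ℤ) : Set where
  odd : ∀ k → e ≡ 1ℤ + + 2 * k → Odd e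

data Even (e : ℤ) : Set where
  even : ∀ k → e ≡ + 2 * k → Even e

2*≢1 : ∀ k → + 2 * k ≢ 1ℤ
2*≢1 k eq with () ← ℕ.even≢odd ∣ k ∣ 0 (trans (sym (ℤ.abs-* (+ 2) k)) (cong ∣_∣ eq))

odd≢even : ∀ {e} → Odd e → Even e → ⊥
odd≢even (odd k refl) (even l eq) = 2*≢1 (l - k) (trans (halves k l) (trans (cong (_- _) (sym eq)) (cancel k)))
  where
  halves : ∀ k l → + 2 * (l - k) ≡ + 2 * l - + 2 * k
  halves = solve-∀
  cancel : ∀ k → 1ℤ + + 2 * k - + 2 * k ≡ 1ℤ
  cancel = solve-∀

centred : ∀ e a .{{_ : ℕ.NonZero a}} → ∃ λ s → ∣ e + + 2 * + a * s ∣ ≤ a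
centred e a@(suc _) with (e ℤ.%ℕ (2 ℕ.* a)) ℕ.≤? a
... | yes r≤a = - q , subst (λ i → ∣ i ∣ ≤ a) (sym eq) r≤a
  where
  d = 2 ℕ.* a
  q = e ℤ./ℕ d
  r = e ℤ.%ℕ d
  cancel : ∀ r q d → r + q * d + d * - q ≡ r
  cancel = solve-∀
  eq : e + + 2 * + a * - q ≡ + r
  eq = trans (cong₂ _+_ (ℤ.a≡a%ℕn+[a/ℕn]*n e d) (cong (_* - q) (sym (ℤ.pos-* 2 a)))) (cancel (+ r) q (+ d))
... | no r≰a = - q - 1ℤ , subst (_≤ a) (sym (trans (cong ∣_∣ eq) (ℤ.∣⊖∣-≤ r≤d))) d-r≤a
  where
  d = 2 ℕ.* a
  q = e ℤ./ℕ d
  r = e ℤ.%ℕ d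
  r≤d : r ≤ d
  r≤d = ℕ.<⇒≤ (ℤ.n%ℕd<d e d)
  d-r≤a : d ℕ.∸ r ≤ a
  d-r≤a = ℕ.≤-trans (ℕ.∸-monoʳ-≤ d (ℕ.<⇒≤ (ℕ.≰⇒> r≰a)))
            (ℕ.≤-reflexive (trans (ℕ.m+n∸m≡n a (a ℕ.+ 0)) (ℕ.+-identityʳ a)))
  cancel : ∀ r q d → r + q * d + d * (- q - 1ℤ) ≡ r - d
  cancel = solve-∀
  eq : e + + 2 * + a * (- q - 1ℤ) ≡ r ℤ.⊖ d
  eq = trans (cong₂ _+_ (ℤ.a≡a%ℕn+[a/ℕn]*n e d) (cong (_* (- q - 1ℤ)) (sym (ℤ.pos-* 2 a))))
         (trans (cancel (+ r) q (+ d)) (ℤ.m-n≡m⊖n r d))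

square-abs : ∀ i → i * i ≡ + (∣ i ∣ ℕ.* ∣ i ∣)
square-abs (+ n)    = sym (ℤ.pos-* n n)
square-abs -[1+ n ] = refl

square≡0 : ∀ i → ∣ i ∣ ℕ.* ∣ i ∣ ≡ 0 → i ≡ 0ℤ
square≡0 i eq with ℕ.m*n≡0⇒m≡0∨n≡0 ∣ i ∣ eq
... | inj₁ ∣i∣≡0 = ℤ.∣i∣≡0⇒i≡0 ∣i∣≡0
... | inj₂ ∣i∣≡0 = ℤ.∣i∣≡0⇒i≡0 ∣i∣≡0

disc : ℤ → ℤ → ℤ → ℤ → ℤ
disc a e f c = + 4 * c * a - e * e - f * f

disc-translate : ∀ a e f c s t →
  disc a (e + + 2 * a * s) (f + + 2 * a * t) (c + a * (s * s + t * t) + e * s + f * t) ≡ disc a e f c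
disc-translate = solve 6 (λ a e f c s t →
  discₚ a (e :+ con (+ 2) :* a :* s) (f :+ con (+ 2) :* a :* t)
          (c :+ a :* (s :* s :+ t :* t) :+ e :* s :+ f :* t) := discₚ a e f c) refl
  where
  discₚ : ∀ {n} → (a e f c : Polynomial n) → Polynomial n
  discₚ a e f c = con (+ 4) :* c :* a :- e :* e :- f :* f

disc-exchange : ∀ a e f c → disc c e (- f) a ≡ disc a e f c
disc-exchange = solve 4 (λ a e f c →
  con (+ 4) :* a :* c :- e :* e :- (:- f) :* (:- f) := con (+ 4) :* c :* a :- e :* e :- f :* f) refl

odd-translate : ∀ {e} a s → Odd e → Odd (e + + 2 * a * s)
odd-translate a s (odd k refl) = odd (k + a * s) (regroup k a s)
  where
  regroup : ∀ k a s → 1ℤ + + 2 * k + + 2 * a * s ≡ 1ℤ + + 2 * (k + a * s)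
  regroup = solve-∀

even-translate : ∀ {e} a s → Even e → Even (e + + 2 * a * s)
even-translate a s (even k refl) = even (k + a * s) (regroup k a s)
  where
  regroup : ∀ k a s → + 2 * k + + 2 * a * s ≡ + 2 * (k + a * s)
  regroup = solve-∀

even-neg : ∀ {e} → Even e → Even (- e)
even-neg (even k refl) = even (- k) (ℤ.neg-distribʳ-* (+ 2) k)

-- Since 4c(a + 1) = e² + f² + 7 is positive, c cannot be negative. This lets the reduction descend
-- in ℕ.
disc⇒ℕ : ∀ a e f c → disc (+ suc a) e f c ≡ + 7 →
  ∃ λ c′ → c ≡ + c′ × 4 ℕ.* c′ ℕ.* suc a ≡ ∣ e ∣ ℕ.* ∣ e ∣ ℕ.+ ∣ f ∣ ℕ.* ∣ f ∣ ℕ.+ 7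
disc⇒ℕ a e f c d≡7 with trans (move (+ 4 * c * + suc a) (e * e) (f * f))
    (trans (cong (_+_ (e * e + f * f)) d≡7) (cong₂ (λ x y → x + y + + 7) (square-abs e) (square-abs f)))
  where
  move : ∀ x y z → x ≡ y + z + (x - y - z)
  move = solve-∀
disc⇒ℕ a e f (+ c′) d≡7 | eq = c′ , refl , ℤ.+-injective
  (trans (ℤ.pos-* (4 ℕ.* c′) (suc a)) (trans (cong (_* + suc a) (ℤ.pos-* 4 c′)) eq))
disc⇒ℕ a e f -[1+ c′ ] d≡7 | ()

-- The right-hand side is at most 2a² + 7, which is less than 4a² from a = 2 on.
4ca<4aa : ∀ c a e f → 2 ≤ a → e ≤ a → f ≤ a → 4 ℕ.* c ℕ.* a ≡ e ℕ.* e ℕ.+ f ℕ.* f ℕ.+ 7 → c < a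
4ca<4aa c a@(suc (suc b)) e f (s≤s (s≤s z≤n)) e≤a f≤a eq =
  ℕ.*-cancelˡ-< 4 c a (ℕ.*-cancelʳ-< a (4 ℕ.* c) (4 ℕ.* a) (begin-strict
    4 ℕ.* c ℕ.* a                   ≡⟨ eq ⟩
    e ℕ.* e ℕ.+ f ℕ.* f ℕ.+ 7       <⟨ ℕ.+-mono-≤-< (ℕ.+-mono-≤ (ℕ.*-mono-≤ e≤a e≤a) (ℕ.*-mono-≤ f≤a f≤a)) (ℕ.n<1+n 7) ⟩
    a ℕ.* a ℕ.+ a ℕ.* a ℕ.+ 8       ≤⟨ ℕ.m≤m+n _ (2 ℕ.* b ℕ.* b ℕ.+ 8 ℕ.* b) ⟩
    a ℕ.* a ℕ.+ a ℕ.* a ℕ.+ 8 ℕ.+ (2 ℕ.* b ℕ.* b ℕ.+ 8 ℕ.* b) ≡⟨ expand b ⟩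
    4 ℕ.* a ℕ.* a ∎))
  where
  open ℕ.≤-Reasoning
  expand : ∀ b → (2 ℕ.+ b) ℕ.* (2 ℕ.+ b) ℕ.+ (2 ℕ.+ b) ℕ.* (2 ℕ.+ b) ℕ.+ 8 ℕ.+ (2 ℕ.* b ℕ.* b ℕ.+ 8 ℕ.* b)
                 ≡ 4 ℕ.* (2 ℕ.+ b) ℕ.* (2 ℕ.+ b)
  expand = ℕ-Ring.solve-∀

-- The parities single out one class: at a = 1 they leave only e = ±1, f = 0 and c = 2. For a ≥ 2 a
-- reduced form has c < a, so exchanging the two variables lowers the leading coefficient.
standardise-reduced : ∀ a .{{_ : ℕ.NonZero a}} e f c → Odd e → Even f → ∣ e ∣ ≤ a → ∣ f ∣ ≤ a →
  disc (+ a) e f (+ c) ≡ + 7 →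
  (∀ b .{{_ : ℕ.NonZero b}} → b < a → ∀ g h d → Odd g → Even h → disc (+ b) g h (+ d) ≡ + 7 →
     Standardisation (+ b) g h (+ d)) →
  Standardisation (+ a) e f (+ c)
standardise-reduced 1 e f c e-odd f-even ∣e∣≤1 ∣f∣≤1 d≡7 rec = unit e f e-odd f-even ∣e∣≤1 ∣f∣≤1
  (disc⇒ℕ 0 e f (+ c) d≡7)
  where
  unit : ∀ e f → Odd e → Even f → ∣ e ∣ ≤ 1 → ∣ f ∣ ≤ 1 →
    (∃ λ c′ → + c ≡ + c′ × 4 ℕ.* c′ ℕ.* 1 ≡ ∣ e ∣ ℕ.* ∣ e ∣ ℕ.+ ∣ f ∣ ℕ.* ∣ f ∣ ℕ.+ 7) →
    Standardisation (+ 1) e f (+ c)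
  unit (+ 0)    f o _ _ _ _ = contradiction (even 0ℤ refl) (odd≢even o)
  unit (+ 1)    (+ 1) _ v _ _ _ = contradiction v (odd≢even (odd 0ℤ refl))
  unit (+ 1)    -[1+ 0 ] _ v _ _ _ = contradiction v (odd≢even (odd -[1+ 0 ] refl))
  unit -[1+ 0 ] (+ 1) _ v _ _ _ = contradiction v (odd≢even (odd 0ℤ refl))
  unit -[1+ 0 ] -[1+ 0 ] _ v _ _ _ = contradiction v (odd≢even (odd -[1+ 0 ] refl))
  unit (+ 1)    (+ 0) _ _ _ _ (_ , refl , eq) with refl ← ℕ.*-cancelˡ-≡ c 2 4 (trans (sym (ℕ.*-identityʳ _)) eq) = standard⁺
  unit -[1+ 0 ] (+ 0) _ _ _ _ (_ , refl , eq) with refl ← ℕ.*-cancelˡ-≡ c 2 4 (trans (sym (ℕ.*-identityʳ _)) eq) = standard⁻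
  unit (+ (suc (suc _))) _ _ _ (s≤s ()) _ _
  unit -[1+ suc _ ] _ _ _ (s≤s ()) _ _
  unit _ (+ (suc (suc _))) _ _ _ (s≤s ()) _
  unit _ -[1+ suc _ ] _ _ _ (s≤s ()) _
standardise-reduced a@(suc a′@(suc _)) e f c e-odd f-even ∣e∣≤a ∣f∣≤a d≡7 rec
  with disc⇒ℕ a′ e f (+ c) d≡7
standardise-reduced (suc (suc _)) e f 0 _ _ _ _ _ _ | _ , refl , eq with () ← ℕ.m+1+n≢0 (∣ e ∣ ℕ.* ∣ e ∣ ℕ.+ ∣ f ∣ ℕ.* ∣ f ∣) (sym eq)
standardise-reduced a@(suc (suc _)) e f c@(suc _) e-odd f-even ∣e∣≤a ∣f∣≤a d≡7 rec | _ , refl , eq =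
  exchange (rec c (4ca<4aa c a ∣ e ∣ ∣ f ∣ (s≤s (s≤s z≤n)) ∣e∣≤a ∣f∣≤a eq)
                e (- f) a e-odd (even-neg f-even) (trans (disc-exchange (+ a) e f (+ c)) d≡7))

standardise : ∀ a .{{_ : ℕ.NonZero a}} → Acc _<_ a → ∀ e f c → Odd e → Even f →
  disc (+ a) e f (+ c) ≡ + 7 → Standardisation (+ a) e f (+ c)
standardise a@(suc a′) (acc rs) e f c e-odd f-even d≡7
  with centred e a | centred f a
... | s , ∣e′∣≤a | t , ∣f′∣≤a =
  translate s t (reduced _ _ _ (odd-translate (+ a) s e-odd) (even-translate (+ a) t f-even)
    ∣e′∣≤a ∣f′∣≤a (trans (disc-translate (+ a) e f (+ c) s t) d≡7))
  where
  reduced : ∀ e f c → Odd e → Even f → ∣ e ∣ ≤ a → ∣ f ∣ ≤ a → disc (+ a) e f c ≡ + 7 →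
            Standardisation (+ a) e f c
  reduced e f c e-odd f-even ∣e∣≤a ∣f∣≤a d≡7 with disc⇒ℕ a′ e f c d≡7
  ... | c′ , refl , _ = standardise-reduced a e f c′ e-odd f-even ∣e∣≤a ∣f∣≤a d≡7
                          (λ b b<a → standardise b (rs b<a))

-- Arithmetic modulo a prime

∣-subst : ∀ {k m n} → m ≡ n → k ∣ m → k ∣ n
∣-subst refl k∣m = k∣m

parity : ∀ e → Even e ⊎ Odd e
parity e with e ℤ.%ℕ 2 | ℤ.n%ℕd<d e 2 | ℤ.a≡a%ℕn+[a/ℕn]*n e 2
... | 0 | _ | eq = inj₁ (even (e ℤ./ℕ 2) (trans eq (trans (ℤ.+-identityˡ _) (ℤ.*-comm (e ℤ./ℕ 2) (+ 2)))))
... | 1 | _ | eq = inj₂ (odd (e ℤ./ℕ 2) (trans eq (cong (_+_ 1ℤ) (ℤ.*-comm (e ℤ./ℕ 2) (+ 2)))))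
... | suc (suc _) | s≤s (s≤s ()) | _

even+odd : ∀ {a b} → Even a → Odd b → Odd (a + b)
even+odd (even k refl) (odd l refl) = odd (k + l) (eq k l)
  where
  eq : ∀ k l → + 2 * k + (1ℤ + + 2 * l) ≡ 1ℤ + + 2 * (k + l)
  eq = solve-∀

odd+odd : ∀ {a b} → Odd a → Odd b → Even (a + b)
odd+odd (odd k refl) (odd l refl) = even (1ℤ + k + l) (eq k l)
  where
  eq : ∀ k l → 1ℤ + + 2 * k + (1ℤ + + 2 * l) ≡ + 2 * (1ℤ + k + l)
  eq = solve-∀

halve : ∀ {p} q r → Odd p → q * p ≡ + 2 * r → Even q
halve q r (odd h refl) eq =
  even (r - q * h) (trans (expand q h) (trans (cong (_- + 2 * (q * h)) eq) (factor r q h)))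
  where
  expand : ∀ q h → q ≡ q * (1ℤ + + 2 * h) - + 2 * (q * h)
  expand = solve-∀
  factor : ∀ r q h → + 2 * r - + 2 * (q * h) ≡ + 2 * (r - q * h)
  factor = solve-∀

odd-adjust : ∀ {p} → Odd p → ∀ x → ∃ λ e → Odd e × p ∣ e - x
odd-adjust {p} p-odd x with parity x
... | inj₂ x-odd  = x , x-odd , divides 0ℤ (ℤ.+-inverseʳ x)
... | inj₁ x-even = x + p , even+odd x-even p-odd , divides 1ℤ (eq x p)
  where
  eq : ∀ x p → x + p - x ≡ 1ℤ * p
  eq = solve-∀

even-adjust : ∀ {p} → Odd p → ∀ x → ∃ λ e → Even e × p ∣ e - x
even-adjust {p} p-odd x with parity x
... | inj₁ x-even = x , x-even , divides 0ℤ (ℤ.+-inverseʳ x)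
... | inj₂ x-odd  = x + p , odd+odd x-odd p-odd , divides 1ℤ (eq x p)
  where
  eq : ∀ x p → x + p - x ≡ 1ℤ * p
  eq = solve-∀

module _ {p : ℕ} (p-prime : Prime p) where
  private instance
    p≢0 : ℕ.NonZero p
    p≢0 = prime⇒nonZero p-prime

  1<p : 1 < p
  1<p = ℕ.nonTrivial⇒n>1 p {{prime⇒nonTrivial p-prime}}

  euclid : ∀ a b → + p ∣ a * b → (+ p ∣ a) ⊎ (+ p ∣ b)
  euclid a b p∣ab with euclidsLemma ∣ a ∣ ∣ b ∣ p-prime (subst (p ℕ.∣_) (ℤ.abs-* a b) (∣⇒∣ᵤ p∣ab))
  ... | inj₁ p∣a = inj₁ (∣ᵤ⇒∣ p∣a)
  ... | inj₂ p∣b = inj₂ (∣ᵤ⇒∣ p∣b)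

  inverse-mod : ∀ a → ¬ (+ p ∣ a) → ∃ λ b → + p ∣ a * b - 1ℤ
  inverse-mod a p∤a with a ℤ.%ℕ p | ℤ.n%ℕd<d a p | ℤ.a≡a%ℕn+[a/ℕn]*n a p
  ... | 0 | _ | eq = contradiction (divides (a ℤ./ℕ p) (trans eq (ℤ.+-identityˡ _))) p∤a
  ... | r@(suc _) | r<p | eq with coprime-Bézout (prime⇒coprime p-prime r<p)
  ...   | Bézout.-+ x y 1+xp≡yr = + y , divides (+ x + q * + y)
            (trans (cong (λ z → z * + y - 1ℤ) eq) (trans (rearrange (+ r) q (+ p) (+ y))
            (trans (cong (λ z → z - 1ℤ + q * + y * + p) (sym ints)) (collect (+ x) (+ p) (q * + y)))))
    where
    q = a ℤ./ℕ p
    ints : 1ℤ + + x * + p ≡ + y * + r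
    ints = trans (cong (_+_ 1ℤ) (sym (ℤ.pos-* x p))) (trans (cong +_ 1+xp≡yr) (ℤ.pos-* y r))
    rearrange : ∀ r q p y → (r + q * p) * y - 1ℤ ≡ y * r - 1ℤ + q * y * p
    rearrange = solve-∀
    collect : ∀ x p z → 1ℤ + x * p - 1ℤ + z * p ≡ (x + z) * p
    collect = solve-∀
  ...   | Bézout.+- x y 1+yr≡xp = - + y , divides (- + x - q * + y)
            (trans (cong (λ z → z * - + y - 1ℤ) eq) (trans (rearrange (+ r) q (+ p) (+ y))
            (trans (cong (λ z → - z - q * + y * + p) ints) (collect (+ x) (+ p) (q * + y)))))
    where
    q = a ℤ./ℕ p
    ints : 1ℤ + + y * + r ≡ + x * + p
    ints = trans (cong (_+_ 1ℤ) (sym (ℤ.pos-* y r))) (trans (cong +_ 1+yr≡xp) (ℤ.pos-* x p))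
    rearrange : ∀ r q p y → (r + q * p) * - y - 1ℤ ≡ - (1ℤ + y * r) - q * y * p
    rearrange = solve-∀
    collect : ∀ x p z → - (x * p) - z * p ≡ (- x - z) * p
    collect = solve-∀

  residue-collision : ∀ {n} → p < n → (f : Fin n → ℤ) →
                      ∃₂ λ i j → toℕ i < toℕ j × + p ∣ f i - f j
  residue-collision p<n f
    with i , j , i<j , eq ← Fin.pigeonhole p<n (λ i → fromℕ< (ℤ.n%ℕd<d (f i) p)) =
    i , j , i<j , divides (f i ℤ./ℕ p - f j ℤ./ℕ p)
      (trans (cong₂ _-_ (trans (ℤ.a≡a%ℕn+[a/ℕn]*n (f i) p) (cong (λ r → + r + f i ℤ./ℕ p * + p) residues))
                        (ℤ.a≡a%ℕn+[a/ℕn]*n (f j) p))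
             (collect (+ (f j ℤ.%ℕ p)) (f i ℤ./ℕ p) (f j ℤ./ℕ p) (+ p)))
    where
    residues : f i ℤ.%ℕ p ≡ f j ℤ.%ℕ p
    residues = trans (sym (Fin.toℕ-fromℕ< (ℤ.n%ℕd<d (f i) p)))
                 (trans (cong toℕ eq) (Fin.toℕ-fromℕ< (ℤ.n%ℕd<d (f j) p)))
    collect : ∀ r a b p → r + a * p - (r + b * p) ≡ (a - b) * p
    collect = solve-∀

  small-multiple : ∀ n → n < p → + p ∣ + n → n ≡ 0
  small-multiple 0       _   _   = refl
  small-multiple (suc n) n<p p∣n = contradiction (ℕ.∣⇒≤ (∣⇒∣ᵤ p∣n)) (ℕ.<⇒≱ n<p)

  -- Otherwise p divides (b - a)(b + a), and both factors lie strictly between 0 and p.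
  squares-distinct : ∀ {h} → p ≡ suc (2 ℕ.* h) → ∀ a b → a < b → b ≤ h →
                     ¬ (+ p ∣ + a * + a - + b * + b)
  squares-distinct {h} p≡ a b a<b b≤h p∣ with euclid (+ b - + a) (+ b + + a)
      (∣-subst (factor (+ a) (+ b)) (∣m⇒∣-m p∣))
    where
    factor : ∀ a b → - (a * a - b * b) ≡ (b - a) * (b + a)
    factor = solve-∀
  ... | inj₁ p∣b-a = ℕ.m>n⇒m∸n≢0 a<b (small-multiple (b ℕ.∸ a) b-a<p
          (∣-subst (trans (ℤ.m-n≡m⊖n b a) (ℤ.⊖-≥ (ℕ.<⇒≤ a<b))) p∣b-a))
    where
    b-a<p : b ℕ.∸ a < p
    b-a<p = ℕ.≤-<-trans (ℕ.m∸n≤m b a) (ℕ.≤-<-trans b≤h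
              (subst (h <_) (sym p≡) (s≤s (ℕ.m≤m+n h (h ℕ.+ 0)))))
  ... | inj₂ p∣b+a = contradiction (ℕ.m+n≡0⇒m≡0 b (small-multiple (b ℕ.+ a) b+a<p p∣b+a))
                       (ℕ.>⇒≢ (ℕ.≤-<-trans z≤n a<b))
    where
    b+a<p : b ℕ.+ a < p
    b+a<p = subst (b ℕ.+ a <_) (sym p≡) (s≤s (ℕ.+-mono-≤ b≤h
              (ℕ.≤-trans (ℕ.≤-trans (ℕ.<⇒≤ a<b) b≤h) (ℕ.≤-reflexive (sym (ℕ.+-identityʳ h))))))

  module _ {h : ℕ} (p≡ : p ≡ suc (2 ℕ.* h)) where

    private
      value : Fin (suc h) ⊎ Fin (suc h) → ℤ
      value (inj₁ i) = + toℕ i * + toℕ i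
      value (inj₂ j) = - (+ toℕ j * + toℕ j + + 7)

      toℕ≤h : ∀ (i : Fin (suc h)) → toℕ i ≤ h
      toℕ≤h i = ℕ.≤-pred (Fin.toℕ<n i)

      equal-squares : ∀ (i j : Fin (suc h)) → + p ∣ + toℕ i * + toℕ i - + toℕ j * + toℕ j → i ≡ j
      equal-squares i j p∣ with ℕ.<-cmp (toℕ i) (toℕ j)
      ... | tri< i<j _ _ = contradiction p∣ (squares-distinct p≡ (toℕ i) (toℕ j) i<j (toℕ≤h j))
      ... | tri≈ _ i≡j _ = Fin.toℕ-injective i≡j
      ... | tri> _ _ j<i = contradiction (∣-subst (swap (+ toℕ i) (+ toℕ j)) (∣m⇒∣-m p∣))
                             (squares-distinct p≡ (toℕ j) (toℕ i) j<i (toℕ≤h i))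
        where
        swap : ∀ a b → - (a * a - b * b) ≡ b * b - a * a
        swap = solve-∀

      p<2+2h : p < suc h ℕ.+ suc h
      p<2+2h = subst (_< suc h ℕ.+ suc h) (sym p≡) (s≤s (ℕ.≤-reflexive (eq h)))
        where
        eq : ∀ h → suc (2 ℕ.* h) ≡ h ℕ.+ suc h
        eq = ℕ-Ring.solve-∀

      splitAt-injective : ∀ {i j} → splitAt (suc h) {suc h} i ≡ splitAt (suc h) j → i ≡ j
      splitAt-injective {i} {j} eq = trans (sym (Fin.join-splitAt (suc h) (suc h) i))
        (trans (cong (Fin.join (suc h) (suc h)) eq) (Fin.join-splitAt (suc h) (suc h) j))

      mixed₁ : ∀ a b → a * a - - (b * b + + 7) ≡ a * a + b * b + + 7
      mixed₁ = solve-∀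
      mixed₂ : ∀ a b → - (- (a * a + + 7) - b * b) ≡ a * a + b * b + + 7
      mixed₂ = solve-∀
      same₂ : ∀ a b → - (- (a * a + + 7) - - (b * b + + 7)) ≡ a * a - b * b
      same₂ = solve-∀

      from-collision : ∀ s t → s ≢ t → + p ∣ value s - value t → ∃₂ λ x y → + p ∣ x * x + y * y + + 7
      from-collision (inj₁ a) (inj₂ b) _ p∣ =
        + toℕ a , + toℕ b , ∣-subst (mixed₁ (+ toℕ a) (+ toℕ b)) p∣
      from-collision (inj₂ a) (inj₁ b) _ p∣ =
        + toℕ a , + toℕ b , ∣-subst (mixed₂ (+ toℕ a) (+ toℕ b)) (∣m⇒∣-m p∣)
      from-collision (inj₁ a) (inj₁ b) s≢t p∣ =
        contradiction (cong inj₁ (equal-squares a b p∣)) s≢t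
      from-collision (inj₂ a) (inj₂ b) s≢t p∣ =
        contradiction (cong inj₂ (equal-squares a b (∣-subst (same₂ (+ toℕ a) (+ toℕ b)) (∣m⇒∣-m p∣)))) s≢t

      candidate : Fin (suc h ℕ.+ suc h) → ℤ
      candidate i = value (splitAt (suc h) i)

      from-indices : (∃₂ λ i j → toℕ i < toℕ j × + p ∣ candidate i - candidate j) →
                     ∃₂ λ x y → + p ∣ x * x + y * y + + 7
      from-indices (i , j , i<j , p∣) = from-collision (splitAt (suc h) i) (splitAt (suc h) j)
        (λ eq → ℕ.<⇒≢ i<j (cong toℕ (splitAt-injective eq))) p∣

    -- Pigeonhole: among the p + 1 numbers i² and -(j² + 7) with 0 ≤ i, j ≤ h two share a residue,
    -- and two of the same family never do.
    two-squares-plus-7 : ∃₂ λ x y → + p ∣ x * x + y * y + + 7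
    two-squares-plus-7 = from-indices (residue-collision p<2+2h candidate)

-- Embeddings in the quaternion order

halve-quotient : ∀ {p} q r → Odd p → q * p ≡ + 2 * r → ∃ λ q′ → q ≡ + 2 * q′ × q′ * p ≡ r
halve-quotient {p} q r p-odd eq with halve q r p-odd eq
... | even q′ refl = q′ , refl , ℤ.*-cancelˡ-≡ (+ 2) (q′ * p) r (trans (sym (ℤ.*-assoc (+ 2) q′ p)) eq)

divide-by-4 : ∀ {p n r} → Odd p → p ∣ n → n ≡ + 2 * (+ 2 * r) → ∃ λ q → + 4 * q * p ≡ n
divide-by-4 {p} {n} {r} p-odd (divides q eq) n≡4r
  with halve-quotient q (+ 2 * r) p-odd (trans (sym eq) n≡4r)
... | q₁ , q≡2q₁ , q₁p≡2r with halve-quotient q₁ r p-odd q₁p≡2r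
...   | q₂ , q₁≡2q₂ , _ = q₂ , trans (assoc q₂ p)
          (trans (cong (λ z → + 2 * z * p) (sym q₁≡2q₂)) (trans (cong (_* p) (sym q≡2q₁)) (sym eq)))
  where
  assoc : ∀ q p → + 4 * q * p ≡ + 2 * (+ 2 * q) * p
  assoc = solve-∀

-- The Hermitian form with coefficients m, e + if and p is, up to the factor p, the norm form of a left ideal of norm p.
record Discriminant7 (p : ℕ) : Set where
  constructor mk
  field
    e f   : ℤ
    m     : ℕ
    e-odd : Odd e
    f-even : Even f
    m≢0   : ℕ.NonZero m
    disc≡7 : disc (+ m) e f (+ p) ≡ + 7

module _ {p : ℕ} (p-prime : Prime p) {h : ℕ} (p≡ : p ≡ suc (2 ℕ.* h)) where

  +p-odd : Odd (+ p)
  +p-odd = odd (+ h) (trans (cong +_ p≡) (cong (_+_ 1ℤ) (ℤ.pos-* 2 h)))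

  -- Adding p where necessary repairs the parities. Then e² + f² + 7 is divisible by 4 as well as by
  -- p, and its quotient by 4p is the missing coefficient m.
  lift-disc : ∀ x y → + p ∣ x * x + y * y + + 7 →
    Σ (Discriminant7 p) λ D → (+ p ∣ Discriminant7.e D - x) × (+ p ∣ Discriminant7.f D - y)
  lift-disc x y p∣ with odd-adjust +p-odd x | even-adjust +p-odd y
  ... | e , e-odd@(odd k e≡) , p∣e-x | f , f-even@(even l f≡) , p∣f-y =
      mk e f m e-odd f-even m≢0 (trans (cong (λ z → z - e * e - f * f) (swap (+ p) (+ m)))
        (trans (cong (λ z → + 4 * z * + p - e * e - f * f) (sym q₂≡m)) disc-q₂))
    , p∣e-x , p∣f-y
    where
    r : ℤ
    r = k * k + k + l * l + + 2
    quadruple : e * e + f * f + + 7 ≡ + 2 * (+ 2 * r)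
    quadruple = trans (cong₂ (λ e f → e * e + f * f + + 7) e≡ f≡) (expand k l)
      where
      expand : ∀ k l → (1ℤ + + 2 * k) * (1ℤ + + 2 * k) + + 2 * l * (+ 2 * l) + + 7
                       ≡ + 2 * (+ 2 * (k * k + k + l * l + + 2))
      expand = solve-∀
    p∣e²+f²+7 : + p ∣ e * e + f * f + + 7
    p∣e²+f²+7 = ∣-subst (expand e f x y) (∣m∣n⇒∣m+n p∣
      (∣m∣n⇒∣m+n (∣m⇒∣m*n (e + x) p∣e-x) (∣m⇒∣m*n (f + y) p∣f-y)))
      where
      expand : ∀ e f x y → x * x + y * y + + 7 + ((e - x) * (e + x) + (f - y) * (f + y)) ≡ e * e + f * f + + 7
      expand = solve-∀
    quarter : ∃ λ q₂ → + 4 * q₂ * + p ≡ e * e + f * f + + 7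
    quarter = divide-by-4 +p-odd p∣e²+f²+7 quadruple
    q₂ : ℤ
    q₂ = proj₁ quarter
    disc-q₂ : + 4 * q₂ * + p - e * e - f * f ≡ + 7
    disc-q₂ = trans (cong (λ z → z - e * e - f * f) (proj₂ quarter)) (cancel (e * e) (f * f))
      where
      cancel : ∀ x y → x + y + + 7 - x - y ≡ + 7
      cancel = solve-∀
    natural : ∃ λ m → q₂ ≡ + m × 4 ℕ.* m ℕ.* suc (2 ℕ.* h) ≡ ∣ e ∣ ℕ.* ∣ e ∣ ℕ.+ ∣ f ∣ ℕ.* ∣ f ∣ ℕ.+ 7
    natural = disc⇒ℕ (2 ℕ.* h) e f q₂ (subst (λ p → + 4 * q₂ * + p - e * e - f * f ≡ + 7) p≡ disc-q₂)
    m : ℕ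
    m = proj₁ natural
    q₂≡m : q₂ ≡ + m
    q₂≡m = proj₁ (proj₂ natural)
    m≢0 : ℕ.NonZero m
    m≢0 = ℕ.≢-nonZero λ m≡0 → ℕ.m+1+n≢0 (∣ e ∣ ℕ.* ∣ e ∣ ℕ.+ ∣ f ∣ ℕ.* ∣ f ∣)
      (trans (sym (proj₂ (proj₂ natural))) (cong (λ m → 4 ℕ.* m ℕ.* suc (2 ℕ.* h)) m≡0))
    swap : ∀ p m → + 4 * p * m ≡ + 4 * m * p
    swap = solve-∀

module _ {p : ℕ} .{{_ : ℕ.NonZero p}} (D : Discriminant7 p) where
  open Discriminant7 D

  standard : Standardisation (+ m) e f (+ p)
  standard = standardise m {{m≢0}} (<-wellFounded m) e f p e-odd f-even disc≡7

  open Standardisation standard using (one; one-norm)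

  -- The coordinates of 2py + ex for (x, y) = one, where x, y and e + if are complex.
  η₁ η₂ : ℤ
  η₁ = + 2 * + p * one 2F + (e * one 0F - f * one 1F)
  η₂ = + 2 * + p * one 3F + (e * one 1F + f * one 0F)

  -- This is `complex-square` at `one`: with w and η complex it reads 4p = |η|² + 7|w|², the norm
  -- equation of a generator of the ideal.
  4p≡ : + 4 * + p ≡ η₁ * η₁ + η₂ * η₂ + + 7 * (one 0F * one 0F + one 1F * one 1F)
  4p≡ = begin
    + 4 * + p        ≡⟨ sym (ℤ.*-identityʳ (+ 4 * + p)) ⟩
    + 4 * + p * 1ℤ   ≡⟨ cong (+ 4 * + p *_) (sym one-norm) ⟩
    + 4 * + p * Hermitian (+ m) e f (+ p) one
      ≡⟨ complex-square (+ m) e f (+ p) (one 0F) (one 1F) (one 2F) (one 3F) ⟩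
    η₁ * η₁ + η₂ * η₂ + disc (+ m) e f (+ p) * (one 0F * one 0F + one 1F * one 1F)
      ≡⟨ cong (λ z → η₁ * η₁ + η₂ * η₂ + z * (one 0F * one 0F + one 1F * one 1F)) disc≡7 ⟩
    η₁ * η₁ + η₂ * η₂ + + 7 * (one 0F * one 0F + one 1F * one 1F) ∎
    where open ≡-Reasoning

  -- If the first complex coordinate vanished, the value 1 at `one` would be a multiple of p.
  one-X≢0 : 1 < p → ¬ (one 0F ≡ 0ℤ × one 1F ≡ 0ℤ)
  one-X≢0 1<p (x₁≡0 , x₂≡0) = ℕ.<⇒≱ 1<p (ℕ.∣⇒≤ (∣⇒∣ᵤ p∣1))
    where
    expand : ∀ a e f c y₁ y₂ →
      a * (0ℤ * 0ℤ + 0ℤ * 0ℤ) + (e * (0ℤ * y₁ + 0ℤ * y₂) + f * (0ℤ * y₂ - 0ℤ * y₁)) + c * (y₁ * y₁ + y₂ * y₂)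
      ≡ (y₁ * y₁ + y₂ * y₂) * c
    expand = solve-∀
    p∣1 : + p ∣ 1ℤ
    p∣1 = divides (one 2F * one 2F + one 3F * one 3F) (trans (sym one-norm)
      (trans (cong₂ (λ x₁ x₂ → hermitian (+ m) e f (+ p) x₁ x₂ (one 2F) (one 3F)) x₁≡0 x₂≡0)
             (expand (+ m) e f (+ p) (one 2F) (one 3F))))

sum-of-squares≡0 : ∀ a b → a * a + b * b ≡ 0ℤ → a ≡ 0ℤ × b ≡ 0ℤ
sum-of-squares≡0 a b eq = square≡0 a (ℕ.m+n≡0⇒m≡0 _ squares) , square≡0 b (ℕ.m+n≡0⇒n≡0 (∣ a ∣ ℕ.* ∣ a ∣) squares)
  where
  squares : ∣ a ∣ ℕ.* ∣ a ∣ ℕ.+ ∣ b ∣ ℕ.* ∣ b ∣ ≡ 0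
  squares = ℤ.+-injective (trans (sym (cong₂ _+_ (square-abs a) (square-abs b))) eq)

-- The inner product is prescribed through the norm of the sum, because half of the trace form of O
-- need not be integral. `nontrivial` is the condition that will keep the image in K off the summand
-- I₂.
record Embedding (a b c : ℤ) : Set where
  constructor mk
  field
    x y       : Vec 4
    x-norm    : Norm x ≡ a
    y-norm    : Norm y ≡ c
    sum-norm  : Norm (x +ᵥ y) ≡ a + + 2 * b + c
    nontrivial : ¬ (InFirstAxis x × InFirstAxis y)

PlaneEmbedding : ℕ → ℤ → Set
PlaneEmbedding p t = Embedding (t * t + 1ℤ) (t * + p) (+ p * + p)

Hermitian-cong : ∀ a e f c {u v} → u ≈ᵥ v → Hermitian a e f c u ≡ Hermitian a e f c v
Hermitian-cong a e f c {u} {v} u≈v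
  rewrite u≈v 0F | u≈v 1F | u≈v 2F | u≈v 3F = refl

module _ {a e f c : ℤ} (S : Standardisation a e f c) where
  open Standardisation S

  φ-sum-norm : ∀ u v → Norm (φ u +ᵥ φ v) ≡ Hermitian a e f c (u +ᵥ v)
  φ-sum-norm u v = trans (sym (Hermitian-cong (+ 1) (+ 1) 0ℤ (+ 2) (φ-+ u v))) (φ-norm (u +ᵥ v))

-- Completing the square gives 4 Norm = |2x + y|² + 7|y|², so norm 1 forces 7|y|² ≤ 4.
norm-1⇒axis : ∀ u → Norm u ≡ 1ℤ → InFirstAxis u
norm-1⇒axis u norm≡1 = sum-of-squares≡0 (u 2F) (u 3F)
    (trans (cong₂ _+_ (square-abs (u 2F)) (square-abs (u 3F))) (cong +_ (q≡0 P R squares)))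
  where
  P R : ℕ
  P = ∣ + 2 * u 0F + u 2F ∣ ℕ.* ∣ + 2 * u 0F + u 2F ∣ ℕ.+ ∣ + 2 * u 1F + u 3F ∣ ℕ.* ∣ + 2 * u 1F + u 3F ∣
  R = ∣ u 2F ∣ ℕ.* ∣ u 2F ∣ ℕ.+ ∣ u 3F ∣ ℕ.* ∣ u 3F ∣
  squares : P ℕ.+ 7 ℕ.* R ≡ 4
  squares = ℤ.+-injective (trans (cong (_+_ (+ P)) (ℤ.pos-* 7 R)) (trans (cong₂ (λ x y → x + + 7 * y)
      (sym (cong₂ _+_ (square-abs (+ 2 * u 0F + u 2F)) (square-abs (+ 2 * u 1F + u 3F))))
      (sym (cong₂ _+_ (square-abs (u 2F)) (square-abs (u 3F)))))
    (trans (sym (complete (u 0F) (u 1F) (u 2F) (u 3F))) (cong (+ 4 *_) norm≡1))))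
    where
    complete : ∀ x₁ x₂ y₁ y₂ → + 4 * hermitian (+ 1) (+ 1) 0ℤ (+ 2) x₁ x₂ y₁ y₂ ≡
      (+ 2 * x₁ + y₁) * (+ 2 * x₁ + y₁) + (+ 2 * x₂ + y₂) * (+ 2 * x₂ + y₂) + + 7 * (y₁ * y₁ + y₂ * y₂)
    complete = solve 4 (λ x₁ x₂ y₁ y₂ →
      con (+ 4) :* hermitianₚ (con (+ 1)) (con (+ 1)) (con 0ℤ) (con (+ 2)) x₁ x₂ y₁ y₂ :=
      (con (+ 2) :* x₁ :+ y₁) :* (con (+ 2) :* x₁ :+ y₁) :+ (con (+ 2) :* x₂ :+ y₂) :* (con (+ 2) :* x₂ :+ y₂)
        :+ con (+ 7) :* (y₁ :* y₁ :+ y₂ :* y₂)) refl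
  q≡0 : ∀ P R → P ℕ.+ 7 ℕ.* R ≡ 4 → R ≡ 0
  q≡0 P 0       _  = refl
  q≡0 P (suc R) eq = contradiction (ℕ.≤-reflexive eq)
    (ℕ.<⇒≱ (ℕ.<-≤-trans 4<7 (ℕ.≤-trans (ℕ.*-monoʳ-≤ 7 (s≤s z≤n)) (ℕ.m≤n+m (7 ℕ.* suc R) P))))
    where
    4<7 : 4 < 7
    4<7 = s≤s (s≤s (s≤s (s≤s (s≤s z≤n))))

-- The coefficient p of the Hermitian form makes (0, 1) and (0, i) orthogonal of norm p. The image
-- of `one` lies in ℤ[i], so if the image of (0, 1) did too, `one` would be proportional to (0, 1),
-- against `one-X≢0`.
scaled-embedding : ∀ {p} .{{_ : ℕ.NonZero p}} → 1 < p → Discriminant7 p → Embedding (+ p) 0ℤ (+ p)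
scaled-embedding {p} 1<p D = mk (φ u) (φ v)
    (trans (φ-norm u) (at-u (+ m) e f (+ p))) (trans (φ-norm v) (at-v (+ m) e f (+ p)))
    (trans (φ-sum-norm (standard D) u v) (at-u+v (+ m) e f (+ p)))
    (λ (φu-axis , _) → absurd (φ-axis one u (norm-1⇒axis (φ one) (trans (φ-norm one) one-norm)) φu-axis))
  where
  open Discriminant7 D
  open Standardisation (standard D)
  u v : Vec 4
  u = ⟨ 0ℤ , 0ℤ , 1ℤ , 0ℤ ⟩
  v = ⟨ 0ℤ , 0ℤ , 0ℤ , 1ℤ ⟩
  at-u : ∀ a e f c → hermitian a e f c 0ℤ 0ℤ 1ℤ 0ℤ ≡ c
  at-u = solve 4 (λ a e f c → hermitianₚ a e f c (con 0ℤ) (con 0ℤ) (con 1ℤ) (con 0ℤ) := c) refl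
  at-v : ∀ a e f c → hermitian a e f c 0ℤ 0ℤ 0ℤ 1ℤ ≡ c
  at-v = solve 4 (λ a e f c → hermitianₚ a e f c (con 0ℤ) (con 0ℤ) (con 0ℤ) (con 1ℤ) := c) refl
  at-u+v : ∀ a e f c → hermitian a e f c 0ℤ 0ℤ 1ℤ 1ℤ ≡ c + + 2 * 0ℤ + c
  at-u+v = solve 4 (λ a e f c → hermitianₚ a e f c (con 0ℤ) (con 0ℤ) (con 1ℤ) (con 1ℤ) := c :+ con (+ 2) :* con 0ℤ :+ c) refl
  absurd : ¬ (one ∥ u)
  absurd (re , im) = one-X≢0 D 1<p (trans (re₁ (one 0F) (one 1F)) (trans re (zeros (one 2F) (one 3F)))
                                  , trans (im₁ (one 0F) (one 1F)) (trans im (zeros′ (one 2F) (one 3F))))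
    where
    re₁ : ∀ a b → a ≡ a * 1ℤ - b * 0ℤ
    re₁ = solve-∀
    im₁ : ∀ a b → b ≡ a * 0ℤ + b * 1ℤ
    im₁ = solve-∀
    zeros : ∀ c d → 0ℤ * c - 0ℤ * d ≡ 0ℤ
    zeros = solve-∀
    zeros′ : ∀ c d → 0ℤ * d + 0ℤ * c ≡ 0ℤ
    zeros′ = solve-∀

module _ {p : ℕ} .{{_ : ℕ.NonZero p}} (D D′ : Discriminant7 p) where
  private
    open Discriminant7 D
    open Discriminant7 D′ renaming (e to e′; f to f′; m to m′; disc≡7 to disc≡7′) using ()
    open Standardisation (standard D) using (one; one-norm)
    w₁ = one 0F
    w₂ = one 1F
    w₃ = one 2F
    w₄ = one 3F

  -- em − m̄e′ = 2pκ with e + if, e′ + if′, m = m₁ + im₂ and κ = κ₁ + iκ₂.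
  record Intertwiner (m₁ m₂ κ₁ κ₂ : ℤ) : Set where
    constructor intertwiner
    field
      re : + 2 * + p * κ₁ ≡ e * m₁ - f * m₂ - (m₁ * e′ + m₂ * f′)
      im : + 2 * + p * κ₂ ≡ e * m₂ + f * m₁ - (m₁ * f′ - m₂ * e′)

  -- (x, y) ↦ (x m̄, x κ + m y) evaluated at the vector one.
  ψ : ℤ → ℤ → ℤ → ℤ → Vec 4
  ψ m₁ m₂ κ₁ κ₂ = ⟨ w₁ * m₁ + w₂ * m₂ , w₂ * m₁ - w₁ * m₂
                  , w₁ * κ₁ - w₂ * κ₂ + (m₁ * w₃ - m₂ * w₄) , w₁ * κ₂ + w₂ * κ₁ + (m₁ * w₄ + m₂ * w₃) ⟩

  module _ {m₁ m₂ κ₁ κ₂ : ℤ} (I : Intertwiner m₁ m₂ κ₁ κ₂) where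
    private
      X₁ = ψ m₁ m₂ κ₁ κ₂ 0F
      X₂ = ψ m₁ m₂ κ₁ κ₂ 1F
      Y₁ = ψ m₁ m₂ κ₁ κ₂ 2F
      Y₂ = ψ m₁ m₂ κ₁ κ₂ 3F
    open Intertwiner I

    -- With `ψ-g₂` this is 2pY + (e′ + if′)X = mη in complex notation: substituting 2pκ = em - m̄e′
    -- cancels the terms in e′.
    ψ-g₁ : + 2 * + p * Y₁ + (e′ * X₁ - f′ * X₂) ≡ m₁ * η₁ D - m₂ * η₂ D
    ψ-g₁ = trans (split (+ p) w₁ w₂ w₃ w₄ κ₁ κ₂ m₁ m₂ e′ f′)
      (trans (cong₂ (λ a b → w₁ * a - w₂ * b + (+ 2 * + p * (m₁ * w₃ - m₂ * w₄) + (e′ * X₁ - f′ * X₂))) re im)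
             (collect (+ p) w₁ w₂ w₃ w₄ m₁ m₂ e f e′ f′))
      where
      split : ∀ p w₁ w₂ w₃ w₄ κ₁ κ₂ m₁ m₂ e′ f′ →
        + 2 * p * (w₁ * κ₁ - w₂ * κ₂ + (m₁ * w₃ - m₂ * w₄)) + (e′ * (w₁ * m₁ + w₂ * m₂) - f′ * (w₂ * m₁ - w₁ * m₂))
        ≡ w₁ * (+ 2 * p * κ₁) - w₂ * (+ 2 * p * κ₂)
          + (+ 2 * p * (m₁ * w₃ - m₂ * w₄) + (e′ * (w₁ * m₁ + w₂ * m₂) - f′ * (w₂ * m₁ - w₁ * m₂)))
      split = solve-∀
      collect : ∀ p w₁ w₂ w₃ w₄ m₁ m₂ e f e′ f′ →
        w₁ * (e * m₁ - f * m₂ - (m₁ * e′ + m₂ * f′)) - w₂ * (e * m₂ + f * m₁ - (m₁ * f′ - m₂ * e′))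
          + (+ 2 * p * (m₁ * w₃ - m₂ * w₄) + (e′ * (w₁ * m₁ + w₂ * m₂) - f′ * (w₂ * m₁ - w₁ * m₂)))
        ≡ m₁ * (+ 2 * p * w₃ + (e * w₁ - f * w₂)) - m₂ * (+ 2 * p * w₄ + (e * w₂ + f * w₁))
      collect = solve-∀

    ψ-g₂ : + 2 * + p * Y₂ + (e′ * X₂ + f′ * X₁) ≡ m₁ * η₂ D + m₂ * η₁ D
    ψ-g₂ = trans (split (+ p) w₁ w₂ w₃ w₄ κ₁ κ₂ m₁ m₂ e′ f′)
      (trans (cong₂ (λ a b → w₂ * a + w₁ * b + (+ 2 * + p * (m₁ * w₄ + m₂ * w₃) + (e′ * X₂ + f′ * X₁))) re im)
             (collect (+ p) w₁ w₂ w₃ w₄ m₁ m₂ e f e′ f′))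
      where
      split : ∀ p w₁ w₂ w₃ w₄ κ₁ κ₂ m₁ m₂ e′ f′ →
        + 2 * p * (w₁ * κ₂ + w₂ * κ₁ + (m₁ * w₄ + m₂ * w₃)) + (e′ * (w₂ * m₁ - w₁ * m₂) + f′ * (w₁ * m₁ + w₂ * m₂))
        ≡ w₂ * (+ 2 * p * κ₁) + w₁ * (+ 2 * p * κ₂)
          + (+ 2 * p * (m₁ * w₄ + m₂ * w₃) + (e′ * (w₂ * m₁ - w₁ * m₂) + f′ * (w₁ * m₁ + w₂ * m₂)))
      split = solve-∀
      collect : ∀ p w₁ w₂ w₃ w₄ m₁ m₂ e f e′ f′ →
        w₂ * (e * m₁ - f * m₂ - (m₁ * e′ + m₂ * f′)) + w₁ * (e * m₂ + f * m₁ - (m₁ * f′ - m₂ * e′))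
          + (+ 2 * p * (m₁ * w₄ + m₂ * w₃) + (e′ * (w₂ * m₁ - w₁ * m₂) + f′ * (w₁ * m₁ + w₂ * m₂)))
        ≡ m₁ * (+ 2 * p * w₄ + (e * w₂ + f * w₁)) + m₂ * (+ 2 * p * w₃ + (e * w₁ - f * w₂))
      collect = solve-∀

    -- `complex-square` for the second form turns 4p times the left-hand side into |mη|² + 7|m̄w|² =
    -- |m|²(|η|² + 7|w|²), and the bracket is 4p.
    ψ-norm : Hermitian (+ m′) e′ f′ (+ p) (ψ m₁ m₂ κ₁ κ₂) ≡ m₁ * m₁ + m₂ * m₂
    ψ-norm = ℤ.*-cancelˡ-≡ (+ 4 * + p) _ _ {{4p≢0 p}} (begin
      + 4 * + p * Hermitian (+ m′) e′ f′ (+ p) (ψ m₁ m₂ κ₁ κ₂)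
        ≡⟨ complex-square (+ m′) e′ f′ (+ p) X₁ X₂ Y₁ Y₂ ⟩
      Z₁ * Z₁ + Z₂ * Z₂ + disc (+ m′) e′ f′ (+ p) * (X₁ * X₁ + X₂ * X₂)
        ≡⟨ cong₂ (λ a b → a * a + b * b + disc (+ m′) e′ f′ (+ p) * (X₁ * X₁ + X₂ * X₂)) ψ-g₁ ψ-g₂ ⟩
      h₁ * h₁ + h₂ * h₂ + disc (+ m′) e′ f′ (+ p) * (X₁ * X₁ + X₂ * X₂)
        ≡⟨ cong (λ z → h₁ * h₁ + h₂ * h₂ + z * (X₁ * X₁ + X₂ * X₂)) disc≡7′ ⟩
      h₁ * h₁ + h₂ * h₂ + + 7 * (X₁ * X₁ + X₂ * X₂)
        ≡⟨ multiplicative (η₁ D) (η₂ D) w₁ w₂ m₁ m₂ ⟩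
      (η₁ D * η₁ D + η₂ D * η₂ D + + 7 * (w₁ * w₁ + w₂ * w₂)) * (m₁ * m₁ + m₂ * m₂)
        ≡⟨ cong (_* (m₁ * m₁ + m₂ * m₂)) (sym (4p≡ D)) ⟩
      + 4 * + p * (m₁ * m₁ + m₂ * m₂) ∎)
      where
      open ≡-Reasoning
      Z₁ = + 2 * + p * Y₁ + (e′ * X₁ - f′ * X₂)
      Z₂ = + 2 * + p * Y₂ + (e′ * X₂ + f′ * X₁)
      h₁ = m₁ * η₁ D - m₂ * η₂ D
      h₂ = m₁ * η₂ D + m₂ * η₁ D
      4p≢0 : ∀ p .{{_ : ℕ.NonZero p}} → ℤ.NonZero (+ 4 * + p)
      4p≢0 (suc _) = _
      multiplicative : ∀ η₁ η₂ w₁ w₂ m₁ m₂ →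
        (m₁ * η₁ - m₂ * η₂) * (m₁ * η₁ - m₂ * η₂) + (m₁ * η₂ + m₂ * η₁) * (m₁ * η₂ + m₂ * η₁)
        + + 7 * ((w₁ * m₁ + w₂ * m₂) * (w₁ * m₁ + w₂ * m₂) + (w₂ * m₁ - w₁ * m₂) * (w₂ * m₁ - w₁ * m₂))
        ≡ (η₁ * η₁ + η₂ * η₂ + + 7 * (w₁ * w₁ + w₂ * w₂)) * (m₁ * m₁ + m₂ * m₂)
      multiplicative = solve-∀

  -- The coordinate change y ↦ 2py + (e′ + if′)x multiplies the 2 × 2 determinant by 2p. In the new
  -- coordinates ψ is simply (m̄w, mη).
  ∥⇒cross : ∀ {u v} → u ∥ v →
      (u 0F * (+ 2 * + p * v 2F + (e′ * v 0F - f′ * v 1F)) - u 1F * (+ 2 * + p * v 3F + (e′ * v 1F + f′ * v 0F))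
       ≡ v 0F * (+ 2 * + p * u 2F + (e′ * u 0F - f′ * u 1F)) - v 1F * (+ 2 * + p * u 3F + (e′ * u 1F + f′ * u 0F)))
    × (u 0F * (+ 2 * + p * v 3F + (e′ * v 1F + f′ * v 0F)) + u 1F * (+ 2 * + p * v 2F + (e′ * v 0F - f′ * v 1F))
       ≡ v 0F * (+ 2 * + p * u 3F + (e′ * u 1F + f′ * u 0F)) + v 1F * (+ 2 * + p * u 2F + (e′ * u 0F - f′ * u 1F)))
  ∥⇒cross {u} {v} (re , im) =
      ≡-via (cong (+ 2 * + p *_) re)
        (re-diff (+ p) e′ f′ (u 0F) (u 1F) (u 2F) (u 3F) (v 0F) (v 1F) (v 2F) (v 3F))
    , ≡-via (cong (+ 2 * + p *_) im)
        (im-diff (+ p) e′ f′ (u 0F) (u 1F) (u 2F) (u 3F) (v 0F) (v 1F) (v 2F) (v 3F))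
    where
    re-diff : ∀ p e f a b c d a′ b′ c′ d′ →
      + 2 * p * (a * c′ - b * d′) - + 2 * p * (a′ * c - b′ * d)
      ≡ a * (+ 2 * p * c′ + (e * a′ - f * b′)) - b * (+ 2 * p * d′ + (e * b′ + f * a′))
        - (a′ * (+ 2 * p * c + (e * a - f * b)) - b′ * (+ 2 * p * d + (e * b + f * a)))
    re-diff = solve-∀
    im-diff : ∀ p e f a b c d a′ b′ c′ d′ →
      + 2 * p * (a * d′ + b * c′) - + 2 * p * (a′ * d + b′ * c)
      ≡ a * (+ 2 * p * d′ + (e * b′ + f * a′)) + b * (+ 2 * p * c′ + (e * a′ - f * b′))
        - (a′ * (+ 2 * p * d + (e * b + f * a)) + b′ * (+ 2 * p * c + (e * a - f * b)))
    im-diff = solve-∀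

  module _ (p-prime : Prime p) (p≢7 : p ≢ 7) where

    -- Here p = 7 has to be excluded: if η = 0, then 4p = 7|w|² and 7 divides p.
    product≢0 : (w₁ * w₁ + w₂ * w₂) * (η₁ D * η₁ D + η₂ D * η₂ D) ≢ 0ℤ
    product≢0 eq with ℤ.i*j≡0⇒i≡0∨j≡0 (w₁ * w₁ + w₂ * w₂) eq
    ... | inj₁ w≡0 = one-X≢0 D (1<p p-prime) (sum-of-squares≡0 w₁ w₂ w≡0)
    ... | inj₂ g≡0 = 7∤4p (euclidsLemma 4 p prime[7] (subst (7 ℕ.∣_) (ℤ.abs-* (+ 4) (+ p)) (∣⇒∣ᵤ 7∣4p)))
      where
      prime[7] : Prime 7
      prime[7] = from-yes (prime? 7)
      7∣4p : + 7 ∣ + 4 * + p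
      7∣4p = divides (w₁ * w₁ + w₂ * w₂) (trans (4p≡ D)
        (trans (cong (_+ + 7 * (w₁ * w₁ + w₂ * w₂)) g≡0) (commute (w₁ * w₁ + w₂ * w₂))))
        where
        commute : ∀ w → 0ℤ + + 7 * w ≡ w * + 7
        commute = solve-∀
      7∤4p : 7 ℕ.∣ 4 ⊎ 7 ℕ.∣ p → ⊥
      7∤4p (inj₁ 7∣4) = contradiction (ℕ.∣⇒≤ 7∣4) λ { (s≤s (s≤s (s≤s (s≤s ())))) }
      7∤4p (inj₂ 7∣p) with prime⇒irreducible p-prime 7∣p
      ... | inj₁ ()
      ... | inj₂ 7≡p = p≢7 (sym 7≡p)

    -- In the coordinates of `∥⇒cross` the determinant is wη(m̄n - n̄m) with m = t + i and n = p,
    -- that is -2ip wη. So proportionality would force wη = 0; `re₀` and `im₀` are its imaginary and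
    -- real parts.
    ψ-independent : ∀ {t κ₁ κ₂ λ₁ λ₂} → Intertwiner t 1ℤ κ₁ κ₂ → Intertwiner (+ p) 0ℤ λ₁ λ₂ →
                    ¬ (ψ t 1ℤ κ₁ κ₂ ∥ ψ (+ p) 0ℤ λ₁ λ₂)
    ψ-independent {t} {κ₁} {κ₂} {λ₁} {λ₂} I J u∥v = product≢0 (trans
        (lagrange w₁ w₂ (η₁ D) (η₂ D))
        (cong₂ (λ a b → a * a + b * b) (2p-cancel _ re₀) (2p-cancel _ im₀)))
      where
      u = ψ t 1ℤ κ₁ κ₂
      v = ψ (+ p) 0ℤ λ₁ λ₂
      cross = ∥⇒cross {u} {v} u∥v
      re₀ : + 2 * + p * (w₂ * η₁ D + w₁ * η₂ D) ≡ 0ℤ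
      re₀ = trans (expand (+ p) t w₁ w₂ (η₁ D) (η₂ D)) (ℤ.i≡j⇒i-j≡0
        (trans (cong₂ (λ a b → u 0F * a - u 1F * b) (sym (ψ-g₁ J)) (sym (ψ-g₂ J)))
        (trans (proj₁ cross) (cong₂ (λ a b → v 0F * a - v 1F * b) (ψ-g₁ I) (ψ-g₂ I)))))
        where
        expand : ∀ p t w₁ w₂ η₁ η₂ → + 2 * p * (w₂ * η₁ + w₁ * η₂) ≡
            (w₁ * t + w₂ * 1ℤ) * (p * η₁ - 0ℤ * η₂) - (w₂ * t - w₁ * 1ℤ) * (p * η₂ + 0ℤ * η₁)
          - ((w₁ * p + w₂ * 0ℤ) * (t * η₁ - 1ℤ * η₂) - (w₂ * p - w₁ * 0ℤ) * (t * η₂ + 1ℤ * η₁))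
        expand = solve-∀
      im₀ : + 2 * + p * (w₂ * η₂ D - w₁ * η₁ D) ≡ 0ℤ
      im₀ = trans (expand (+ p) t w₁ w₂ (η₁ D) (η₂ D)) (ℤ.i≡j⇒i-j≡0
        (trans (cong₂ (λ a b → u 0F * b + u 1F * a) (sym (ψ-g₁ J)) (sym (ψ-g₂ J)))
        (trans (proj₂ cross) (cong₂ (λ a b → v 0F * b + v 1F * a) (ψ-g₁ I) (ψ-g₂ I)))))
        where
        expand : ∀ p t w₁ w₂ η₁ η₂ → + 2 * p * (w₂ * η₂ - w₁ * η₁) ≡
            (w₁ * t + w₂ * 1ℤ) * (p * η₂ + 0ℤ * η₁) + (w₂ * t - w₁ * 1ℤ) * (p * η₁ - 0ℤ * η₂)
          - ((w₁ * p + w₂ * 0ℤ) * (t * η₂ + 1ℤ * η₁) + (w₂ * p - w₁ * 0ℤ) * (t * η₁ - 1ℤ * η₂))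
        expand = solve-∀
      lagrange : ∀ w₁ w₂ η₁ η₂ → (w₁ * w₁ + w₂ * w₂) * (η₁ * η₁ + η₂ * η₂)
        ≡ (w₂ * η₁ + w₁ * η₂) * (w₂ * η₁ + w₁ * η₂) + (w₂ * η₂ - w₁ * η₁) * (w₂ * η₂ - w₁ * η₁)
      lagrange = solve-∀
      2p≢0 : ∀ p .{{_ : ℕ.NonZero p}} → ℤ.NonZero (+ 2 * + p)
      2p≢0 (suc _) = _
      2p-cancel : ∀ z → + 2 * + p * z ≡ 0ℤ → z ≡ 0ℤ
      2p-cancel z eq = ℤ.*-cancelˡ-≡ (+ 2 * + p) z 0ℤ {{2p≢0 p}} (trans eq (sym (ℤ.*-zeroʳ (+ 2 * + p))))

    -- ψ is additive in m and κ together, so the norm of the sum is `ψ-norm` at m = t + p + i.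
    intertwined-embedding : ∀ {t κ₁ κ₂ λ₁ λ₂} → Intertwiner t 1ℤ κ₁ κ₂ → Intertwiner (+ p) 0ℤ λ₁ λ₂ →
                            PlaneEmbedding p t
    intertwined-embedding {t} {κ₁} {κ₂} {λ₁} {λ₂} I J = mk (φ u) (φ v)
        (trans (φ-norm u) (ψ-norm I)) (trans (φ-norm v) (trans (ψ-norm J) (ℤ.+-identityʳ _)))
        (trans (φ-sum-norm (standard D′) u v) (trans (Hermitian-cong (+ m′) e′ f′ (+ p) u+v≈) (trans (ψ-norm I+J) (square (+ p) t))))
        (λ (u-axis , v-axis) → ψ-independent I J (φ-axis u v u-axis v-axis))
      where
      open Standardisation (standard D′) hiding (one; one-norm)
      u = ψ t 1ℤ κ₁ κ₂
      v = ψ (+ p) 0ℤ λ₁ λ₂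
      I+J : Intertwiner (t + + p) 1ℤ (κ₁ + λ₁) (κ₂ + λ₂)
      I+J = intertwiner
        (trans (ℤ.*-distribˡ-+ (+ 2 * + p) κ₁ λ₁) (trans (cong₂ _+_ (Intertwiner.re I) (Intertwiner.re J)) (re-+ (+ p) t e f e′ f′)))
        (trans (ℤ.*-distribˡ-+ (+ 2 * + p) κ₂ λ₂) (trans (cong₂ _+_ (Intertwiner.im I) (Intertwiner.im J)) (im-+ (+ p) t e f e′ f′)))
        where
        re-+ : ∀ p t e f e′ f′ → e * t - f * 1ℤ - (t * e′ + 1ℤ * f′) + (e * p - f * 0ℤ - (p * e′ + 0ℤ * f′))
                                 ≡ e * (t + p) - f * 1ℤ - ((t + p) * e′ + 1ℤ * f′)
        re-+ = solve-∀
        im-+ : ∀ p t e f e′ f′ → e * 1ℤ + f * t - (t * f′ - 1ℤ * e′) + (e * 0ℤ + f * p - (p * f′ - 0ℤ * e′))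
                                 ≡ e * 1ℤ + f * (t + p) - ((t + p) * f′ - 1ℤ * e′)
        im-+ = solve-∀
      u+v≈ : (u +ᵥ v) ≈ᵥ ψ (t + + p) 1ℤ (κ₁ + λ₁) (κ₂ + λ₂)
      u+v≈ = 4-cases (X₁-+ w₁ w₂ t (+ p)) (X₂-+ w₁ w₂ t (+ p))
               (Y₁-+ w₁ w₂ w₃ w₄ t (+ p) κ₁ κ₂ λ₁ λ₂) (Y₂-+ w₁ w₂ w₃ w₄ t (+ p) κ₁ κ₂ λ₁ λ₂)
        where
        X₁-+ : ∀ w₁ w₂ t p → w₁ * t + w₂ * 1ℤ + (w₁ * p + w₂ * 0ℤ) ≡ w₁ * (t + p) + w₂ * 1ℤ
        X₁-+ = solve-∀
        X₂-+ : ∀ w₁ w₂ t p → w₂ * t - w₁ * 1ℤ + (w₂ * p - w₁ * 0ℤ) ≡ w₂ * (t + p) - w₁ * 1ℤ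
        X₂-+ = solve-∀
        Y₁-+ : ∀ w₁ w₂ w₃ w₄ t p κ₁ κ₂ λ₁ λ₂ →
          w₁ * κ₁ - w₂ * κ₂ + (t * w₃ - 1ℤ * w₄) + (w₁ * λ₁ - w₂ * λ₂ + (p * w₃ - 0ℤ * w₄))
          ≡ w₁ * (κ₁ + λ₁) - w₂ * (κ₂ + λ₂) + ((t + p) * w₃ - 1ℤ * w₄)
        Y₁-+ = solve-∀
        Y₂-+ : ∀ w₁ w₂ w₃ w₄ t p κ₁ κ₂ λ₁ λ₂ →
          w₁ * κ₂ + w₂ * κ₁ + (t * w₄ + 1ℤ * w₃) + (w₁ * λ₂ + w₂ * λ₁ + (p * w₄ + 0ℤ * w₃))
          ≡ w₁ * (κ₂ + λ₂) + w₂ * (κ₁ + λ₁) + ((t + p) * w₄ + 1ℤ * w₃)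
        Y₂-+ = solve-∀
      square : ∀ p t → (t + p) * (t + p) + 1ℤ * 1ℤ ≡ t * t + 1ℤ + + 2 * (t * p) + p * p
      square = solve-∀

even-multiple : ∀ p s → Odd p → p ∣ s → Even s → ∃ λ κ → + 2 * p * κ ≡ s
even-multiple p s p-odd (divides q s≡qp) (even r s≡2r) with halve-quotient q r p-odd (trans (sym s≡qp) s≡2r)
... | κ , _ , κp≡r = κ , trans (swap p κ) (trans (cong (+ 2 *_) κp≡r) (sym s≡2r))
  where
  swap : ∀ p κ → + 2 * p * κ ≡ + 2 * (κ * p)
  swap = solve-∀

module _ {p : ℕ} (p-prime : Prime p) {h : ℕ} (p≡ : p ≡ suc (2 ℕ.* h)) (p≢7 : p ≢ 7) where
  private instance
    p≢0 : ℕ.NonZero p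
    p≢0 = prime⇒nonZero p-prime

  module _ (t n : ℤ) (p∣Nn-1 : + p ∣ (t * t + 1ℤ) * n - 1ℤ) (D : Discriminant7 p) where
    open Discriminant7 D

    -- Real and imaginary part of n(e + if)(t + i)². As n inverts t² + 1 modulo p, this is (e +
    -- if)μ/μ̄ for μ = t + i, the coefficient that a second ideal must have modulo p for μ to
    -- intertwine the two.
    rotated-e rotated-f : ℤ
    rotated-e = n * (e * (t * t - 1ℤ) - + 2 * t * f)
    rotated-f = n * (f * (t * t - 1ℤ) + + 2 * t * e)

    -- Multiplication by μ/μ̄ preserves the absolute value modulo p, so the squared absolute value
    -- remains -7.
    rotated-zero : + p ∣ rotated-e * rotated-e + rotated-f * rotated-f + + 7
    rotated-zero = ∣-subst (expand e f n t (disc (+ m) e f (+ p)) (+ p) (+ m) disc≡7 refl)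
      (∣m∣n⇒∣m+n (∣m⇒∣m*n (+ 4 * + m * ((t * t + 1ℤ) * n * ((t * t + 1ℤ) * n))) ∣-refl)
                  (∣m⇒∣-m (∣n⇒∣m*n (+ 7) (∣m⇒∣m*n ((t * t + 1ℤ) * n + 1ℤ) p∣Nn-1))))
      where
      -- The ring identity holds with the discriminant written out in place of 7; the constant is
      -- substituted afterwards.
      polynomial : ∀ e f n t p m →
        p * (+ 4 * m * ((t * t + 1ℤ) * n * ((t * t + 1ℤ) * n)))
          + - ((+ 4 * p * m - e * e - f * f) * (((t * t + 1ℤ) * n - 1ℤ) * ((t * t + 1ℤ) * n + 1ℤ)))
        ≡ n * (e * (t * t - 1ℤ) - + 2 * t * f) * (n * (e * (t * t - 1ℤ) - + 2 * t * f))
          + n * (f * (t * t - 1ℤ) + + 2 * t * e) * (n * (f * (t * t - 1ℤ) + + 2 * t * e))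
          + (+ 4 * p * m - e * e - f * f)
      polynomial = solve-∀
      expand : ∀ e f n t d p m → d ≡ + 7 → d ≡ + 4 * p * m - e * e - f * f →
        p * (+ 4 * m * ((t * t + 1ℤ) * n * ((t * t + 1ℤ) * n)))
          + - (+ 7 * (((t * t + 1ℤ) * n - 1ℤ) * ((t * t + 1ℤ) * n + 1ℤ)))
        ≡ n * (e * (t * t - 1ℤ) - + 2 * t * f) * (n * (e * (t * t - 1ℤ) - + 2 * t * f))
          + n * (f * (t * t - 1ℤ) + + 2 * t * e) * (n * (f * (t * t - 1ℤ) + + 2 * t * e)) + + 7
      expand e f n t _ p m refl d≡ = subst (λ s →
        p * (+ 4 * m * ((t * t + 1ℤ) * n * ((t * t + 1ℤ) * n)))
          + - (s * (((t * t + 1ℤ) * n - 1ℤ) * ((t * t + 1ℤ) * n + 1ℤ)))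
        ≡ n * (e * (t * t - 1ℤ) - + 2 * t * f) * (n * (e * (t * t - 1ℤ) - + 2 * t * f))
          + n * (f * (t * t - 1ℤ) + + 2 * t * e) * (n * (f * (t * t - 1ℤ) + + 2 * t * e)) + s)
        (sym d≡) (polynomial e f n t p m)

    module _ (D′ : Discriminant7 p) where
      open Discriminant7 D′ using () renaming (e to e′; f to f′; e-odd to e′-odd; f-even to f′-even)

      -- For m = p divisibility by p is automatic, and the factor 2 comes from the parities of both
      -- coefficients.
      p-intertwiner : ∃₂ λ λ₁ λ₂ → Intertwiner D D′ (+ p) 0ℤ λ₁ λ₂
      p-intertwiner with e-odd | f-even | e′-odd | f′-even
      ... | odd k e≡ | even l f≡ | odd k′ e′≡ | even l′ f′≡ = k - k′ , l - l′ , intertwiner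
        (trans (re-eq (+ p) k k′ f f′) (cong₂ (λ e e′ → e * + p - f * 0ℤ - (+ p * e′ + 0ℤ * f′)) (sym e≡) (sym e′≡)))
        (trans (im-eq (+ p) l l′ e e′) (cong₂ (λ f f′ → e * 0ℤ + f * + p - (+ p * f′ - 0ℤ * e′)) (sym f≡) (sym f′≡)))
        where
        re-eq : ∀ p k k′ f f′ → + 2 * p * (k - k′) ≡ (1ℤ + + 2 * k) * p - f * 0ℤ - (p * (1ℤ + + 2 * k′) + 0ℤ * f′)
        re-eq = solve-∀
        im-eq : ∀ p l l′ e e′ → + 2 * p * (l - l′) ≡ e * 0ℤ + + 2 * l * p - (p * (+ 2 * l′) - 0ℤ * e′)
        im-eq = solve-∀

      module _ (p∣e′ : + p ∣ e′ - rotated-e) (p∣f′ : + p ∣ f′ - rotated-f) where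

        -- Modulo p the condition is the choice of the rotated coefficient, modulo 2 it follows from
        -- the parities, and p is odd.
        t-intertwiner : ∃₂ λ κ₁ κ₂ → Intertwiner D D′ t 1ℤ κ₁ κ₂
        t-intertwiner = proj₁ re-part , proj₁ im-part , intertwiner (proj₂ re-part) (proj₂ im-part)
          where
          p-odd = +p-odd p-prime {h} p≡
          re-part : ∃ λ κ → + 2 * + p * κ ≡ e * t - f * 1ℤ - (t * e′ + 1ℤ * f′)
          re-part = even-multiple (+ p) (e * t - f * 1ℤ - (t * e′ + 1ℤ * f′)) p-odd
            (∣-subst (split e f e′ f′ t n)
              (∣m∣n⇒∣m+n (∣n⇒∣m*n (f - e * t) p∣Nn-1) (∣m⇒∣-m (∣m∣n⇒∣m+n (∣n⇒∣m*n t p∣e′) p∣f′))))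
            (parity-re e f e′ f′ e-odd e′-odd f-even f′-even)
            where
            split : ∀ e f e′ f′ t n → (f - e * t) * ((t * t + 1ℤ) * n - 1ℤ)
                + - (t * (e′ - n * (e * (t * t - 1ℤ) - + 2 * t * f)) + (f′ - n * (f * (t * t - 1ℤ) + + 2 * t * e)))
              ≡ e * t - f * 1ℤ - (t * e′ + 1ℤ * f′)
            split = solve-∀
            parity-re : ∀ e f e′ f′ → Odd e → Odd e′ → Even f → Even f′ → Even (e * t - f * 1ℤ - (t * e′ + 1ℤ * f′))
            parity-re _ _ _ _ (odd k refl) (odd k′ refl) (even l refl) (even l′ refl) =
              even (k * t - l - t * k′ - l′) (eq k k′ l l′ t)
              where
              eq : ∀ k k′ l l′ t → (1ℤ + + 2 * k) * t - + 2 * l * 1ℤ - (t * (1ℤ + + 2 * k′) + 1ℤ * (+ 2 * l′))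
                                   ≡ + 2 * (k * t - l - t * k′ - l′)
              eq = solve-∀
          im-part : ∃ λ κ → + 2 * + p * κ ≡ e * 1ℤ + f * t - (t * f′ - 1ℤ * e′)
          im-part = even-multiple (+ p) (e * 1ℤ + f * t - (t * f′ - 1ℤ * e′)) p-odd
            (∣-subst (split e f e′ f′ t n)
              (∣m∣n⇒∣m+n (∣n⇒∣m*n (- (e + f * t)) p∣Nn-1) (∣m∣n⇒∣m-n p∣e′ (∣n⇒∣m*n t p∣f′))))
            (parity-im e f e′ f′ e-odd e′-odd f-even f′-even)
            where
            split : ∀ e f e′ f′ t n → - (e + f * t) * ((t * t + 1ℤ) * n - 1ℤ)
                + (e′ - n * (e * (t * t - 1ℤ) - + 2 * t * f) - t * (f′ - n * (f * (t * t - 1ℤ) + + 2 * t * e)))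
              ≡ e * 1ℤ + f * t - (t * f′ - 1ℤ * e′)
            split = solve-∀
            parity-im : ∀ e f e′ f′ → Odd e → Odd e′ → Even f → Even f′ → Even (e * 1ℤ + f * t - (t * f′ - 1ℤ * e′))
            parity-im _ _ _ _ (odd k refl) (odd k′ refl) (even l refl) (even l′ refl) =
              even (1ℤ + k + k′ + l * t - t * l′) (eq k k′ l l′ t)
              where
              eq : ∀ k k′ l l′ t → (1ℤ + + 2 * k) * 1ℤ + + 2 * l * t - (t * (+ 2 * l′) - 1ℤ * (1ℤ + + 2 * k′))
                                   ≡ + 2 * (1ℤ + k + k′ + l * t - t * l′)
              eq = solve-∀

        rotated-embedding : PlaneEmbedding p t
        rotated-embedding = intertwined-embedding D D′ p-prime p≢7
          (proj₂ (proj₂ t-intertwiner)) (proj₂ (proj₂ p-intertwiner))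

  some-discriminant7 : Discriminant7 p
  some-discriminant7 = from-zero (two-squares-plus-7 p-prime {h} p≡)
    where
    from-zero : (∃₂ λ x y → + p ∣ x * x + y * y + + 7) → Discriminant7 p
    from-zero (x , y , p∣) = proj₁ (lift-disc p-prime {h} p≡ x y p∣)

  primitive-embedding : ∀ t → ¬ (+ p ∣ t * t + 1ℤ) → PlaneEmbedding p t
  primitive-embedding t p∤N = from-inverse (inverse-mod p-prime (t * t + 1ℤ) p∤N)
    where
    D = some-discriminant7
    module _ (n : ℤ) (p∣Nn-1 : + p ∣ (t * t + 1ℤ) * n - 1ℤ) where
      from-rotated : (Σ (Discriminant7 p) λ D′ → (+ p ∣ Discriminant7.e D′ - rotated-e t n p∣Nn-1 D)
                                               × (+ p ∣ Discriminant7.f D′ - rotated-f t n p∣Nn-1 D)) →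
                     PlaneEmbedding p t
      from-rotated (D′ , p∣e′ , p∣f′) = rotated-embedding t n p∣Nn-1 D D′ p∣e′ p∣f′
    from-inverse : (∃ λ n → + p ∣ (t * t + 1ℤ) * n - 1ℤ) → PlaneEmbedding p t
    from-inverse (n , p∣Nn-1) = from-rotated n p∣Nn-1 (lift-disc p-prime {h} p≡
      (rotated-e t n p∣Nn-1 D) (rotated-f t n p∣Nn-1 D) (rotated-zero t n p∣Nn-1 D))

-- Gauss reduction of a binary form of determinant 1: once |2b| ≤ a, the equation 4ac = (2b)² + 4 ≤
-- a² + 4 gives c < a for a ≥ 2, and the form with c leading is treated next. `back` undoes the
-- translation and the exchange.
gauss-reduce : ∀ a .{{_ : ℕ.NonZero a}} → Acc _<_ a → ∀ b c → + a * c - b * b ≡ 1ℤ →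
               ∃₂ λ x y → + a * x * x + + 2 * b * x * y + c * y * y ≡ 1ℤ
gauss-reduce 1 _ b c _ = 1ℤ , 0ℤ , at-1 b c
  where
  at-1 : ∀ b c → 1ℤ * 1ℤ * 1ℤ + + 2 * b * 1ℤ * 0ℤ + c * 0ℤ * 0ℤ ≡ 1ℤ
  at-1 = solve-∀
gauss-reduce a@(suc a′@(suc a″)) (acc rs) b c ac-b²≡1 = step (centred (+ 2 * b) a)
  where
  step : (∃ λ s → ∣ + 2 * b + + 2 * + a * s ∣ ≤ a) → ∃₂ λ x y → + a * x * x + + 2 * b * x * y + c * y * y ≡ 1ℤ
  step (s , small) = recurse c₁ refl
    where
    b₁ c₁ : ℤ
    b₁ = b + + a * s
    c₁ = c + + 2 * b * s + + a * s * s
    det₁ : + a * c₁ ≡ b₁ * b₁ + 1ℤ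
    det₁ = trans (expand (+ a) b c s) (cong (_+_ (b₁ * b₁)) ac-b²≡1)
      where
      expand : ∀ a b c s → a * (c + + 2 * b * s + a * s * s) ≡ (b + a * s) * (b + a * s) + (a * c - b * b)
      expand = solve-∀
    2b₁≤a : 2 ℕ.* ∣ b₁ ∣ ≤ a
    2b₁≤a = subst (_≤ a) (trans (cong ∣_∣ (factor (+ a) b s)) (ℤ.abs-* (+ 2) b₁)) small
      where
      factor : ∀ a b s → + 2 * b + + 2 * a * s ≡ + 2 * (b + a * s)
      factor = solve-∀
    recurse : ∀ c₁′ → c₁ ≡ c₁′ → ∃₂ λ x y → + a * x * x + + 2 * b * x * y + c * y * y ≡ 1ℤ
    recurse (+ c₂) c₁≡ = back (descend c₂ natural det₂)
      where
      natural : a ℕ.* c₂ ≡ ∣ b₁ ∣ ℕ.* ∣ b₁ ∣ ℕ.+ 1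
      natural = ℤ.+-injective (trans (ℤ.pos-* a c₂) (trans (cong (+ a *_) (sym c₁≡))
        (trans det₁ (cong (_+ 1ℤ) (square-abs b₁)))))
      det₂ : + c₂ * + a - b₁ * b₁ ≡ 1ℤ
      det₂ = trans (cong (_- b₁ * b₁) (trans (ℤ.*-comm (+ c₂) (+ a)) (trans (cong (+ a *_) (sym c₁≡)) det₁))) (cancel (b₁ * b₁))
        where
        cancel : ∀ x → x + 1ℤ - x ≡ 1ℤ
        cancel = solve-∀
      descend : ∀ c₂ → a ℕ.* c₂ ≡ ∣ b₁ ∣ ℕ.* ∣ b₁ ∣ ℕ.+ 1 → + c₂ * + a - b₁ * b₁ ≡ 1ℤ →
                ∃₂ λ x y → + c₂ * x * x + + 2 * b₁ * x * y + + a * y * y ≡ 1ℤ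
      descend 0 eq _ = contradiction (trans (sym (ℕ.*-zeroʳ a)) eq) (λ e → ℕ.m+1+n≢0 _ (sym e))
      descend c₂@(suc _) eq d = gauss-reduce c₂ (rs c₂<a) b₁ (+ a) d
        where
        c₂<a : c₂ < a
        c₂<a = ℕ.*-cancelˡ-< 4 c₂ a (ℕ.*-cancelˡ-< a (4 ℕ.* c₂) (4 ℕ.* a) (begin-strict
          a ℕ.* (4 ℕ.* c₂)                       ≡⟨ swap₄ a c₂ ⟩
          4 ℕ.* (a ℕ.* c₂)                       ≡⟨ cong (4 ℕ.*_) eq ⟩
          4 ℕ.* (∣ b₁ ∣ ℕ.* ∣ b₁ ∣ ℕ.+ 1)         ≡⟨ square₂ ∣ b₁ ∣ ⟩
          2 ℕ.* ∣ b₁ ∣ ℕ.* (2 ℕ.* ∣ b₁ ∣) ℕ.+ 4    <⟨ ℕ.+-mono-≤-< (ℕ.*-mono-≤ 2b₁≤a 2b₁≤a) (ℕ.n<1+n 4) ⟩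
          a ℕ.* a ℕ.+ 5                          ≤⟨ ℕ.m≤m+n _ (7 ℕ.+ 12 ℕ.* a″ ℕ.+ 3 ℕ.* a″ ℕ.* a″) ⟩
          a ℕ.* a ℕ.+ 5 ℕ.+ (7 ℕ.+ 12 ℕ.* a″ ℕ.+ 3 ℕ.* a″ ℕ.* a″) ≡⟨ expand₄ a″ ⟩
          a ℕ.* (4 ℕ.* a)                        ∎))
          where
          open ℕ.≤-Reasoning
          swap₄ : ∀ a c → a ℕ.* (4 ℕ.* c) ≡ 4 ℕ.* (a ℕ.* c)
          swap₄ = ℕ-Ring.solve-∀
          square₂ : ∀ b → 4 ℕ.* (b ℕ.* b ℕ.+ 1) ≡ 2 ℕ.* b ℕ.* (2 ℕ.* b) ℕ.+ 4
          square₂ = ℕ-Ring.solve-∀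
          expand₄ : ∀ a → (2 ℕ.+ a) ℕ.* (2 ℕ.+ a) ℕ.+ 5 ℕ.+ (7 ℕ.+ 12 ℕ.* a ℕ.+ 3 ℕ.* a ℕ.* a)
                          ≡ (2 ℕ.+ a) ℕ.* (4 ℕ.* (2 ℕ.+ a))
          expand₄ = ℕ-Ring.solve-∀
      back : (∃₂ λ x y → + c₂ * x * x + + 2 * b₁ * x * y + + a * y * y ≡ 1ℤ) →
             ∃₂ λ x y → + a * x * x + + 2 * b * x * y + c * y * y ≡ 1ℤ
      back (x , y , eq) = y + s * x , x , trans (expand (+ a) b c s x y)
              (trans (cong (λ c → c * x * x + + 2 * b₁ * x * y + + a * y * y) c₁≡) eq)
        where
        expand : ∀ a b c s x y →
          a * (y + s * x) * (y + s * x) + + 2 * b * (y + s * x) * x + c * x * x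
          ≡ (c + + 2 * b * s + a * s * s) * x * x + + 2 * (b + a * s) * x * y + a * y * y
        expand = solve-∀
    recurse -[1+ c₂ ] c₁≡ with trans (cong (+ a *_) (sym c₁≡)) (trans det₁ (cong (_+ 1ℤ) (square-abs b₁)))
    ... | ()

-- Searches over residues

∧-sound : ∀ a {b} → T (a ∧ b) → T a × T b
∧-sound true t = tt , t

∨-sound : ∀ a {b} → T (a ∨ b) → T a ⊎ T b
∨-sound true  t = inj₁ tt
∨-sound false t = inj₂ t

infixr 4 _⇒ᵇ_
_⇒ᵇ_ : Bool → Bool → Bool
true  ⇒ᵇ b = b
false ⇒ᵇ b = true

⇒-sound : ∀ a {b} → T (a ⇒ᵇ b) → T a → T b
⇒-sound true t _ = t

not-complete : ∀ b → ¬ T b → T (not b)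
not-complete true  ¬t = ¬t tt
not-complete false ¬t = tt

not-sound : ∀ b → T (not b) → ¬ T b
not-sound true () _

∨-not-sound : ∀ a b → T (a ∨ not b) → T b → T a
∨-not-sound true  b    _  _ = tt
∨-not-sound false true () _

allFinᵇ anyFinᵇ : ∀ n → (Fin n → Bool) → Bool
allFinᵇ zero    P = true
allFinᵇ (suc n) P = P zero ∧ allFinᵇ n (λ i → P (suc i))
anyFinᵇ zero    P = false
anyFinᵇ (suc n) P = P zero ∨ anyFinᵇ n (λ i → P (suc i))

allFin-sound : ∀ n {P} → T (allFinᵇ n P) → ∀ i → T (P i)
allFin-sound (suc n) {P} t zero    = proj₁ (∧-sound (P zero) t)
allFin-sound (suc n) {P} t (suc i) = allFin-sound n (proj₂ (∧-sound (P zero) t)) i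

allFin-complete : ∀ n {P} → (∀ i → T (P i)) → T (allFinᵇ n P)
allFin-complete zero    t = tt
allFin-complete (suc n) {P} t with P zero | t zero
... | true | _ = allFin-complete n (λ i → t (suc i))

anyFin-sound : ∀ n {P} → T (anyFinᵇ n P) → ∃ λ i → T (P i)
anyFin-sound (suc n) {P} t with ∨-sound (P zero) t
... | inj₁ t₀ = zero , t₀
... | inj₂ t′ with i , tᵢ ← anyFin-sound n t′ = suc i , tᵢ

allBelow : ℕ → (ℕ → Bool) → Bool
allBelow zero    P = true
allBelow (suc n) P = P n ∧ allBelow n P

allBelow-sound : ∀ n {P} → T (allBelow n P) → ∀ i → i < n → T (P i)
allBelow-sound (suc n) {P} t i (s≤s i≤n) with ℕ.m≤n⇒m<n∨m≡n i≤n
... | inj₁ i<n  = allBelow-sound n (proj₂ (∧-sound (P n) t)) i i<n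
... | inj₂ refl = proj₁ (∧-sound (P n) t)

Digits : ℕ → Set
Digits n = Fin n → ℕ

infixr 5 _◂_
_◂_ : ∀ {A : Set} {n} → A → (Fin n → A) → Fin (suc n) → A
(a ◂ x) zero    = a
(a ◂ x) (suc i) = x i

empty : ∀ {A : Set} → Fin 0 → A
empty ()

allDigits : ℕ → ∀ n → (Digits n → Bool) → Bool
allDigits q zero    P = P empty
allDigits q (suc n) P = allBelow q (λ d → allDigits q n (λ x → P (d ◂ x)))

-- `P` need not respect pointwise equality of functions, so the lemma returns the digits that were
-- actually tested, with a proof that they agree with `d`.
allDigits-sound : ∀ q n {P} → T (allDigits q n P) → (d : Digits n) → (∀ i → d i < q) →
                  ∃ λ d′ → T (P d′) × (∀ i → d′ i ≡ d i)
allDigits-sound q zero    t d d<q = empty , t , λ ()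
allDigits-sound q (suc n) t d d<q
  with d′ , t′ , d′≗d ← allDigits-sound q n (allBelow-sound q t (d zero) (d<q zero)) (λ i → d (suc i)) (λ i → d<q (suc i)) =
  d zero ◂ d′ , t′ , λ { zero → refl ; (suc i) → d′≗d i }

infix 25 ⁺_
⁺_ : ∀ {n} → Digits n → Vec n
(⁺ d) i = + d i

_≋_[_] : ∀ {n} → Vec n → Vec n → ℕ → Set
x ≋ y [ q ] = ∀ i → + q ∣ x i - y i

module _ {q : ℕ} .{{_ : ℕ.NonZero q}} where

  residues : ∀ {n} {P} → T (allDigits q n P) → (x : Vec n) → ∃ λ d → T (P d) × x ≋ ⁺ d [ q ]
  residues {n} t x with d , td , d≗ ← allDigits-sound q n t (λ i → x i ℤ.%ℕ q) (λ i → ℤ.n%ℕd<d (x i) q) =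
    d , td , λ i → divides (x i ℤ./ℕ q)
      (trans (cong₂ (λ a b → a - + b) (ℤ.a≡a%ℕn+[a/ℕn]*n (x i) q) (d≗ i))
             (cancel (+ (x i ℤ.%ℕ q)) (x i ℤ./ℕ q * + q)))
    where
    cancel : ∀ r s → r + s - r ≡ s
    cancel = solve-∀

divisible : ℕ → ℤ → Bool
divisible zero    a = false
divisible (suc q) a = (a ℤ.%ℕ suc q) ≡ᵇ 0

divisible-sound : ∀ q a → T (divisible q a) → + q ∣ a
divisible-sound (suc q) a t = divides (a ℤ./ℕ suc q)
  (trans (ℤ.a≡a%ℕn+[a/ℕn]*n a (suc q))
    (trans (cong (λ r → + r + a ℤ./ℕ suc q * + suc q) (ℕ.≡ᵇ⇒≡ _ 0 t)) (ℤ.+-identityˡ _)))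

divisible-complete : ∀ q a → + suc q ∣ a → T (divisible (suc q) a)
divisible-complete q a q∣a with a ℤ.%ℕ suc q in eq
... | 0 = tt
... | r@(suc _) = contradiction (ℕ.∣⇒≤ (∣⇒∣ᵤ q∣r)) (ℕ.<⇒≱ (subst (_< suc q) eq (ℤ.n%ℕd<d a (suc q))))
  where
  q∣r : + suc q ∣ + r
  q∣r = ∣-subst (trans (cong (_- a ℤ./ℕ suc q * + suc q) (trans (ℤ.a≡a%ℕn+[a/ℕn]*n a (suc q)) (cong (λ r → + r + a ℤ./ℕ suc q * + suc q) eq)))
                       (cancel (+ r) (a ℤ./ℕ suc q * + suc q)))
          (∣m∣n⇒∣m-n q∣a (divides (a ℤ./ℕ suc q) refl))
    where
    cancel : ∀ r s → r + s - s ≡ r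
    cancel = solve-∀

divisibleᵥ : ∀ {n} → ℕ → Vec n → Bool
divisibleᵥ {n} q x = allFinᵇ n (λ i → divisible q (x i))

_∣ᵥ_ : ∀ {n} → ℕ → Vec n → Set
q ∣ᵥ x = ∀ i → + q ∣ x i

divisibleᵥ-sound : ∀ {n} q (x : Vec n) → T (divisibleᵥ q x) → q ∣ᵥ x
divisibleᵥ-sound {n} q x t i = divisible-sound q (x i) (allFin-sound n t i)

divisibleᵥ-complete : ∀ {n} q (x : Vec n) → suc q ∣ᵥ x → T (divisibleᵥ (suc q) x)
divisibleᵥ-complete {n} q x q∣x = allFin-complete n (λ i → divisible-complete q (x i) (q∣x i))

∑-∣ : ∀ n {k} {f : Fin n → ℤ} → (∀ i → k ∣ f i) → k ∣ ∑ n f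
∑-∣ zero    k∣f = divides 0ℤ refl
∑-∣ (suc n) k∣f = ∣m∣n⇒∣m+n (k∣f zero) (∑-∣ n (λ i → k∣f (suc i)))

∑-≡-mod : ∀ n {k} (f g : Fin n → ℤ) → (∀ i → k ∣ f i - g i) → k ∣ ∑ n f - ∑ n g
∑-≡-mod zero    f g k∣ = divides 0ℤ refl
∑-≡-mod (suc n) f g k∣ = ∣-subst (regroup (f zero) (g zero) _ _)
  (∣m∣n⇒∣m+n (k∣ zero) (∑-≡-mod n (λ i → f (suc i)) (λ i → g (suc i)) (λ i → k∣ (suc i))))
  where
  regroup : ∀ a b c d → a - b + (c - d) ≡ a + c - (b + d)
  regroup = solve-∀

*-≡-mod : ∀ {k a a′ b b′} → k ∣ a - a′ → k ∣ b - b′ → k ∣ a * b - a′ * b′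
*-≡-mod {k} {a} {a′} {b} {b′} p q = ∣-subst (regroup a a′ b b′) (∣m∣n⇒∣m+n (∣m⇒∣m*n b p) (∣n⇒∣m*n a′ q))
  where
  regroup : ∀ a a′ b b′ → (a - a′) * b + a′ * (b - b′) ≡ a * b - a′ * b′
  regroup = solve-∀

const-≡-mod : ∀ k a → k ∣ a - a
const-≡-mod k a = divides 0ℤ (ℤ.+-inverseʳ a)

⊙-≡-mod : ∀ {m n q} (E : Mat m n) x y → x ≋ y [ q ] → (E ⊙ x) ≋ (E ⊙ y) [ q ]
⊙-≡-mod {n = n} E x y x≋y i = ∑-≡-mod n _ _ (λ j → *-≡-mod {a = E i j} {E i j} {x j} {y j} (const-≡-mod _ (E i j)) (x≋y j))

⟪⟫-≡-mod : ∀ {n q} (G : Mat n n) x x′ y y′ → x ≋ x′ [ q ] → y ≋ y′ [ q ] → + q ∣ ⟪ G ⟫ x y - ⟪ G ⟫ x′ y′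
⟪⟫-≡-mod {n} G x x′ y y′ x≋ y≋ = ∑-≡-mod n _ _ (λ i → *-≡-mod {a = x i} {x′ i} {(G ⊙ y) i} {(G ⊙ y′) i} (x≋ i) (⊙-≡-mod G y y′ y≋ i))

∣-resp-≡-mod : ∀ {k a b} → k ∣ a - b → k ∣ b → k ∣ a
∣-resp-≡-mod {k} {a} {b} p q = ∣-subst (cancel a b) (∣m∣n⇒∣m+n p q)
  where
  cancel : ∀ a b → a - b + b ≡ a
  cancel = solve-∀

∣-resp-≡-mod′ : ∀ {k a b} → k ∣ a - b → k ∣ a → k ∣ b
∣-resp-≡-mod′ {k} {a} {b} p q = ∣-subst (cancel a b) (∣m∣n⇒∣m-n q p)
  where
  cancel : ∀ a b → a - (a - b) ≡ b
  cancel = solve-∀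

∑ℕ : ∀ n → (Fin n → ℕ) → ℕ
∑ℕ zero    f = 0
∑ℕ (suc n) f = f zero ℕ.+ ∑ℕ n (λ i → f (suc i))

dotℕ : ∀ {n} → Digits n → Digits n → ℕ
dotℕ {n} x y = ∑ℕ n (λ i → x i ℕ.* y i)

dot : ∀ {n} → Vec n → Vec n → ℤ
dot {n} x y = ∑ n (λ i → x i * y i)

dot-⁺ : ∀ {n} (x y : Digits n) → dot (⁺ x) (⁺ y) ≡ + dotℕ x y
dot-⁺ {zero}  x y = refl
dot-⁺ {suc n} x y = cong₂ _+_ (sym (ℤ.pos-* (x zero) (y zero))) (dot-⁺ (λ i → x (suc i)) (λ i → y (suc i)))

dot-congʳ : ∀ {n} (x : Vec n) {y z : Vec n} → y ≈ᵥ z → dot x y ≡ dot x z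
dot-congʳ {n} x y≈z = ∑-cong n (λ i → cong (x i *_) (y≈z i))

⟪_⟫ℕ : ∀ {n} → (Fin n → Digits n) → Digits n → Digits n → ℕ
⟪ G ⟫ℕ x y = dotℕ x (λ i → dotℕ (G i) y)

⟪⟫-⁺ : ∀ {n} (G : Fin n → Digits n) x y → ⟪ (λ i → ⁺ G i) ⟫ (⁺ x) (⁺ y) ≡ + ⟪ G ⟫ℕ x y
⟪⟫-⁺ G x y = trans (dot-congʳ (⁺ x) (λ i → dot-⁺ (G i) y)) (dot-⁺ x (λ i → dotℕ (G i) y))

-- The lattices O, K, T and similarities between them

-- Halves of these are isometric embeddings of O ⊗ ℚ in L ⊗ ℚ. Each plane of O / 2O that is totally isotropic for
-- the trace form, not entirely of even norm and different from ℤ[i] is mapped to L by one of them.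
O→L : V.Vec (V.Vec (V.Vec ℤ 4) 5) 8
O→L =
    ((-[1+ 1 ] ∷ + 0 ∷ -[1+ 0 ] ∷ + 0 ∷ [])
     ∷ (+ 0 ∷ -[1+ 0 ] ∷ -[1+ 0 ] ∷ + 0 ∷ [])
     ∷ (+ 0 ∷ + 0 ∷ -[1+ 0 ] ∷ -[1+ 1 ] ∷ [])
     ∷ (+ 0 ∷ -[1+ 0 ] ∷ + 0 ∷ -[1+ 1 ] ∷ [])
     ∷ (+ 0 ∷ + 0 ∷ -[1+ 0 ] ∷ + 0 ∷ [])
     ∷ [])
  ∷ ((+ 0 ∷ -[1+ 1 ] ∷ + 0 ∷ -[1+ 0 ] ∷ [])
     ∷ (-[1+ 0 ] ∷ + 0 ∷ + 0 ∷ -[1+ 0 ] ∷ [])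
     ∷ (+ 0 ∷ + 0 ∷ -[1+ 1 ] ∷ -[1+ 0 ] ∷ [])
     ∷ (-[1+ 0 ] ∷ + 0 ∷ -[1+ 1 ] ∷ + 0 ∷ [])
     ∷ (+ 0 ∷ + 0 ∷ + 0 ∷ -[1+ 0 ] ∷ [])
     ∷ [])
  ∷ ((+ 0 ∷ -[1+ 0 ] ∷ -[1+ 0 ] ∷ + 1 ∷ [])
     ∷ (-[1+ 0 ] ∷ + 0 ∷ -[1+ 0 ] ∷ -[1+ 0 ] ∷ [])
     ∷ (+ 1 ∷ + 0 ∷ -[1+ 0 ] ∷ -[1+ 0 ] ∷ [])
     ∷ (+ 0 ∷ + 0 ∷ -[1+ 1 ] ∷ + 0 ∷ [])
     ∷ (+ 0 ∷ + 1 ∷ -[1+ 0 ] ∷ + 1 ∷ [])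
     ∷ [])
  ∷ ((+ 0 ∷ -[1+ 1 ] ∷ + 0 ∷ -[1+ 0 ] ∷ [])
     ∷ (-[1+ 0 ] ∷ + 0 ∷ -[1+ 0 ] ∷ -[1+ 0 ] ∷ [])
     ∷ (+ 0 ∷ + 0 ∷ + 2 ∷ -[1+ 0 ] ∷ [])
     ∷ (-[1+ 0 ] ∷ + 0 ∷ + 1 ∷ + 0 ∷ [])
     ∷ (+ 0 ∷ + 0 ∷ + 0 ∷ -[1+ 0 ] ∷ [])
     ∷ [])
  ∷ ((+ 2 ∷ + 0 ∷ + 1 ∷ + 0 ∷ [])
     ∷ (+ 0 ∷ -[1+ 0 ] ∷ -[1+ 0 ] ∷ -[1+ 0 ] ∷ [])
     ∷ (+ 0 ∷ + 0 ∷ -[1+ 0 ] ∷ + 2 ∷ [])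
     ∷ (+ 0 ∷ -[1+ 0 ] ∷ + 0 ∷ + 1 ∷ [])
     ∷ (+ 0 ∷ + 0 ∷ -[1+ 0 ] ∷ + 0 ∷ [])
     ∷ [])
  ∷ ((-[1+ 0 ] ∷ + 0 ∷ -[1+ 1 ] ∷ + 1 ∷ [])
     ∷ (+ 0 ∷ -[1+ 0 ] ∷ + 1 ∷ + 0 ∷ [])
     ∷ (+ 0 ∷ -[1+ 0 ] ∷ -[1+ 0 ] ∷ -[1+ 1 ] ∷ [])
     ∷ (-[1+ 0 ] ∷ -[1+ 0 ] ∷ -[1+ 0 ] ∷ -[1+ 0 ] ∷ [])
     ∷ (-[1+ 0 ] ∷ + 0 ∷ + 0 ∷ -[1+ 0 ] ∷ [])
     ∷ [])
  ∷ ((+ 0 ∷ + 1 ∷ -[1+ 0 ] ∷ -[1+ 0 ] ∷ [])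
     ∷ (-[1+ 0 ] ∷ + 0 ∷ + 0 ∷ -[1+ 0 ] ∷ [])
     ∷ (-[1+ 0 ] ∷ + 0 ∷ -[1+ 1 ] ∷ + 1 ∷ [])
     ∷ (+ 0 ∷ + 0 ∷ -[1+ 1 ] ∷ + 0 ∷ [])
     ∷ (+ 0 ∷ -[1+ 0 ] ∷ -[1+ 0 ] ∷ -[1+ 0 ] ∷ [])
     ∷ [])
  ∷ ((+ 1 ∷ + 0 ∷ -[1+ 0 ] ∷ -[1+ 0 ] ∷ [])
     ∷ (+ 0 ∷ -[1+ 0 ] ∷ -[1+ 0 ] ∷ + 0 ∷ [])
     ∷ (+ 0 ∷ -[1+ 0 ] ∷ + 1 ∷ -[1+ 1 ] ∷ [])
     ∷ (-[1+ 0 ] ∷ -[1+ 0 ] ∷ + 0 ∷ -[1+ 0 ] ∷ [])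
     ∷ (-[1+ 0 ] ∷ + 0 ∷ -[1+ 0 ] ∷ -[1+ 0 ] ∷ [])
     ∷ [])
  ∷ []

-- Thirds of these are isometries K ⊗ ℚ → L ⊗ ℚ, which identify various 3-neighbours of K with L.
K→L : V.Vec (V.Vec (V.Vec ℤ 5) 5) 16
K→L =
    ((-[1+ 2 ] ∷ + 0 ∷ + 0 ∷ + 0 ∷ + 0 ∷ [])
     ∷ (+ 0 ∷ + 1 ∷ + 1 ∷ -[1+ 1 ] ∷ -[1+ 2 ] ∷ [])
     ∷ (+ 0 ∷ -[1+ 1 ] ∷ + 1 ∷ -[1+ 1 ] ∷ + 0 ∷ [])
     ∷ (+ 0 ∷ -[1+ 1 ] ∷ + 1 ∷ + 1 ∷ -[1+ 2 ] ∷ [])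
     ∷ (+ 0 ∷ -[1+ 0 ] ∷ -[1+ 0 ] ∷ -[1+ 0 ] ∷ -[1+ 2 ] ∷ [])
     ∷ [])
  ∷ ((-[1+ 2 ] ∷ + 0 ∷ + 0 ∷ + 0 ∷ + 0 ∷ [])
     ∷ (+ 0 ∷ -[1+ 0 ] ∷ + 1 ∷ -[1+ 1 ] ∷ -[1+ 2 ] ∷ [])
     ∷ (+ 0 ∷ + 0 ∷ + 0 ∷ + 3 ∷ -[1+ 2 ] ∷ [])
     ∷ (+ 0 ∷ + 2 ∷ + 1 ∷ + 1 ∷ -[1+ 2 ] ∷ [])
     ∷ (+ 0 ∷ + 1 ∷ -[1+ 0 ] ∷ -[1+ 0 ] ∷ -[1+ 2 ] ∷ [])
     ∷ [])
  ∷ ((+ 0 ∷ -[1+ 2 ] ∷ + 0 ∷ + 0 ∷ + 0 ∷ [])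
     ∷ (+ 1 ∷ + 0 ∷ + 1 ∷ -[1+ 1 ] ∷ -[1+ 2 ] ∷ [])
     ∷ (-[1+ 1 ] ∷ + 0 ∷ + 1 ∷ -[1+ 1 ] ∷ + 0 ∷ [])
     ∷ (-[1+ 1 ] ∷ + 0 ∷ + 1 ∷ + 1 ∷ -[1+ 2 ] ∷ [])
     ∷ (-[1+ 0 ] ∷ + 0 ∷ -[1+ 0 ] ∷ -[1+ 0 ] ∷ -[1+ 2 ] ∷ [])
     ∷ [])
  ∷ ((+ 0 ∷ -[1+ 2 ] ∷ + 0 ∷ + 0 ∷ + 0 ∷ [])
     ∷ (-[1+ 0 ] ∷ + 0 ∷ + 1 ∷ -[1+ 1 ] ∷ -[1+ 2 ] ∷ [])
     ∷ (+ 0 ∷ + 0 ∷ + 0 ∷ + 3 ∷ -[1+ 2 ] ∷ [])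
     ∷ (+ 2 ∷ + 0 ∷ + 1 ∷ + 1 ∷ -[1+ 2 ] ∷ [])
     ∷ (+ 1 ∷ + 0 ∷ -[1+ 0 ] ∷ -[1+ 0 ] ∷ -[1+ 2 ] ∷ [])
     ∷ [])
  ∷ ((+ 0 ∷ + 0 ∷ -[1+ 2 ] ∷ + 0 ∷ + 0 ∷ [])
     ∷ (+ 1 ∷ + 1 ∷ + 0 ∷ -[1+ 1 ] ∷ -[1+ 2 ] ∷ [])
     ∷ (-[1+ 1 ] ∷ + 1 ∷ + 0 ∷ -[1+ 1 ] ∷ + 0 ∷ [])
     ∷ (-[1+ 1 ] ∷ + 1 ∷ + 0 ∷ + 1 ∷ -[1+ 2 ] ∷ [])
     ∷ (-[1+ 0 ] ∷ -[1+ 0 ] ∷ + 0 ∷ -[1+ 0 ] ∷ -[1+ 2 ] ∷ [])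
     ∷ [])
  ∷ ((+ 0 ∷ + 0 ∷ -[1+ 2 ] ∷ + 0 ∷ + 0 ∷ [])
     ∷ (-[1+ 0 ] ∷ -[1+ 0 ] ∷ + 0 ∷ -[1+ 1 ] ∷ -[1+ 2 ] ∷ [])
     ∷ (-[1+ 0 ] ∷ + 2 ∷ + 0 ∷ -[1+ 1 ] ∷ + 0 ∷ [])
     ∷ (-[1+ 0 ] ∷ + 2 ∷ + 0 ∷ + 1 ∷ -[1+ 2 ] ∷ [])
     ∷ (+ 1 ∷ + 1 ∷ + 0 ∷ -[1+ 0 ] ∷ -[1+ 2 ] ∷ [])
     ∷ [])
  ∷ ((-[1+ 0 ] ∷ -[1+ 0 ] ∷ -[1+ 0 ] ∷ -[1+ 1 ] ∷ + 4 ∷ [])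
     ∷ (-[1+ 0 ] ∷ -[1+ 0 ] ∷ -[1+ 0 ] ∷ + 1 ∷ -[1+ 1 ] ∷ [])
     ∷ (+ 1 ∷ + 1 ∷ -[1+ 1 ] ∷ -[1+ 0 ] ∷ -[1+ 0 ] ∷ [])
     ∷ (-[1+ 0 ] ∷ + 2 ∷ -[1+ 0 ] ∷ -[1+ 1 ] ∷ -[1+ 1 ] ∷ [])
     ∷ (+ 0 ∷ + 0 ∷ + 0 ∷ -[1+ 2 ] ∷ -[1+ 2 ] ∷ [])
     ∷ [])
  ∷ ((+ 1 ∷ + 1 ∷ + 1 ∷ -[1+ 1 ] ∷ + 4 ∷ [])
     ∷ (-[1+ 0 ] ∷ -[1+ 0 ] ∷ -[1+ 0 ] ∷ -[1+ 0 ] ∷ + 2 ∷ [])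
     ∷ (-[1+ 0 ] ∷ -[1+ 0 ] ∷ + 2 ∷ -[1+ 0 ] ∷ -[1+ 0 ] ∷ [])
     ∷ (+ 1 ∷ -[1+ 1 ] ∷ + 1 ∷ -[1+ 1 ] ∷ -[1+ 1 ] ∷ [])
     ∷ (+ 0 ∷ + 0 ∷ + 0 ∷ -[1+ 2 ] ∷ -[1+ 2 ] ∷ [])
     ∷ [])
  ∷ ((-[1+ 0 ] ∷ -[1+ 0 ] ∷ + 1 ∷ -[1+ 1 ] ∷ + 4 ∷ [])
     ∷ (-[1+ 0 ] ∷ -[1+ 0 ] ∷ + 1 ∷ + 1 ∷ -[1+ 1 ] ∷ [])
     ∷ (+ 1 ∷ -[1+ 1 ] ∷ -[1+ 0 ] ∷ -[1+ 0 ] ∷ -[1+ 0 ] ∷ [])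
     ∷ (+ 2 ∷ -[1+ 0 ] ∷ + 1 ∷ -[1+ 1 ] ∷ -[1+ 1 ] ∷ [])
     ∷ (+ 0 ∷ + 0 ∷ + 0 ∷ -[1+ 2 ] ∷ -[1+ 2 ] ∷ [])
     ∷ [])
  ∷ ((-[1+ 0 ] ∷ -[1+ 0 ] ∷ + 1 ∷ + 2 ∷ -[1+ 3 ] ∷ [])
     ∷ (-[1+ 0 ] ∷ -[1+ 0 ] ∷ + 1 ∷ -[1+ 0 ] ∷ + 2 ∷ [])
     ∷ (-[1+ 0 ] ∷ + 2 ∷ + 1 ∷ -[1+ 0 ] ∷ -[1+ 0 ] ∷ [])
     ∷ (+ 1 ∷ + 1 ∷ + 2 ∷ -[1+ 1 ] ∷ -[1+ 1 ] ∷ [])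
     ∷ (+ 0 ∷ + 0 ∷ + 0 ∷ -[1+ 2 ] ∷ -[1+ 2 ] ∷ [])
     ∷ [])
  ∷ ((+ 0 ∷ + 0 ∷ -[1+ 2 ] ∷ + 0 ∷ + 0 ∷ [])
     ∷ (-[1+ 0 ] ∷ + 1 ∷ + 0 ∷ + 2 ∷ + 3 ∷ [])
     ∷ (+ 0 ∷ + 0 ∷ + 0 ∷ -[1+ 2 ] ∷ + 3 ∷ [])
     ∷ (+ 2 ∷ + 1 ∷ + 0 ∷ -[1+ 0 ] ∷ + 3 ∷ [])
     ∷ (+ 1 ∷ -[1+ 0 ] ∷ + 0 ∷ + 1 ∷ + 3 ∷ [])
     ∷ [])
  ∷ ((+ 0 ∷ + 0 ∷ -[1+ 2 ] ∷ + 0 ∷ + 0 ∷ [])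
     ∷ (-[1+ 0 ] ∷ + 1 ∷ + 0 ∷ -[1+ 1 ] ∷ -[1+ 2 ] ∷ [])
     ∷ (+ 0 ∷ + 0 ∷ + 0 ∷ + 3 ∷ -[1+ 2 ] ∷ [])
     ∷ (+ 2 ∷ + 1 ∷ + 0 ∷ + 1 ∷ -[1+ 2 ] ∷ [])
     ∷ (+ 1 ∷ -[1+ 0 ] ∷ + 0 ∷ -[1+ 0 ] ∷ -[1+ 2 ] ∷ [])
     ∷ [])
  ∷ ((-[1+ 0 ] ∷ + 1 ∷ -[1+ 0 ] ∷ -[1+ 1 ] ∷ + 4 ∷ [])
     ∷ (-[1+ 0 ] ∷ + 1 ∷ -[1+ 0 ] ∷ + 1 ∷ -[1+ 1 ] ∷ [])
     ∷ (-[1+ 0 ] ∷ + 1 ∷ + 2 ∷ + 1 ∷ + 1 ∷ [])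
     ∷ (+ 1 ∷ + 2 ∷ + 1 ∷ + 2 ∷ + 2 ∷ [])
     ∷ (+ 0 ∷ + 0 ∷ + 0 ∷ + 3 ∷ + 3 ∷ [])
     ∷ [])
  ∷ ((-[1+ 0 ] ∷ + 1 ∷ -[1+ 0 ] ∷ + 2 ∷ -[1+ 3 ] ∷ [])
     ∷ (+ 1 ∷ -[1+ 0 ] ∷ + 1 ∷ + 1 ∷ -[1+ 1 ] ∷ [])
     ∷ (+ 1 ∷ -[1+ 0 ] ∷ -[1+ 1 ] ∷ + 1 ∷ + 1 ∷ [])
     ∷ (+ 2 ∷ + 1 ∷ -[1+ 0 ] ∷ + 2 ∷ + 2 ∷ [])
     ∷ (+ 0 ∷ + 0 ∷ + 0 ∷ + 3 ∷ + 3 ∷ [])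
     ∷ [])
  ∷ ((+ 1 ∷ -[1+ 0 ] ∷ -[1+ 0 ] ∷ + 2 ∷ -[1+ 3 ] ∷ [])
     ∷ (-[1+ 0 ] ∷ + 1 ∷ + 1 ∷ + 1 ∷ -[1+ 1 ] ∷ [])
     ∷ (-[1+ 0 ] ∷ + 1 ∷ -[1+ 1 ] ∷ + 1 ∷ + 1 ∷ [])
     ∷ (+ 1 ∷ + 2 ∷ -[1+ 0 ] ∷ + 2 ∷ + 2 ∷ [])
     ∷ (+ 0 ∷ + 0 ∷ + 0 ∷ + 3 ∷ + 3 ∷ [])
     ∷ [])
  ∷ ((+ 1 ∷ -[1+ 0 ] ∷ -[1+ 0 ] ∷ -[1+ 1 ] ∷ + 4 ∷ [])
     ∷ (+ 1 ∷ -[1+ 0 ] ∷ -[1+ 0 ] ∷ + 1 ∷ -[1+ 1 ] ∷ [])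
     ∷ (-[1+ 0 ] ∷ + 1 ∷ -[1+ 1 ] ∷ -[1+ 0 ] ∷ -[1+ 0 ] ∷ [])
     ∷ (+ 1 ∷ + 2 ∷ -[1+ 0 ] ∷ -[1+ 1 ] ∷ -[1+ 1 ] ∷ [])
     ∷ (+ 0 ∷ + 0 ∷ + 0 ∷ -[1+ 2 ] ∷ -[1+ 2 ] ∷ [])
     ∷ [])
  ∷ []

-- Thirds of these are isometries of T ⊗ ℚ, from the 3-neighbours of T at three of its isotropic lines.
T→T : V.Vec (V.Vec (V.Vec ℤ 3) 3) 3
T→T =
    ((-[1+ 2 ] ∷ + 0 ∷ + 0 ∷ [])
     ∷ (+ 0 ∷ -[1+ 2 ] ∷ -[1+ 1 ] ∷ [])
     ∷ (+ 0 ∷ + 0 ∷ + 3 ∷ [])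
     ∷ [])
  ∷ ((-[1+ 2 ] ∷ + 0 ∷ + 0 ∷ [])
     ∷ (+ 0 ∷ -[1+ 0 ] ∷ -[1+ 3 ] ∷ [])
     ∷ (+ 0 ∷ -[1+ 1 ] ∷ + 1 ∷ [])
     ∷ [])
  ∷ ((-[1+ 1 ] ∷ + 1 ∷ + 5 ∷ [])
     ∷ (+ 0 ∷ -[1+ 2 ] ∷ + 0 ∷ [])
     ∷ (+ 1 ∷ + 1 ∷ + 2 ∷ [])
     ∷ [])
  ∷ []

K→L-kernel : V.Vec (V.Vec ℕ 5) 16
K→L-kernel =
    (0 ∷ 1 ∷ 1 ∷ 1 ∷ 0 ∷ [])
  ∷ (0 ∷ 1 ∷ 2 ∷ 2 ∷ 0 ∷ [])
  ∷ (1 ∷ 0 ∷ 1 ∷ 1 ∷ 0 ∷ [])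
  ∷ (1 ∷ 0 ∷ 2 ∷ 2 ∷ 0 ∷ [])
  ∷ (1 ∷ 1 ∷ 0 ∷ 1 ∷ 0 ∷ [])
  ∷ (1 ∷ 1 ∷ 0 ∷ 2 ∷ 0 ∷ [])
  ∷ (1 ∷ 1 ∷ 1 ∷ 2 ∷ 2 ∷ [])
  ∷ (1 ∷ 1 ∷ 1 ∷ 1 ∷ 1 ∷ [])
  ∷ (1 ∷ 1 ∷ 2 ∷ 2 ∷ 2 ∷ [])
  ∷ (1 ∷ 1 ∷ 2 ∷ 1 ∷ 1 ∷ [])
  ∷ (1 ∷ 2 ∷ 0 ∷ 1 ∷ 0 ∷ [])
  ∷ (1 ∷ 2 ∷ 0 ∷ 2 ∷ 0 ∷ [])
  ∷ (1 ∷ 2 ∷ 1 ∷ 2 ∷ 2 ∷ [])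
  ∷ (1 ∷ 2 ∷ 1 ∷ 1 ∷ 1 ∷ [])
  ∷ (1 ∷ 2 ∷ 2 ∷ 2 ∷ 2 ∷ [])
  ∷ (1 ∷ 2 ∷ 2 ∷ 1 ∷ 1 ∷ [])
  ∷ []

matrix : ∀ {m n} → V.Vec (V.Vec ℤ n) m → Mat m n
matrix M i j = V.lookup (V.lookup M i) j

Kℕ : Fin 5 → Digits 5
Kℕ 0F 0F = 1
Kℕ 1F 1F = 1
Kℕ 2F 2F = 1
Kℕ 3F 3F = 3
Kℕ 3F 4F = 1
Kℕ 4F 3F = 1
Kℕ 4F 4F = 5
Kℕ _ _ = 0

Tℕ : Fin 3 → Digits 3
Tℕ i j = Kℕ (suc (suc i)) (suc (suc j))

-- Gram matrix of the trace form, whose quadratic form is twice `Norm`; the norm form itself has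
-- half-integral products.
Oℕ : Fin 4 → Digits 4
Oℕ 0F 0F = 2
Oℕ 0F 2F = 1
Oℕ 1F 1F = 2
Oℕ 1F 3F = 1
Oℕ 2F 0F = 1
Oℕ 2F 2F = 4
Oℕ 3F 1F = 1
Oℕ 3F 3F = 4
Oℕ _ _ = 0

Kgram : Mat 5 5
Kgram i j = + Kℕ i j
Tgram : Mat 3 3
Tgram i j = + Tℕ i j
Ogram : Mat 4 4
Ogram i j = + Oℕ i j

K→L-map : Fin 16 → Mat 5 5
K→L-map k = matrix (V.lookup K→L k)

O→L-map : Fin 8 → Mat 5 4
O→L-map k = matrix (V.lookup O→L k)

T→T-map : Fin 3 → Mat 3 3
T→T-map k = matrix (V.lookup T→T k)

-- Modulo 3 the map K→L-map k has rank 1, and it kills exactly the vectors orthogonal to annihilator k.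
annihilator : Fin 16 → Digits 5
annihilator k = V.lookup (V.lookup K→L-kernel k)

Similarity : ∀ {m n} → ℤ → Mat m m → Mat n n → Mat m n → Set
Similarity c G H E = (transpose E · (G · E)) ≈ₘ (λ i j → c * H i j)

similarity? : ∀ {m n} c (G : Mat m m) (H : Mat n n) (E : Mat m n) → _
similarity? c G H E = Fin.all? (λ i → Fin.all? (λ j → (transpose E · (G · E)) i j ℤ.≟ c * H i j))

-- The factor 2 is 4/2: each matrix is twice an isometry, and `Ogram` is twice the norm form.
O→L-similarity : ∀ k → Similarity (+ 2) Lgram Ogram (O→L-map k)
O→L-similarity = from-yes (Fin.all? (λ k → similarity? (+ 2) Lgram Ogram (O→L-map k)))

K→L-similarity : ∀ k → Similarity (+ 9) Lgram Kgram (K→L-map k)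
K→L-similarity = from-yes (Fin.all? (λ k → similarity? (+ 9) Lgram Kgram (K→L-map k)))

T→T-similarity : ∀ k → Similarity (+ 9) Tgram Tgram (T→T-map k)
T→T-similarity = from-yes (Fin.all? (λ k → similarity? (+ 9) Tgram Tgram (T→T-map k)))

-- Half of it sends 1 and i to the basis of I₂, and j = 2ω - 1 and ij to the vectors (2, 1, 0) and
-- (1, -1, 1) of T.
O→K : V.Vec (V.Vec ℤ 4) 5
O→K =
    (+ 2 ∷ + 0 ∷ + 1 ∷ + 0 ∷ [])
  ∷ (+ 0 ∷ + 2 ∷ + 0 ∷ + 1 ∷ [])
  ∷ (+ 0 ∷ + 0 ∷ + 2 ∷ + 1 ∷ [])
  ∷ (+ 0 ∷ + 0 ∷ + 1 ∷ -[1+ 0 ] ∷ [])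
  ∷ (+ 0 ∷ + 0 ∷ + 0 ∷ + 1 ∷ []) ∷ []

O→K-similarity : Similarity (+ 2) Kgram Ogram (matrix O→K)
O→K-similarity = from-yes (similarity? (+ 2) Kgram Ogram (matrix O→K))

annihilated : Fin 16 → Digits 5 → Bool
annihilated k d = divisible 3 (+ dotℕ (annihilator k) d)

kernel-test : Fin 16 → Digits 5 → Bool
kernel-test k d = annihilated k d ⇒ᵇ divisibleᵥ 3 (K→L-map k ⊙ ⁺ d)

kernel-tests : T (allDigits 3 5 (λ d → allFinᵇ 16 (λ k → kernel-test k d)))
kernel-tests = tt

common : Digits 5 → Digits 5 → Bool
common u v = anyFinᵇ 16 (λ k → annihilated k u ∧ annihilated k v)

-- The Gram determinant is 1 modulo 3; minus signs are replaced by factors 2.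
unimodularℕ : Digits 5 → Digits 5 → Bool
unimodularℕ u v = divisible 3
  (+ (⟪ Kℕ ⟫ℕ u u ℕ.* ⟪ Kℕ ⟫ℕ v v ℕ.+ 2 ℕ.* (⟪ Kℕ ⟫ℕ u v ℕ.* ⟪ Kℕ ⟫ℕ u v) ℕ.+ 2))

-- With the I₂-components normalised to the standard basis modulo 3 only the T-components vary.
-- Unless both vanish or the determinant is wrong, one of the sixteen neighbours contains the pair.
independent-test : Digits 3 → Digits 3 → Bool
independent-test x y = not (divisibleᵥ 3 (⁺ x) ∧ divisibleᵥ 3 (⁺ y)) ⇒ᵇ
             (common (1 ◂ 0 ◂ x) (0 ◂ 1 ◂ y) ∨ not (unimodularℕ (1 ◂ 0 ◂ x) (0 ◂ 1 ◂ y)))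

independent-tests : T (allDigits 3 3 (λ x → allDigits 3 3 (independent-test x)))
independent-tests = tt

-- Modulo 3, T-components in the span of the images (2, 1, 0) and (1, -1, 1) of j and ij.
plane-digits : Digits 4 → Digits 5
plane-digits d = d 0F ◂ d 1F ◂ 2 ℕ.* d 2F ◂ d 2F ◂ d 3F ◂ empty

-- With dependent I₂-components that normal form is lost, but the T-components are confined to the
-- plane of `plane-digits`, so four digits describe each vector.
dependent-test : Digits 4 → Digits 4 → Bool
dependent-test d e = divisible 3 (+ (d 0F ℕ.* e 1F ℕ.+ 2 ℕ.* (d 1F ℕ.* e 0F))) ⇒ᵇ
  (not ((divisible 3 (+ d 2F) ∧ divisible 3 (+ d 3F)) ∧ (divisible 3 (+ e 2F) ∧ divisible 3 (+ e 3F))) ⇒ᵇ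
  (common (plane-digits d) (plane-digits e) ∨ not (unimodularℕ (plane-digits d) (plane-digits e))))

dependent-tests : T (allDigits 3 4 (λ d → allDigits 3 4 (dependent-test d)))
dependent-tests = tt

content-test : Digits 3 → Digits 3 → Bool
content-test x y = not (divisibleᵥ 3 (⁺ x) ∧ divisibleᵥ 3 (⁺ y)) ⇒ᵇ
  anyFinᵇ 3 (λ k → not (divisibleᵥ 3 (T→T-map k ⊙ ⁺ x) ∧ divisibleᵥ 3 (T→T-map k ⊙ ⁺ y)))

content-tests : T (allDigits 3 3 (λ x → allDigits 3 3 (content-test x)))
content-tests = tt

-- Upper triangular, so that its quadratic form is Norm itself rather than 2 Norm.
Normℕ : Fin 4 → Digits 4
Normℕ 0F 0F = 1
Normℕ 0F 2F = 1
Normℕ 1F 1F = 1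
Normℕ 1F 3F = 1
Normℕ 2F 2F = 2
Normℕ 3F 3F = 2
Normℕ _ _ = 0

-- The first three hypotheses make x and y nonzero and distinct modulo 2, so they span a plane of O
-- / 2O; the fourth makes it totally isotropic, since a vector has even trace product with itself.
-- The plane of ℤ[i] is the alternative that is passed on to K.
integrality-test : Digits 4 → Digits 4 → Bool
integrality-test x y = not (divisibleᵥ 2 (⁺ x)) ⇒ᵇ not (divisibleᵥ 2 (λ i → + (x i ℕ.+ y i))) ⇒ᵇ
  divisible 2 (+ (⟪ Normℕ ⟫ℕ y y ℕ.+ 1)) ⇒ᵇ divisible 2 (+ ⟪ Oℕ ⟫ℕ x y) ⇒ᵇ
  (((divisible 2 (+ x 2F) ∧ divisible 2 (+ x 3F)) ∧ (divisible 2 (+ y 2F) ∧ divisible 2 (+ y 3F)))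
  ∨ anyFinᵇ 8 (λ k → divisibleᵥ 2 (O→L-map k ⊙ ⁺ x) ∧ divisibleᵥ 2 (O→L-map k ⊙ ⁺ y)))

integrality-tests : T (allDigits 2 4 (λ x → allDigits 2 4 (integrality-test x)))
integrality-tests = tt

-- Pairs of vectors with given products and their transport along similarities

record Pair {n} (G : Mat n n) (a b c : ℤ) : Set where
  constructor pair
  field
    x y : Vec n
    xx  : ⟪ G ⟫ x x ≡ a
    xy  : ⟪ G ⟫ x y ≡ b
    yy  : ⟪ G ⟫ y y ≡ c

quotientᵥ : ∀ {n q} {x : Vec n} → q ∣ᵥ x → Vec n
quotientᵥ q∣x i = _∣_.quotient (q∣x i)

quotientᵥ-eq : ∀ {n q} {x : Vec n} (q∣x : q ∣ᵥ x) → x ≈ᵥ (+ q *ᵥ quotientᵥ q∣x)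
quotientᵥ-eq {q = q} q∣x i = trans (_∣_.equality (q∣x i)) (ℤ.*-comm (quotientᵥ q∣x i) (+ q))

similar-product : ∀ {m n} c (G : Mat m m) (H : Mat n n) (E : Mat m n) → Similarity c G H E →
                  ∀ x y → ⟪ G ⟫ (E ⊙ x) (E ⊙ y) ≡ c * ⟪ H ⟫ x y
similar-product c G H E sim x y =
  trans (⟪⟫-⊙ G E x y) (trans (⟪⟫-congₘ sim x y) (⟪⟫-scale c H x y))

similar-quotient : ∀ {m n} c q (G : Mat m m) (H : Mat n n) (E : Mat m n) → Similarity c G H E →
                   ∀ x y (dx : q ∣ᵥ (E ⊙ x)) (dy : q ∣ᵥ (E ⊙ y)) →
                   + q * (+ q * ⟪ G ⟫ (quotientᵥ dx) (quotientᵥ dy)) ≡ c * ⟪ H ⟫ x y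
similar-quotient c q G H E sim x y dx dy = begin
  + q * (+ q * ⟪ G ⟫ X Y)            ≡⟨ cong (+ q *_) (sym (⟪⟫-*ʳ G (+ q) X Y)) ⟩
  + q * ⟪ G ⟫ X (+ q *ᵥ Y)           ≡⟨ sym (⟪⟫-*ˡ G (+ q) X (+ q *ᵥ Y)) ⟩
  ⟪ G ⟫ (+ q *ᵥ X) (+ q *ᵥ Y)        ≡⟨ ⟪⟫-cong G (λ i → sym (quotientᵥ-eq dx i)) (λ i → sym (quotientᵥ-eq dy i)) ⟩
  ⟪ G ⟫ (E ⊙ x) (E ⊙ y)              ≡⟨ similar-product c G H E sim x y ⟩
  c * ⟪ H ⟫ x y                      ∎
  where
  open ≡-Reasoning
  X = quotientᵥ dx
  Y = quotientᵥ dy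

module _ {m n} {G : Mat m m} {H : Mat n n} (E : Mat m n) where

  pair-O : Similarity (+ 2) G H E → ∀ {a b c} → (P : Pair H (+ 2 * a) (+ 2 * b) (+ 2 * c)) →
           2 ∣ᵥ (E ⊙ Pair.x P) → 2 ∣ᵥ (E ⊙ Pair.y P) → Pair G a b c
  pair-O sim (pair x y xx xy yy) dx dy = pair (quotientᵥ dx) (quotientᵥ dy)
    (cancel (trans (similar-quotient (+ 2) 2 G H E sim x x dx dx) (cong (+ 2 *_) xx)))
    (cancel (trans (similar-quotient (+ 2) 2 G H E sim x y dx dy) (cong (+ 2 *_) xy)))
    (cancel (trans (similar-quotient (+ 2) 2 G H E sim y y dy dy) (cong (+ 2 *_) yy)))
    where
    cancel : ∀ {u v} → + 2 * (+ 2 * u) ≡ + 2 * (+ 2 * v) → u ≡ v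
    cancel {u} {v} eq = ℤ.*-cancelˡ-≡ (+ 2) u v (ℤ.*-cancelˡ-≡ (+ 2) (+ 2 * u) (+ 2 * v) eq)

  pair-K : Similarity (+ 9) G H E → ∀ {a b c} → (P : Pair H a b c) →
           3 ∣ᵥ (E ⊙ Pair.x P) → 3 ∣ᵥ (E ⊙ Pair.y P) → Pair G a b c
  pair-K sim {a} {b} {c} (pair x y xx xy yy) dx dy = pair (quotientᵥ dx) (quotientᵥ dy)
    (cancel a (trans (similar-quotient (+ 9) 3 G H E sim x x dx dx) (cong (+ 9 *_) xx)))
    (cancel b (trans (similar-quotient (+ 9) 3 G H E sim x y dx dy) (cong (+ 9 *_) xy)))
    (cancel c (trans (similar-quotient (+ 9) 3 G H E sim y y dy dy) (cong (+ 9 *_) yy)))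
    where
    cancel : ∀ {u} v → + 3 * (+ 3 * u) ≡ + 9 * v → u ≡ v
    cancel {u} v eq = ℤ.*-cancelˡ-≡ (+ 9) u v (trans (ℤ.*-assoc (+ 3) (+ 3) u) eq)

-- From K to L through 3-neighbours

annihilated-sound : ∀ k (x : Vec 5) d → x ≋ ⁺ d [ 3 ] → T (annihilated k d) →
                    3 ∣ᵥ (K→L-map k ⊙ x)
-- The entries of `d` may exceed 2, as those of `plane-digits` do. So the table is read at the
-- reduced digits of x, whose product with the annihilator is the same modulo 3.
annihilated-sound k x d x≋d ann = from-residues (residues {3} kernel-tests x)
  where
  z = annihilator k
  E = K→L-map k
  dot-mod : ∀ d → x ≋ ⁺ d [ 3 ] → + 3 ∣ dot (⁺ z) x - + dotℕ z d
  dot-mod d x≋d = ∣-subst (cong (_-_ (dot (⁺ z) x)) (dot-⁺ z d))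
    (∑-≡-mod 5 (λ j → + z j * x j) (λ j → + z j * + d j) (λ j → *-≡-mod {a = + z j} {+ z j} {x j} {+ d j} (const-≡-mod (+ 3) (+ z j)) (x≋d j)))
  3∣zx : + 3 ∣ dot (⁺ z) x
  3∣zx = ∣-resp-≡-mod (dot-mod d x≋d) (divisible-sound 3 (+ dotℕ z d) ann)
  from-residues : (∃ λ d → T (allFinᵇ 16 (λ k → kernel-test k d)) × x ≋ ⁺ d [ 3 ]) → 3 ∣ᵥ (E ⊙ x)
  from-residues (e , te , x≋e) i = ∣-resp-≡-mod (⊙-≡-mod E x (⁺ e) x≋e i)
    (divisibleᵥ-sound 3 (E ⊙ ⁺ e) (⇒-sound (annihilated k e) (allFin-sound 16 {λ k → kernel-test k e} te k)
      (divisible-complete 2 (+ dotℕ z e) (∣-resp-≡-mod′ (dot-mod e x≋e) 3∣zx))) i)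

common-sound : ∀ (u v : Vec 5) d e → u ≋ ⁺ d [ 3 ] → v ≋ ⁺ e [ 3 ] → T (common d e) →
  ∃ λ k → 3 ∣ᵥ (K→L-map k ⊙ u) × 3 ∣ᵥ (K→L-map k ⊙ v)
common-sound u v d e u≋ v≋ t = from-any (anyFin-sound 16 {λ k → annihilated k d ∧ annihilated k e} t)
  where
  from-any : (∃ λ k → T (annihilated k d ∧ annihilated k e)) → ∃ λ k → 3 ∣ᵥ (K→L-map k ⊙ u) × 3 ∣ᵥ (K→L-map k ⊙ v)
  from-any (k , tk) = k , annihilated-sound k u d u≋ (proj₁ (∧-sound (annihilated k d) tk))
                        , annihilated-sound k v e v≋ (proj₂ (∧-sound (annihilated k d) tk))

-- In the applications the Gram determinant is the square of a prime other than 3, hence 1 modulo 3.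
Unimodular : Vec 5 → Vec 5 → Set
Unimodular u v = + 3 ∣ ⟪ Kgram ⟫ u u * ⟪ Kgram ⟫ v v - ⟪ Kgram ⟫ u v * ⟪ Kgram ⟫ u v - 1ℤ

unimodular-complete : ∀ u v d e → u ≋ ⁺ d [ 3 ] → v ≋ ⁺ e [ 3 ] → Unimodular u v → T (unimodularℕ d e)
unimodular-complete u v d e u≋ v≋ uni = divisible-complete 2
    (+ (α ℕ.* γ ℕ.+ 2 ℕ.* (β ℕ.* β) ℕ.+ 2))
    (∣-subst (sym cast) (∣-subst (regroup (+ α) (+ β) (+ γ))
      (∣m∣n⇒∣m+n (∣-resp-≡-mod′ (∣-subst (drop-1 (⟪ Kgram ⟫ u u * ⟪ Kgram ⟫ v v) (⟪ Kgram ⟫ u v * ⟪ Kgram ⟫ u v) (+ α * + γ) (+ β * + β) 1ℤ) (∣m∣n⇒∣m-n ac (bb))) uni) (divides (+ β * + β + 1ℤ) refl))))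
  where
  α = ⟪ Kℕ ⟫ℕ d d
  β = ⟪ Kℕ ⟫ℕ d e
  γ = ⟪ Kℕ ⟫ℕ e e
  entry : ∀ x y d e → x ≋ ⁺ d [ 3 ] → y ≋ ⁺ e [ 3 ] → + 3 ∣ ⟪ Kgram ⟫ x y - + ⟪ Kℕ ⟫ℕ d e
  entry x y d e x≋ y≋ = ∣-subst (cong (_-_ (⟪ Kgram ⟫ x y)) (⟪⟫-⁺ Kℕ d e)) (⟪⟫-≡-mod Kgram x (⁺ d) y (⁺ e) x≋ y≋)
  ac : + 3 ∣ ⟪ Kgram ⟫ u u * ⟪ Kgram ⟫ v v - + α * + γ
  ac = *-≡-mod {a = ⟪ Kgram ⟫ u u} {+ α} {⟪ Kgram ⟫ v v} {+ γ} (entry u u d d u≋ u≋) (entry v v e e v≋ v≋)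
  bb : + 3 ∣ ⟪ Kgram ⟫ u v * ⟪ Kgram ⟫ u v - + β * + β
  bb = *-≡-mod {a = ⟪ Kgram ⟫ u v} {+ β} {⟪ Kgram ⟫ u v} {+ β} (entry u v d e u≋ v≋) (entry u v d e u≋ v≋)
  drop-1 : ∀ x y x′ y′ z → x - x′ - (y - y′) ≡ x - y - z - (x′ - y′ - z)
  drop-1 = solve-∀
  regroup : ∀ a b c → a * c - b * b - 1ℤ + (b * b + 1ℤ) * + 3 ≡ a * c + + 2 * (b * b) + + 2
  regroup = solve-∀
  cast : + (α ℕ.* γ ℕ.+ 2 ℕ.* (β ℕ.* β) ℕ.+ 2) ≡ + α * + γ + + 2 * (+ β * + β) + + 2
  cast = cong₂ (λ x y → x + y + + 2) (ℤ.pos-* α γ)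
           (trans (ℤ.pos-* 2 (β ℕ.* β)) (cong (+ 2 *_) (ℤ.pos-* β β)))

combination : ∀ {n} → ℤ → ℤ → Vec n → Vec n → Vec n
combination p q x y = (p *ᵥ x) +ᵥ (q *ᵥ y)

⟪⟫-combination : ∀ {n} (G : Mat n n) p q r s x y →
  ⟪ G ⟫ (combination p q x y) (combination r s x y)
  ≡ p * (r * ⟪ G ⟫ x x + s * ⟪ G ⟫ x y) + q * (r * ⟪ G ⟫ y x + s * ⟪ G ⟫ y y)
⟪⟫-combination G p q r s x y = begin
  ⟪ G ⟫ (combination p q x y) z              ≡⟨ ⟪⟫-+ˡ G (p *ᵥ x) (q *ᵥ y) z ⟩
  ⟪ G ⟫ (p *ᵥ x) z + ⟪ G ⟫ (q *ᵥ y) z        ≡⟨ cong₂ _+_ (⟪⟫-*ˡ G p x z) (⟪⟫-*ˡ G q y z) ⟩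
  p * ⟪ G ⟫ x z + q * ⟪ G ⟫ y z              ≡⟨ cong₂ (λ a b → p * a + q * b) (right x) (right y) ⟩
  p * (r * ⟪ G ⟫ x x + s * ⟪ G ⟫ x y) + q * (r * ⟪ G ⟫ y x + s * ⟪ G ⟫ y y) ∎
  where
  open ≡-Reasoning
  z = combination r s x y
  right : ∀ w → ⟪ G ⟫ w z ≡ r * ⟪ G ⟫ w x + s * ⟪ G ⟫ w y
  right w = trans (⟪⟫-+ʳ G w (r *ᵥ x) (s *ᵥ y)) (cong₂ _+_ (⟪⟫-*ʳ G r w x) (⟪⟫-*ʳ G s w y))

⊙-combination : ∀ {m n} (E : Mat m n) p q x y i →
  (E ⊙ combination p q x y) i ≡ p * (E ⊙ x) i + q * (E ⊙ y) i
⊙-combination {n = n} E p q x y i =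
  trans (∑-cong n (λ j → distribute (E i j) p q (x j) (y j)))
  (trans (∑-+ n (λ j → p * (E i j * x j)) (λ j → q * (E i j * y j)))
         (cong₂ _+_ (∑-*ˡ n p (λ j → E i j * x j)) (∑-*ˡ n q (λ j → E i j * y j))))
  where
  distribute : ∀ e p q x y → e * (p * x + q * y) ≡ p * (e * x) + q * (e * y)
  distribute = solve-∀

square-mod-3 : ∀ d → ¬ (+ 3 ∣ d) → + 3 ∣ d * d - 1ℤ
square-mod-3 d 3∤d = cases (d ℤ.%ℕ 3) (ℤ.n%ℕd<d d 3) (ℤ.a≡a%ℕn+[a/ℕn]*n d 3)
  where
  q = d ℤ./ℕ 3
  expand₁ : ∀ q → (+ 1 + q * + 3) * (+ 1 + q * + 3) - 1ℤ ≡ (+ 2 * q + + 3 * q * q) * + 3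
  expand₁ = solve-∀
  expand₂ : ∀ q → (+ 2 + q * + 3) * (+ 2 + q * + 3) - 1ℤ ≡ (+ 1 + + 4 * q + + 3 * q * q) * + 3
  expand₂ = solve-∀
  cases : ∀ r → r < 3 → d ≡ + r + q * + 3 → + 3 ∣ d * d - 1ℤ
  cases 0 _ eq = contradiction (divides q (trans eq (ℤ.+-identityˡ _))) 3∤d
  cases 1 _ eq = divides (+ 2 * q + + 3 * q * q) (trans (cong (λ d → d * d - 1ℤ) eq) (expand₁ q))
  cases 2 _ eq = divides (+ 1 + + 4 * q + + 3 * q * q) (trans (cong (λ d → d * d - 1ℤ) eq) (expand₂ q))
  cases (suc (suc (suc _))) (s≤s (s≤s (s≤s ()))) _

tail² : Vec 5 → Vec 3
tail² u i = u (suc (suc i))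

detρ : Vec 5 → Vec 5 → ℤ
detρ u v = u 0F * v 1F - u 1F * v 0F

SharedKernel : Vec 5 → Vec 5 → Set
SharedKernel u v = ∃ λ k → 3 ∣ᵥ (K→L-map k ⊙ u) × 3 ∣ᵥ (K→L-map k ⊙ v)

Kgram-sym : Symmetric Kgram
Kgram-sym = from-yes (Fin.all? (λ i → Fin.all? (λ j → Kgram i j ℤ.≟ Kgram j i)))

-- If the projections of u and v to the first two coordinates are independent mod 3,
-- then so normalised combinations u′, v′ project to the standard basis mod 3.
module Independent (u v : Vec 5) (3∤d : ¬ (+ 3 ∣ detρ u v))
                   (nonzero : ¬ (3 ∣ᵥ tail² u × 3 ∣ᵥ tail² v)) (uni : Unimodular u v) where
  private
    d : ℤ
    d = detρ u v
    3∣d²-1 : + 3 ∣ d * d - 1ℤ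
    3∣d²-1 = square-mod-3 d 3∤d
    u′ v′ : Vec 5
    -- The coefficients are d times the adjugate of the matrix of first two coordinates. As d² is 1
    -- modulo 3, this is its inverse modulo 3.
    u′ = combination (d * v 1F) (- (d * u 1F)) u v
    v′ = combination (- (d * v 0F)) (d * u 0F) u v

    -- The change of basis is invertible modulo 3, so a linear expression that vanishes modulo 3 on
    -- u′ and v′ vanishes on u and v.
    recover : ∀ s t → + 3 ∣ d * v 1F * s + - (d * u 1F) * t → + 3 ∣ - (d * v 0F) * s + d * u 0F * t →
              (+ 3 ∣ s) × (+ 3 ∣ t)
    recover s t p q =
        ∣-subst (first (u 0F) (u 1F) (v 0F) (v 1F) s t)
          (∣m∣n⇒∣m-n (∣m∣n⇒∣m+n (∣n⇒∣m*n (u 0F) p) (∣n⇒∣m*n (u 1F) q)) (∣m⇒∣m*n s 3∣d²-1))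
      , ∣-subst (second (u 0F) (u 1F) (v 0F) (v 1F) s t)
          (∣m∣n⇒∣m-n (∣m∣n⇒∣m+n (∣n⇒∣m*n (v 0F) p) (∣n⇒∣m*n (v 1F) q)) (∣m⇒∣m*n t 3∣d²-1))
      where
      first : ∀ a b a′ b′ s t →
        a * ((a * b′ - b * a′) * b′ * s + - ((a * b′ - b * a′) * b) * t)
        + b * (- ((a * b′ - b * a′) * a′) * s + (a * b′ - b * a′) * a * t)
        - ((a * b′ - b * a′) * (a * b′ - b * a′) - 1ℤ) * s ≡ s
      first = solve-∀
      second : ∀ a b a′ b′ s t →
        a′ * ((a * b′ - b * a′) * b′ * s + - ((a * b′ - b * a′) * b) * t)
        + b′ * (- ((a * b′ - b * a′) * a′) * s + (a * b′ - b * a′) * a * t)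
        - ((a * b′ - b * a′) * (a * b′ - b * a′) - 1ℤ) * t ≡ t
      second = solve-∀

    -- The change of basis has determinant d³, so the Gram determinant is multiplied by d⁶, and d²
    -- is 1 modulo 3.
    uni′ : Unimodular u′ v′
    uni′ = ∣-subst (trans (collect (d * d) g) (cong (_- 1ℤ) (trans (cube d g) (trans (cong (λ z → z * z * g) (sym minor)) (sym gram-det)))))
             (∣m∣n⇒∣m+n (∣n⇒∣m*n (d * d * (d * d) * (d * d)) uni)
                        (∣n⇒∣m*n (d * d * (d * d) + d * d + 1ℤ) 3∣d²-1))
      where
      a = ⟪ Kgram ⟫ u u
      b = ⟪ Kgram ⟫ u v
      c = ⟪ Kgram ⟫ v v
      g = a * c - b * b
      p = d * v 1F
      q = - (d * u 1F)
      r = - (d * v 0F)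
      s = d * u 0F
      gram-det : ⟪ Kgram ⟫ u′ u′ * ⟪ Kgram ⟫ v′ v′ - ⟪ Kgram ⟫ u′ v′ * ⟪ Kgram ⟫ u′ v′
                 ≡ (p * s - q * r) * (p * s - q * r) * g
      gram-det = trans (cong₂ (λ x y → x - y * y)
          (cong₂ _*_ (⟪⟫-combination Kgram p q p q u v) (⟪⟫-combination Kgram r s r s u v))
          (⟪⟫-combination Kgram p q r s u v))
        (trans (cong (λ b′ → (p * (p * a + q * b) + q * (p * b′ + q * c)) * (r * (r * a + s * b) + s * (r * b′ + s * c))
                 - (p * (r * a + s * b) + q * (r * b′ + s * c)) * (p * (r * a + s * b) + q * (r * b′ + s * c)))
               (⟪⟫-sym Kgram Kgram-sym v u))
          (expand p q r s a b c))
        where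
        expand : ∀ p q r s a b c →
          (p * (p * a + q * b) + q * (p * b + q * c)) * (r * (r * a + s * b) + s * (r * b + s * c))
            - (p * (r * a + s * b) + q * (r * b + s * c)) * (p * (r * a + s * b) + q * (r * b + s * c))
          ≡ (p * s - q * r) * (p * s - q * r) * (a * c - b * b)
        expand = solve-∀
      minor : p * s - q * r ≡ d * d * d
      minor = expand d (u 0F) (u 1F) (v 0F) (v 1F)
        where
        expand : ∀ d a b a′ b′ → d * b′ * (d * a) - - (d * b) * - (d * a′) ≡ d * d * (a * b′ - b * a′)
        expand = solve-∀
      cube : ∀ d g → d * d * (d * d) * (d * d) * g ≡ d * d * d * (d * d * d) * g
      cube = solve-∀
      collect : ∀ e g → e * e * e * (g - 1ℤ) + (e * e + e + 1ℤ) * (e - 1ℤ) ≡ e * e * e * g - 1ℤ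
      collect = solve-∀

    extend : ∀ (w : Vec 5) (x : Digits 3) i j → + 3 ∣ w 0F - + i → + 3 ∣ w 1F - + j → tail² w ≋ ⁺ x [ 3 ] → w ≋ ⁺ (i ◂ j ◂ x) [ 3 ]
    extend w x i j w₀ w₁ w≋ = 5-cases w₀ w₁ (w≋ 0F) (w≋ 1F) (w≋ 2F)

    u′≋ : ∀ x → tail² u′ ≋ ⁺ x [ 3 ] → u′ ≋ ⁺ (1 ◂ 0 ◂ x) [ 3 ]
    u′≋ x = extend u′ x 1 0 (∣-subst (at-0 (u 0F) (u 1F) (v 0F) (v 1F)) 3∣d²-1) (divides 0ℤ (at-1 d (u 1F) (v 1F)))
      where
      at-0 : ∀ a b a′ b′ → (a * b′ - b * a′) * (a * b′ - b * a′) - 1ℤ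
                           ≡ (a * b′ - b * a′) * b′ * a + - ((a * b′ - b * a′) * b) * a′ - 1ℤ
      at-0 = solve-∀
      at-1 : ∀ d b b′ → d * b′ * b + - (d * b) * b′ - 0ℤ ≡ 0ℤ
      at-1 = solve-∀
    v′≋ : ∀ y → tail² v′ ≋ ⁺ y [ 3 ] → v′ ≋ ⁺ (0 ◂ 1 ◂ y) [ 3 ]
    v′≋ y = extend v′ y 0 1 (divides 0ℤ (at-0 d (u 0F) (v 0F))) (∣-subst (at-1 (u 0F) (u 1F) (v 0F) (v 1F)) 3∣d²-1)
      where
      at-1 : ∀ a b a′ b′ → (a * b′ - b * a′) * (a * b′ - b * a′) - 1ℤ
                           ≡ - ((a * b′ - b * a′) * a′) * b + (a * b′ - b * a′) * a * b′ - 1ℤ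
      at-1 = solve-∀
      at-0 : ∀ d a a′ → - (d * a′) * a + d * a * a′ - 0ℤ ≡ 0ℤ
      at-0 = solve-∀

    from-digits : ∀ x y → T (independent-test x y) → tail² u′ ≋ ⁺ x [ 3 ] → tail² v′ ≋ ⁺ y [ 3 ] → SharedKernel u′ v′
    from-digits x y t x≋ y≋ = common-sound u′ v′ (1 ◂ 0 ◂ x) (0 ◂ 1 ◂ y) (u′≋ x x≋) (v′≋ y y≋)
      (∨-not-sound (common (1 ◂ 0 ◂ x) (0 ◂ 1 ◂ y)) (unimodularℕ (1 ◂ 0 ◂ x) (0 ◂ 1 ◂ y))
        (⇒-sound (not (divisibleᵥ 3 (⁺ x) ∧ divisibleᵥ 3 (⁺ y))) t
          (not-complete (divisibleᵥ 3 (⁺ x) ∧ divisibleᵥ 3 (⁺ y)) not-both))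
        (unimodular-complete u′ v′ (1 ◂ 0 ◂ x) (0 ◂ 1 ◂ y) (u′≋ x x≋) (v′≋ y y≋) uni′))
      where
      not-both : ¬ T (divisibleᵥ 3 (⁺ x) ∧ divisibleᵥ 3 (⁺ y))
      not-both both = nonzero ((λ i → proj₁ (tails i)) , (λ i → proj₂ (tails i)))
        where
        3∣x = divisibleᵥ-sound 3 (⁺ x) (proj₁ (∧-sound (divisibleᵥ 3 (⁺ x)) both))
        3∣y = divisibleᵥ-sound 3 (⁺ y) (proj₂ (∧-sound (divisibleᵥ 3 (⁺ x)) both))
        tails : ∀ i → (+ 3 ∣ tail² u i) × (+ 3 ∣ tail² v i)
        tails i = recover (tail² u i) (tail² v i) (∣-resp-≡-mod (x≋ i) (3∣x i)) (∣-resp-≡-mod (y≋ i) (3∣y i))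

  shared-kernel : SharedKernel u v
  shared-kernel = finish primed
    where
    inner : ∀ x → tail² u′ ≋ ⁺ x [ 3 ] → (∃ λ y → T (independent-test x y) × tail² v′ ≋ ⁺ y [ 3 ]) → SharedKernel u′ v′
    inner x x≋ (y , ty , y≋) = from-digits x y ty x≋ y≋
    outer : (∃ λ x → T (allDigits 3 3 (independent-test x)) × tail² u′ ≋ ⁺ x [ 3 ]) → SharedKernel u′ v′
    outer (x , tx , x≋) = inner x x≋ (residues {3} {3} {independent-test x} tx (tail² v′))
    primed : SharedKernel u′ v′
    primed = outer (residues {3} {3} {λ x → allDigits 3 3 (independent-test x)} independent-tests (tail² u′))
    finish : SharedKernel u′ v′ → SharedKernel u v
    finish (k , ku , kv) = k , (λ i → proj₁ (both i)) , (λ i → proj₂ (both i))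
      where
      E = K→L-map k
      both : ∀ i → (+ 3 ∣ (E ⊙ u) i) × (+ 3 ∣ (E ⊙ v) i)
      both i = recover ((E ⊙ u) i) ((E ⊙ v) i)
        (∣-subst (⊙-combination E (d * v 1F) (- (d * u 1F)) u v i) (ku i))
        (∣-subst (⊙-combination E (- (d * v 0F)) (d * u 0F) u v i) (kv i))

tail³ : Vec 5 → Vec 4
tail³ u = u 0F ◂ u 1F ◂ u 3F ◂ u 4F ◂ empty

module Dependent (u v : Vec 5) (3∣d : + 3 ∣ detρ u v) (3∣u : + 3 ∣ u 2F + u 3F) (3∣v : + 3 ∣ v 2F + v 3F)
                 (nonzero : ¬ (3 ∣ᵥ tail² u × 3 ∣ᵥ tail² v)) (uni : Unimodular u v) where
  private
    plane-≋ : ∀ w → + 3 ∣ w 2F + w 3F → ∀ d → tail³ w ≋ ⁺ d [ 3 ] → w ≋ ⁺ plane-digits d [ 3 ]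
    plane-≋ w 3∣w d w≋ = 5-cases (w≋ 0F) (w≋ 1F)
      (∣-subst (trans (regroup (w 2F) (w 3F) (+ d 2F)) (cong (_-_ (w 2F)) (sym (ℤ.pos-* 2 (d 2F)))))
        (∣m∣n⇒∣m+n (∣m∣n⇒∣m-n 3∣w (∣m⇒∣m*n (w 3F) ∣-refl)) (∣n⇒∣m*n (+ 2) (w≋ 2F))))
      (w≋ 2F) (w≋ 3F)
      where
      regroup : ∀ a b d → a + b - + 3 * b + + 2 * (b - d) ≡ a - + 2 * d
      regroup = solve-∀

    plane-zero : ∀ w → + 3 ∣ w 2F + w 3F → ∀ d → tail³ w ≋ ⁺ d [ 3 ] → + 3 ∣ + d 2F → + 3 ∣ + d 3F → 3 ∣ᵥ tail² w
    plane-zero w 3∣w d w≋ 3∣d₂ 3∣d₃ = 3-cases (∣-subst (cancel (w 2F) (w 3F)) (∣m∣n⇒∣m-n 3∣w 3∣w₃)) 3∣w₃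
                                    (∣-resp-≡-mod (w≋ 3F) 3∣d₃)
      where
      3∣w₃ : + 3 ∣ w 3F
      3∣w₃ = ∣-resp-≡-mod (w≋ 2F) 3∣d₂
      cancel : ∀ a b → a + b - b ≡ a
      cancel = solve-∀

    from-digits : ∀ d e → T (dependent-test d e) → tail³ u ≋ ⁺ d [ 3 ] → tail³ v ≋ ⁺ e [ 3 ] → SharedKernel u v
    from-digits d e t u≋ v≋ = common-sound u v (plane-digits d) (plane-digits e) (plane-≋ u 3∣u d u≋) (plane-≋ v 3∣v e v≋)
      (∨-not-sound (common (plane-digits d) (plane-digits e)) (unimodularℕ (plane-digits d) (plane-digits e))
        (⇒-sound (not all-zero) (⇒-sound (divisible 3 (+ minor)) t (divisible-complete 2 (+ minor) 3∣minor))
          (not-complete all-zero not-all-zero))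
        (unimodular-complete u v (plane-digits d) (plane-digits e) (plane-≋ u 3∣u d u≋) (plane-≋ v 3∣v e v≋) uni))
      where
      minor : ℕ
      minor = d 0F ℕ.* e 1F ℕ.+ 2 ℕ.* (d 1F ℕ.* e 0F)
      3∣minor : + 3 ∣ + minor
      3∣minor = ∣-subst
        (trans (regroup (u 0F * v 1F) (u 1F * v 0F) (+ d 0F * + e 1F) (+ d 1F * + e 0F))
          (cong₂ _+_ (sym (ℤ.pos-* (d 0F) (e 1F)))
            (trans (cong (+ 2 *_) (sym (ℤ.pos-* (d 1F) (e 0F)))) (sym (ℤ.pos-* 2 (d 1F ℕ.* e 0F))))))
        (∣m∣n⇒∣m+n (∣m∣n⇒∣m-n 3∣d (∣m∣n⇒∣m-n
            (*-≡-mod {a = u 0F} {+ d 0F} {v 1F} {+ e 1F} (u≋ 0F) (v≋ 1F))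
            (*-≡-mod {a = u 1F} {+ d 1F} {v 0F} {+ e 0F} (u≋ 1F) (v≋ 0F))))
          (∣m⇒∣m*n (+ d 1F * + e 0F) ∣-refl))
        where
        regroup : ∀ x y x′ y′ → x - y - (x - x′ - (y - y′)) + + 3 * y′ ≡ x′ + + 2 * y′
        regroup = solve-∀
      zero-u zero-v all-zero : Bool
      zero-u = divisible 3 (+ d 2F) ∧ divisible 3 (+ d 3F)
      zero-v = divisible 3 (+ e 2F) ∧ divisible 3 (+ e 3F)
      all-zero = zero-u ∧ zero-v
      not-all-zero : ¬ T all-zero
      not-all-zero z = nonzero
          ( plane-zero u 3∣u d u≋ (divisible-sound 3 (+ d 2F) (proj₁ zu)) (divisible-sound 3 (+ d 3F) (proj₂ zu))
          , plane-zero v 3∣v e v≋ (divisible-sound 3 (+ e 2F) (proj₁ zv)) (divisible-sound 3 (+ e 3F) (proj₂ zv)))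
        where
        zu = ∧-sound (divisible 3 (+ d 2F)) (proj₁ (∧-sound zero-u z))
        zv = ∧-sound (divisible 3 (+ e 2F)) (proj₂ (∧-sound zero-u z))

  shared-kernel : SharedKernel u v
  shared-kernel = outer (residues {3} {4} {λ d → allDigits 3 4 (dependent-test d)} dependent-tests (tail³ u))
    where
    inner : ∀ d → tail³ u ≋ ⁺ d [ 3 ] → (∃ λ e → T (dependent-test d e) × tail³ v ≋ ⁺ e [ 3 ]) → SharedKernel u v
    inner d u≋ (e , te , v≋) = from-digits d e te u≋ v≋
    outer : (∃ λ d → T (allDigits 3 4 (dependent-test d)) × tail³ u ≋ ⁺ d [ 3 ]) → SharedKernel u v
    outer (d , td , u≋) = inner d u≋ (residues {3} {4} {dependent-test d} td (tail³ v))

-- Making the component in T nonzero modulo 3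

_∣ᵥ?_ : ∀ q .{{_ : ℕ.NonZero q}} {n} (x : Vec n) → Dec (q ∣ᵥ x)
q ∣ᵥ? x = Fin.all? (λ i → + q ∣? x i)

record SameGram (x y : Vec 3) : Set where
  constructor sameGram
  field
    x′ y′   : Vec 3
    xx      : ⟪ Tgram ⟫ x′ x′ ≡ ⟪ Tgram ⟫ x x
    xy      : ⟪ Tgram ⟫ x′ y′ ≡ ⟪ Tgram ⟫ x y
    yy      : ⟪ Tgram ⟫ y′ y′ ≡ ⟪ Tgram ⟫ y y
    nonzero : ¬ (3 ∣ᵥ x′ × 3 ∣ᵥ y′)

T-step : ∀ x y → ¬ (3 ∣ᵥ x × 3 ∣ᵥ y) →
         ∃ λ k → ¬ (3 ∣ᵥ (T→T-map k ⊙ x) × 3 ∣ᵥ (T→T-map k ⊙ y))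
T-step x y nonzero = outer (residues {3} {3} {λ d → allDigits 3 3 (content-test d)} content-tests x)
  where
  Goal : Set
  Goal = ∃ λ k → ¬ (3 ∣ᵥ (T→T-map k ⊙ x) × 3 ∣ᵥ (T→T-map k ⊙ y))
  image-zero : Fin 3 → Digits 3 → Bool
  image-zero k d = divisibleᵥ 3 (T→T-map k ⊙ ⁺ d)
  image-complete : ∀ k w d → w ≋ ⁺ d [ 3 ] → 3 ∣ᵥ (T→T-map k ⊙ w) → T (image-zero k d)
  image-complete k w d w≋ 3∣ = divisibleᵥ-complete 2 (T→T-map k ⊙ ⁺ d)
    (λ i → ∣-resp-≡-mod′ (⊙-≡-mod (T→T-map k) w (⁺ d) w≋ i) (3∣ i))
  from-digits : ∀ d e → T (content-test d e) → x ≋ ⁺ d [ 3 ] → y ≋ ⁺ e [ 3 ] → Goal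
  from-digits d e t x≋ y≋ = conclude (anyFin-sound 3 {λ k → not (image-zero k d ∧ image-zero k e)}
      (⇒-sound (not (divisibleᵥ 3 (⁺ d) ∧ divisibleᵥ 3 (⁺ e))) t
        (not-complete (divisibleᵥ 3 (⁺ d) ∧ divisibleᵥ 3 (⁺ e)) digits-nonzero)))
    where
    digits-nonzero : ¬ T (divisibleᵥ 3 (⁺ d) ∧ divisibleᵥ 3 (⁺ e))
    digits-nonzero both = nonzero
      ( (λ i → ∣-resp-≡-mod (x≋ i) (divisibleᵥ-sound 3 (⁺ d) (proj₁ (∧-sound (divisibleᵥ 3 (⁺ d)) both)) i))
      , (λ i → ∣-resp-≡-mod (y≋ i) (divisibleᵥ-sound 3 (⁺ e) (proj₂ (∧-sound (divisibleᵥ 3 (⁺ d)) both)) i)))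
    ∧-complete : ∀ a b → T a → T b → T (a ∧ b)
    ∧-complete true b _ tb = tb
    conclude : (∃ λ k → T (not (image-zero k d ∧ image-zero k e))) → Goal
    conclude (k , tk) = k , λ (zx , zy) → not-sound (image-zero k d ∧ image-zero k e) tk
      (∧-complete (image-zero k d) (image-zero k e) (image-complete k x d x≋ zx) (image-complete k y e y≋ zy))
  inner : ∀ d → x ≋ ⁺ d [ 3 ] → (∃ λ e → T (content-test d e) × y ≋ ⁺ e [ 3 ]) → Goal
  inner d x≋ (e , te , y≋) = from-digits d e te x≋ y≋
  outer : (∃ λ d → T (allDigits 3 3 (content-test d)) × x ≋ ⁺ d [ 3 ]) → Goal
  outer (d , td , x≋) = inner d x≋ (residues {3} {3} {content-test d} td y)

size : Vec 3 → ℕ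
size x = ∣ x 0F ∣ ℕ.+ (∣ x 1F ∣ ℕ.+ ∣ x 2F ∣)

size≡0 : ∀ x → size x ≡ 0 → x ≈ᵥ 0ᵥ
size≡0 x eq = 3-cases (ℤ.∣i∣≡0⇒i≡0 (ℕ.m+n≡0⇒m≡0 ∣ x 0F ∣ eq)) (ℤ.∣i∣≡0⇒i≡0 (ℕ.m+n≡0⇒m≡0 ∣ x 1F ∣ rest))
                (ℤ.∣i∣≡0⇒i≡0 (ℕ.m+n≡0⇒n≡0 ∣ x 1F ∣ rest))
  where
  rest : ∣ x 1F ∣ ℕ.+ ∣ x 2F ∣ ≡ 0
  rest = ℕ.m+n≡0⇒n≡0 ∣ x 0F ∣ eq

size-3* : ∀ x z → x ≈ᵥ (+ 3 *ᵥ z) → size x ≡ 3 ℕ.* size z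
size-3* x z x≈3z = trans (cong₂ ℕ._+_ (entry 0F) (cong₂ ℕ._+_ (entry 1F) (entry 2F)))
                     (factor (∣ z 0F ∣) (∣ z 1F ∣) (∣ z 2F ∣))
  where
  entry : ∀ i → ∣ x i ∣ ≡ 3 ℕ.* ∣ z i ∣
  entry i = trans (cong ∣_∣ (x≈3z i)) (ℤ.abs-* (+ 3) (z i))
  factor : ∀ a b c → 3 ℕ.* a ℕ.+ (3 ℕ.* b ℕ.+ 3 ℕ.* c) ≡ 3 ℕ.* (a ℕ.+ (b ℕ.+ c))
  factor = ℕ-Ring.solve-∀

-- If x = 3z and y = 3w, the pair is normalised for z and w first. A matrix of `T→T` is 3σ with σ a
-- rational isometry, so applying it restores the Gram matrix of x and y, and one of the three keeps
-- the pair nonzero modulo 3. The total size drops because z and w are not both zero.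
remove-content : ∀ x y → Acc _<_ (size x ℕ.+ size y) → ¬ (x ≈ᵥ 0ᵥ × y ≈ᵥ 0ᵥ) → SameGram x y
remove-content x y (acc rs) x,y≢0 = decide (3 ∣ᵥ? x) (3 ∣ᵥ? y)
  where
  module _ (3∣x : 3 ∣ᵥ x) (3∣y : 3 ∣ᵥ y) where
    z w : Vec 3
    z = quotientᵥ {q = 3} 3∣x
    w = quotientᵥ {q = 3} 3∣y
    x≈3z = quotientᵥ-eq {q = 3} 3∣x
    y≈3w = quotientᵥ-eq {q = 3} 3∣y
    z,w≢0 : ¬ (z ≈ᵥ 0ᵥ × w ≈ᵥ 0ᵥ)
    z,w≢0 (z≈0 , w≈0) = x,y≢0 ((λ i → trans (x≈3z i) (cong (+ 3 *_) (z≈0 i))) , (λ i → trans (y≈3w i) (cong (+ 3 *_) (w≈0 i))))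
    smaller : size z ℕ.+ size w < size x ℕ.+ size y
    smaller = subst (size z ℕ.+ size w <_) (sym (trans (cong₂ ℕ._+_ (size-3* x z x≈3z) (size-3* y w y≈3w)) (sym (ℕ.*-distribˡ-+ 3 (size z) (size w)))))
      (n<3n (size z ℕ.+ size w) (λ sum≡0 → z,w≢0 (size≡0 z (ℕ.m+n≡0⇒m≡0 (size z) sum≡0) , size≡0 w (ℕ.m+n≡0⇒n≡0 (size z) sum≡0))))
      where
      n<3n : ∀ n → n ≢ 0 → n < 3 ℕ.* n
      n<3n 0       n≢0 = contradiction refl n≢0
      n<3n (suc n) _   = ℕ.m<m+n (suc n) (s≤s z≤n)
    scaled : ∀ a b a′ b′ → a ≈ᵥ (+ 3 *ᵥ a′) → b ≈ᵥ (+ 3 *ᵥ b′) → + 9 * ⟪ Tgram ⟫ a′ b′ ≡ ⟪ Tgram ⟫ a b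
    scaled a b a′ b′ a≈ b≈ = sym (trans (⟪⟫-cong Tgram a≈ b≈) (trans (⟪⟫-*ˡ Tgram (+ 3) a′ (+ 3 *ᵥ b′))
      (trans (cong (+ 3 *_) (⟪⟫-*ʳ Tgram (+ 3) a′ b′)) (sym (ℤ.*-assoc (+ 3) (+ 3) (⟪ Tgram ⟫ a′ b′))))))
    move : SameGram z w → SameGram x y
    move (sameGram z′ w′ zz zw ww nonzero) = apply (T-step z′ w′ nonzero)
      where
      apply : (∃ λ k → ¬ (3 ∣ᵥ (T→T-map k ⊙ z′) × 3 ∣ᵥ (T→T-map k ⊙ w′))) → SameGram x y
      apply (k , still-nonzero) = sameGram (E ⊙ z′) (E ⊙ w′)
          (trans (similar z′ z′) (trans (cong (+ 9 *_) zz) (scaled x x z z x≈3z x≈3z)))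
          (trans (similar z′ w′) (trans (cong (+ 9 *_) zw) (scaled x y z w x≈3z y≈3w)))
          (trans (similar w′ w′) (trans (cong (+ 9 *_) ww) (scaled y y w w y≈3w y≈3w)))
          still-nonzero
        where
        E = T→T-map k
        similar = similar-product (+ 9) Tgram Tgram E (T→T-similarity k)
  decide : Dec (3 ∣ᵥ x) → Dec (3 ∣ᵥ y) → SameGram x y
  decide (no 3∤x) _        = sameGram x y refl refl refl (λ (3∣x , _) → 3∤x 3∣x)
  decide (yes _) (no 3∤y)  = sameGram x y refl refl refl (λ (_ , 3∣y) → 3∤y 3∣y)
  decide (yes 3∣x) (yes 3∣y) = move 3∣x 3∣y (remove-content (z 3∣x 3∣y) (w 3∣x 3∣y) (rs (smaller 3∣x 3∣y)) (z,w≢0 3∣x 3∣y))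

Kgram-split : ∀ u v → ⟪ Kgram ⟫ u v ≡ u 0F * v 0F + u 1F * v 1F + ⟪ Tgram ⟫ (tail² u) (tail² v)
Kgram-split u v = expand (u 0F) (u 1F) (u 2F) (u 3F) (u 4F) (v 0F) (v 1F) (v 2F) (v 3F) (v 4F)
    ((Tgram ⊙ tail² v) 0F) ((Tgram ⊙ tail² v) 1F) ((Tgram ⊙ tail² v) 2F)
  where
  expand : ∀ u₀ u₁ u₂ u₃ u₄ v₀ v₁ v₂ v₃ v₄ s₂ s₃ s₄ →
    u₀ * (+ 1 * v₀ + (+ 0 * v₁ + (+ 0 * v₂ + (+ 0 * v₃ + (+ 0 * v₄ + + 0)))))
    + (u₁ * (+ 0 * v₀ + (+ 1 * v₁ + (+ 0 * v₂ + (+ 0 * v₃ + (+ 0 * v₄ + + 0)))))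
    + (u₂ * (+ 0 * v₀ + (+ 0 * v₁ + s₂)) + (u₃ * (+ 0 * v₀ + (+ 0 * v₁ + s₃)) + (u₄ * (+ 0 * v₀ + (+ 0 * v₁ + s₄)) + + 0))))
    ≡ u₀ * v₀ + u₁ * v₁ + (u₂ * s₂ + (u₃ * s₃ + (u₄ * s₄ + + 0)))
  expand = solve-∀

replace-tail : Vec 5 → Vec 3 → Vec 5
replace-tail u x = u 0F ◂ u 1F ◂ x

module _ {a b c : ℤ} (P : Pair Kgram a b c) (3∣det-1 : + 3 ∣ a * c - b * b - 1ℤ) where
  open Pair P

  unimodular : Unimodular x y
  unimodular rewrite xx | xy | yy = 3∣det-1

  independent-pair : ¬ (+ 3 ∣ detρ x y) → ¬ (3 ∣ᵥ tail² x × 3 ∣ᵥ tail² y) → Pair Lgram a b c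
  independent-pair 3∤d nonzero = from-kernel (Independent.shared-kernel x y 3∤d nonzero unimodular)
    where
    from-kernel : SharedKernel x y → Pair Lgram a b c
    from-kernel (k , kx , ky) = pair-K (K→L-map k) (K→L-similarity k) P kx ky

  dependent-pair : + 3 ∣ detρ x y → + 3 ∣ x 2F + x 3F → + 3 ∣ y 2F + y 3F →
                   ¬ (3 ∣ᵥ tail² x × 3 ∣ᵥ tail² y) → Pair Lgram a b c
  dependent-pair 3∣d wx wy nonzero = from-kernel (Dependent.shared-kernel x y 3∣d wx wy nonzero unimodular)
    where
    from-kernel : SharedKernel x y → Pair Lgram a b c
    from-kernel (k , kx , ky) = pair-K (K→L-map k) (K→L-similarity k) P kx ky

  -- Modulo 3 the products are then those of the I₂-components, so the Gram determinant is the
  -- square of `detρ`; but it is 1.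
  zero-tails⇒independent : 3 ∣ᵥ tail² x → 3 ∣ᵥ tail² y → ¬ (+ 3 ∣ detρ x y)
  zero-tails⇒independent 3∣x 3∣y 3∣d = contradiction (ℕ.∣⇒≤ (∣⇒∣ᵤ 3∣1)) λ { (s≤s ()) }
    where
    entry : ∀ u v → 3 ∣ᵥ tail² u → + 3 ∣ ⟪ Kgram ⟫ u v - (u 0F * v 0F + u 1F * v 1F)
    entry u v 3∣u = ∣-subst (trans (cancel (u 0F * v 0F + u 1F * v 1F) (⟪ Tgram ⟫ (tail² u) (tail² v)))
                              (cong (_- (u 0F * v 0F + u 1F * v 1F)) (sym (Kgram-split u v))))
      (∑-∣ 3 (λ i → ∣m⇒∣m*n ((Tgram ⊙ tail² v) i) (3∣u i)))
      where
      cancel : ∀ r t → t ≡ r + t - r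
      cancel = solve-∀
    ρ : Vec 5 → Vec 5 → ℤ
    ρ u v = u 0F * v 0F + u 1F * v 1F
    3∣1 : + 3 ∣ 1ℤ
    3∣1 = ∣-subst (collect (⟪ Kgram ⟫ x x * ⟪ Kgram ⟫ y y) (⟪ Kgram ⟫ x y * ⟪ Kgram ⟫ x y) (ρ x x * ρ y y) (ρ x y * ρ x y))
      (∣m∣n⇒∣m-n (∣m∣n⇒∣m+n (∣m∣n⇒∣m-n
          (*-≡-mod {a = ⟪ Kgram ⟫ x x} {ρ x x} {⟪ Kgram ⟫ y y} {ρ y y} (entry x x 3∣x) (entry y y 3∣y))
          (*-≡-mod {a = ⟪ Kgram ⟫ x y} {ρ x y} {⟪ Kgram ⟫ x y} {ρ x y} (entry x y 3∣x) (entry x y 3∣x)))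
          (∣-subst (lagrange (x 0F) (x 1F) (y 0F) (y 1F)) (∣m⇒∣m*n (detρ x y) 3∣d))) unimodular)
      where
      collect : ∀ p q r s → p - r - (q - s) + (r - s) - (p - q - 1ℤ) ≡ 1ℤ
      collect = solve-∀
      lagrange : ∀ a b c d → (a * d - b * c) * (a * d - b * c)
                 ≡ (a * a + b * b) * (c * c + d * d) - (a * c + b * d) * (a * c + b * d)
      lagrange = solve-∀

-- If both T-components vanish modulo 3, they are exchanged for others with the same products. This
-- keeps the I₂-components, which are independent by `zero-tails⇒independent`, so the new pair falls
-- under the case that asks nothing of the plane.
K-pair⇒L-pair : ∀ {a b c} (P : Pair Kgram a b c) → + 3 ∣ a * c - b * b - 1ℤ →
  + 3 ∣ Pair.x P 2F + Pair.x P 3F → + 3 ∣ Pair.y P 2F + Pair.y P 3F →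
  ¬ (tail² (Pair.x P) ≈ᵥ 0ᵥ × tail² (Pair.y P) ≈ᵥ 0ᵥ) → Pair Lgram a b c
K-pair⇒L-pair {a} {b} {c} P 3∣det-1 wx wy tails≢0 = decide (3 ∣ᵥ? tail² x) (3 ∣ᵥ? tail² y)
  where
  open Pair P
  by-det : ¬ (3 ∣ᵥ tail² x × 3 ∣ᵥ tail² y) → Dec (+ 3 ∣ detρ x y) → Pair Lgram a b c
  by-det nonzero (yes 3∣d) = dependent-pair P 3∣det-1 3∣d wx wy nonzero
  by-det nonzero (no 3∤d)  = independent-pair P 3∣det-1 3∤d nonzero
  decide : Dec (3 ∣ᵥ tail² x) → Dec (3 ∣ᵥ tail² y) → Pair Lgram a b c
  decide (no 3∤x)  _         = by-det (λ (3∣x , _) → 3∤x 3∣x) (+ 3 ∣? detρ x y)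
  decide (yes _)   (no 3∤y)  = by-det (λ (_ , 3∣y) → 3∤y 3∣y) (+ 3 ∣? detρ x y)
  decide (yes 3∣x) (yes 3∣y) = from-same (remove-content (tail² x) (tail² y) (<-wellFounded _) tails≢0)
    where
    from-same : SameGram (tail² x) (tail² y) → Pair Lgram a b c
    from-same (sameGram x′ y′ xx′ xy′ yy′ nonzero) = independent-pair
        (pair (replace-tail x x′) (replace-tail y y′) (trans (same x x x′ x′ xx′) xx) (trans (same x y x′ y′ xy′) xy)
              (trans (same y y y′ y′ yy′) yy))
        3∣det-1 (zero-tails⇒independent P 3∣det-1 3∣x 3∣y) nonzero
      where
      same : ∀ u v u′ v′ → ⟪ Tgram ⟫ u′ v′ ≡ ⟪ Tgram ⟫ (tail² u) (tail² v) →
             ⟪ Kgram ⟫ (replace-tail u u′) (replace-tail v v′) ≡ ⟪ Kgram ⟫ u v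
      same u v u′ v′ eq = trans (Kgram-split (replace-tail u u′) (replace-tail v v′))
        (trans (cong (_+_ (u 0F * v 0F + u 1F * v 1F)) eq) (sym (Kgram-split u v)))

-- From the quaternion order to L

Normgram : Mat 4 4
Normgram i j = + Normℕ i j

Norm-form : ∀ u → ⟪ Normgram ⟫ u u ≡ Norm u
Norm-form u = solve 4 (λ a b c d →
    a :* row 1 0 1 0 a b c d :+ (b :* row 0 1 0 1 a b c d :+ (c :* row 0 0 2 0 a b c d :+ (d :* row 0 0 0 2 a b c d :+ con 0ℤ)))
    := hermitianₚ (con (+ 1)) (con (+ 1)) (con 0ℤ) (con (+ 2)) a b c d) refl (u 0F) (u 1F) (u 2F) (u 3F)
  where
  row : ∀ {n} → (p q r s : ℕ) → (a b c d : Polynomial n) → Polynomial n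
  row p q r s a b c d = con (+ p) :* a :+ (con (+ q) :* b :+ (con (+ r) :* c :+ (con (+ s) :* d :+ con 0ℤ)))

Ogram-norm : ∀ u → ⟪ Ogram ⟫ u u ≡ + 2 * Norm u
Ogram-norm u = solve 4 (λ a b c d →
    a :* row 2 0 1 0 a b c d :+ (b :* row 0 2 0 1 a b c d :+ (c :* row 1 0 4 0 a b c d :+ (d :* row 0 1 0 4 a b c d :+ con 0ℤ)))
    := con (+ 2) :* hermitianₚ (con (+ 1)) (con (+ 1)) (con 0ℤ) (con (+ 2)) a b c d) refl (u 0F) (u 1F) (u 2F) (u 3F)
  where
  row : ∀ {n} → (p q r s : ℕ) → (a b c d : Polynomial n) → Polynomial n
  row p q r s a b c d = con (+ p) :* a :+ (con (+ q) :* b :+ (con (+ r) :* c :+ (con (+ s) :* d :+ con 0ℤ)))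

Ogram-sym : Symmetric Ogram
Ogram-sym = from-yes (Fin.all? (λ i → Fin.all? (λ j → Ogram i j ℤ.≟ Ogram j i)))

embedding-pair : ∀ {a b c} → Embedding a b c → Pair Ogram (+ 2 * a) (+ 2 * b) (+ 2 * c)
embedding-pair {a} {b} {c} (mk x y x-norm y-norm sum-norm _) = pair x y xx xy yy
  where
  xx = trans (Ogram-norm x) (cong (+ 2 *_) x-norm)
  yy = trans (Ogram-norm y) (cong (+ 2 *_) y-norm)
  polarise : ⟪ Ogram ⟫ (x +ᵥ y) (x +ᵥ y) ≡ ⟪ Ogram ⟫ x x + + 2 * ⟪ Ogram ⟫ x y + ⟪ Ogram ⟫ y y
  polarise = trans (⟪⟫-+ˡ Ogram x y (x +ᵥ y)) (trans (cong₂ _+_ (⟪⟫-+ʳ Ogram x x y) (⟪⟫-+ʳ Ogram y x y))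
    (trans (cong (λ z → ⟪ Ogram ⟫ x x + ⟪ Ogram ⟫ x y + (z + ⟪ Ogram ⟫ y y)) (⟪⟫-sym Ogram Ogram-sym y x))
           (regroup (⟪ Ogram ⟫ x x) (⟪ Ogram ⟫ x y) (⟪ Ogram ⟫ y y))))
    where
    regroup : ∀ p q r → p + q + (q + r) ≡ p + + 2 * q + r
    regroup = solve-∀
  xy : ⟪ Ogram ⟫ x y ≡ + 2 * b
  xy = ℤ.*-cancelˡ-≡ (+ 2) (⟪ Ogram ⟫ x y) (+ 2 * b) (trans (isolate (⟪ Ogram ⟫ x x) (⟪ Ogram ⟫ x y) (⟪ Ogram ⟫ y y))
    (trans (cong₂ _-_ (trans (sym polarise) (trans (Ogram-norm (x +ᵥ y)) (cong (+ 2 *_) sum-norm))) (cong₂ _+_ xx yy))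
           (collect a b c)))
    where
    isolate : ∀ p q r → + 2 * q ≡ p + + 2 * q + r - (p + r)
    isolate = solve-∀
    collect : ∀ a b c → + 2 * (a + + 2 * b + c) - (+ 2 * a + + 2 * c) ≡ + 2 * (+ 2 * b)
    collect = solve-∀

doubled-norm : ∀ u → 2 ∣ᵥ u → + 4 ∣ Norm u
doubled-norm u 2∣u = divides (Norm h) (trans (sym (Norm-form u)) (trans
    (⟪⟫-cong Normgram (quotientᵥ-eq {q = 2} 2∣u) (quotientᵥ-eq {q = 2} 2∣u))
    (trans (⟪⟫-*ˡ Normgram (+ 2) h (+ 2 *ᵥ h)) (trans (cong (+ 2 *_) (⟪⟫-*ʳ Normgram (+ 2) h h))
    (trans (sym (ℤ.*-assoc (+ 2) (+ 2) (⟪ Normgram ⟫ h h))) (trans (ℤ.*-comm (+ 4) (⟪ Normgram ⟫ h h)) (cong (_* + 4) (Norm-form h))))))))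
  where
  h = quotientᵥ {q = 2} 2∣u

even-coefficients : ∀ i → (+ 2 ∣ matrix O→K i 0F) × (+ 2 ∣ matrix O→K i 1F)
even-coefficients = from-yes (Fin.all? (λ i → (+ 2 ∣? matrix O→K i 0F) ×-dec (+ 2 ∣? matrix O→K i 1F)))

O→K-even : ∀ x → + 2 ∣ x 2F → + 2 ∣ x 3F → 2 ∣ᵥ (matrix O→K ⊙ x)
O→K-even x 2∣x₂ 2∣x₃ i = ∑-∣ 4 {f = λ j → matrix O→K i j * x j} (4-cases {λ j → + 2 ∣ matrix O→K i j * x j}
  (∣m⇒∣m*n (x 0F) (proj₁ (even-coefficients i))) (∣m⇒∣m*n (x 1F) (proj₂ (even-coefficients i)))
  (∣n⇒∣m*n (matrix O→K i 2F) 2∣x₂) (∣n⇒∣m*n (matrix O→K i 3F) 2∣x₃))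

module O→K-image (x : Vec 4) (even : 2 ∣ᵥ (matrix O→K ⊙ x)) where
  z : Vec 5
  z = quotientᵥ {q = 2} even

  -- The rows of `O→K` with indices 2 and 3 add up to (0, 0, 3, 0), so 2(z₂ + z₃) = 3x₂.
  image-plane : + 3 ∣ z 2F + z 3F
  image-plane = divides (z 2F + z 3F - x 2F) (solve-for (z 2F + z 3F) (x 2F) (trans (ℤ.*-distribˡ-+ (+ 2) (z 2F) (z 3F))
      (trans (cong₂ _+_ (sym (quotientᵥ-eq {q = 2} even 2F)) (sym (quotientᵥ-eq {q = 2} even 3F)))
             (rows (x 0F) (x 1F) (x 2F) (x 3F)))))
    where
    rows : ∀ a b c d → + 0 * a + (+ 0 * b + (+ 2 * c + (+ 1 * d + + 0))) + (+ 0 * a + (+ 0 * b + (+ 1 * c + (-[1+ 0 ] * d + + 0))))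
           ≡ + 3 * c
    rows = solve-∀
    solve-for : ∀ s c → + 2 * s ≡ + 3 * c → s ≡ (s - c) * + 3
    solve-for s c eq = trans (split s) (trans (cong (_-_ (+ 3 * s)) eq) (factor s c))
      where
      split : ∀ s → s ≡ + 3 * s - + 2 * s
      split = solve-∀
      factor : ∀ s c → + 3 * s - + 3 * c ≡ (s - c) * + 3
      factor = solve-∀

  image-axis : tail² z ≈ᵥ 0ᵥ → InFirstAxis x
  image-axis z≈0 = trans (sym (row-3 (x 0F) (x 1F) (x 2F) (x 3F))) (trans (cong₂ _+_ (vanish 1F) (vanish 2F)) refl)
                 , trans (sym (row-4 (x 0F) (x 1F) (x 2F) (x 3F))) (vanish 2F)
    where
    vanish : ∀ i → (matrix O→K ⊙ x) (suc (suc i)) ≡ 0ℤ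
    vanish i = trans (quotientᵥ-eq {q = 2} even (suc (suc i))) (cong (+ 2 *_) (z≈0 i))
    row-4 : ∀ a b c d → + 0 * a + (+ 0 * b + (+ 0 * c + (+ 1 * d + + 0))) ≡ d
    row-4 = solve-∀
    row-3 : ∀ a b c d → + 0 * a + (+ 0 * b + (+ 1 * c + (-[1+ 0 ] * d + + 0))) + (+ 0 * a + (+ 0 * b + (+ 0 * c + (+ 1 * d + + 0)))) ≡ c
    row-3 = solve-∀

-- Norms of elements of 2O are divisible by 4, so the hypotheses keep x, y and x + y out of 2O, and
-- x and y span a plane of O / 2O. If it is the plane of ℤ[i], the pair goes to K, where
-- `nontrivial` provides a nonzero T-component.
embedding⇒L-pair : ∀ {a b c} → Embedding a b c → ¬ (+ 4 ∣ a) → ¬ (+ 4 ∣ a + + 2 * b + c) → + 2 ∣ c + 1ℤ →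
                   + 3 ∣ a * c - b * b - 1ℤ → Pair Lgram a b c
embedding⇒L-pair {a} {b} {c} S 4∤a 4∤sum c-odd 3∣det-1 = outer (residues {2} {4} {λ d → allDigits 2 4 (integrality-test d)} integrality-tests x)
  where
  open Embedding S
  P = embedding-pair S

  from-digits : ∀ d e → T (integrality-test d e) → x ≋ ⁺ d [ 2 ] → y ≋ ⁺ e [ 2 ] → Pair Lgram a b c
  from-digits d e t x≋ y≋ = conclude (∨-sound flat
      (⇒-sound (divisible 2 (+ ⟪ Oℕ ⟫ℕ d e))
        (⇒-sound (divisible 2 (+ (⟪ Normℕ ⟫ℕ e e ℕ.+ 1)))
          (⇒-sound (not sum-zero) (⇒-sound (not (divisibleᵥ 2 (⁺ d))) t (not-complete (divisibleᵥ 2 (⁺ d)) x-nonzero))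
            (not-complete sum-zero sum-nonzero))
          (divisible-complete 1 (+ (⟪ Normℕ ⟫ℕ e e ℕ.+ 1)) norm-odd))
        (divisible-complete 1 (+ ⟪ Oℕ ⟫ℕ d e) product-even)))
    where
    flat sum-zero : Bool
    flat = (divisible 2 (+ d 2F) ∧ divisible 2 (+ d 3F)) ∧ (divisible 2 (+ e 2F) ∧ divisible 2 (+ e 3F))
    sum-zero = divisibleᵥ 2 (λ i → + (d i ℕ.+ e i))
    x-nonzero : ¬ T (divisibleᵥ 2 (⁺ d))
    x-nonzero zero-d = 4∤a (∣-subst x-norm (doubled-norm x (λ i → ∣-resp-≡-mod (x≋ i) (divisibleᵥ-sound 2 (⁺ d) zero-d i))))
    sum-nonzero : ¬ T sum-zero
    sum-nonzero zero-sum = 4∤sum (∣-subst sum-norm (doubled-norm (x +ᵥ y)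
      (λ i → ∣-subst (regroup (x i) (y i) (+ d i) (+ e i))
        (∣m∣n⇒∣m+n (∣m∣n⇒∣m+n (x≋ i) (y≋ i)) (divisibleᵥ-sound 2 (λ i → + (d i ℕ.+ e i)) zero-sum i)))))
      where
      regroup : ∀ x y d e → x - d + (y - e) + (d + e) ≡ x + y
      regroup = solve-∀
    norm-odd : + 2 ∣ + (⟪ Normℕ ⟫ℕ e e ℕ.+ 1)
    norm-odd = ∣-subst (regroup c (+ ⟪ Normℕ ⟫ℕ e e)) (∣m∣n⇒∣m-n c-odd
      (∣-subst (cong₂ _-_ (trans (Norm-form y) y-norm) (⟪⟫-⁺ Normℕ e e)) (⟪⟫-≡-mod Normgram y (⁺ e) y (⁺ e) y≋ y≋)))
      where
      regroup : ∀ c n → c + 1ℤ - (c - n) ≡ n + 1ℤ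
      regroup = solve-∀
    product-even : + 2 ∣ + ⟪ Oℕ ⟫ℕ d e
    product-even = ∣-resp-≡-mod′ (∣-subst (cong₂ _-_ (Pair.xy P) (⟪⟫-⁺ Oℕ d e)) (⟪⟫-≡-mod Ogram x (⁺ d) y (⁺ e) x≋ y≋))
                     (∣m⇒∣m*n b ∣-refl)

    flat-case : T flat → Pair Lgram a b c
    flat-case t = K-pair⇒L-pair (pair-O (matrix O→K) O→K-similarity P x-even y-even) 3∣det-1
        (O→K-image.image-plane x x-even) (O→K-image.image-plane y y-even)
        (λ (zx , zy) → nontrivial (O→K-image.image-axis x x-even zx , O→K-image.image-axis y y-even zy))
      where
      td = ∧-sound (divisible 2 (+ d 2F)) (proj₁ (∧-sound (divisible 2 (+ d 2F) ∧ divisible 2 (+ d 3F)) t))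
      te = ∧-sound (divisible 2 (+ e 2F)) (proj₂ (∧-sound (divisible 2 (+ d 2F) ∧ divisible 2 (+ d 3F)) t))
      x-even : 2 ∣ᵥ (matrix O→K ⊙ x)
      x-even = O→K-even x (∣-resp-≡-mod (x≋ 2F) (divisible-sound 2 (+ d 2F) (proj₁ td)))
                          (∣-resp-≡-mod (x≋ 3F) (divisible-sound 2 (+ d 3F) (proj₂ td)))
      y-even : 2 ∣ᵥ (matrix O→K ⊙ y)
      y-even = O→K-even y (∣-resp-≡-mod (y≋ 2F) (divisible-sound 2 (+ e 2F) (proj₁ te)))
                          (∣-resp-≡-mod (y≋ 3F) (divisible-sound 2 (+ e 3F) (proj₂ te)))

    image-zero : Fin 8 → Digits 4 → Bool
    image-zero k d = divisibleᵥ 2 (O→L-map k ⊙ ⁺ d)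

    direct-case : (∃ λ k → T (image-zero k d ∧ image-zero k e)) → Pair Lgram a b c
    direct-case (k , t) = pair-O E (O→L-similarity k) P
        (λ i → ∣-resp-≡-mod (⊙-≡-mod E x (⁺ d) x≋ i) (divisibleᵥ-sound 2 (E ⊙ ⁺ d) (proj₁ (∧-sound (image-zero k d) t)) i))
        (λ i → ∣-resp-≡-mod (⊙-≡-mod E y (⁺ e) y≋ i) (divisibleᵥ-sound 2 (E ⊙ ⁺ e) (proj₂ (∧-sound (image-zero k d) t)) i))
      where
      E = O→L-map k

    conclude : T flat ⊎ T (anyFinᵇ 8 (λ k → image-zero k d ∧ image-zero k e)) → Pair Lgram a b c
    conclude (inj₁ t) = flat-case t
    conclude (inj₂ t) = direct-case (anyFin-sound 8 {λ k → image-zero k d ∧ image-zero k e} t)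

  inner : ∀ d → x ≋ ⁺ d [ 2 ] → (∃ λ e → T (integrality-test d e) × y ≋ ⁺ e [ 2 ]) → Pair Lgram a b c
  inner d x≋ (e , te , y≋) = from-digits d e te x≋ y≋
  outer : (∃ λ d → T (allDigits 2 4 (integrality-test d)) × x ≋ ⁺ d [ 2 ]) → Pair Lgram a b c
  outer (d , td , x≋) = inner d x≋ (residues {2} {4} {integrality-test d} td y)

-- Sublattices of prime index

-- Fraction-free elimination with a nonzero entry b of the first column as pivot: a kernel vector y
-- of the smaller matrix lifts to by, preceded by minus the product of y with the rest of the pivot
-- row.
dependent-columns : ∀ n k → n < k → (B : Mat n k) → ∃ λ x → ¬ (x ≈ᵥ 0ᵥ) × (B ⊙ x) ≈ᵥ 0ᵥ
dependent-columns zero (suc k) _ B = (λ _ → 1ℤ) , (λ x≈0 → contradiction (x≈0 zero) λ ()) , λ ()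
dependent-columns (suc n) (suc k) (s≤s n<k) B = decide (Fin.any? (λ r → ¬? (B r zero ℤ.≟ 0ℤ)))
  where
  Goal : Set
  Goal = ∃ λ x → ¬ (x ≈ᵥ 0ᵥ) × (B ⊙ x) ≈ᵥ 0ᵥ

  pivot : ∀ r → B r zero ≢ 0ℤ → Goal
  pivot r b≢0 = lift (dependent-columns n k n<k C)
    where
    b : ℤ
    b = B r zero
    tail : Fin (suc n) → Vec k
    tail i j = B i (suc j)
    eliminated : Fin (suc n) → Vec k
    eliminated i j = b * tail i j - B i zero * tail r j
    C : Mat n k
    C i = eliminated (punchIn r i)
    eliminated-dot : ∀ i y → ∑ k (λ j → eliminated i j * y j) ≡ b * dot (tail i) y - B i zero * dot (tail r) y
    eliminated-dot i y = trans (∑-cong k (λ j → distribute b (tail i j) (B i zero) (tail r j) (y j)))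
      (trans (∑-+ k (λ j → b * (tail i j * y j)) (λ j → - B i zero * (tail r j * y j)))
      (trans (cong₂ _+_ (∑-*ˡ k b (λ j → tail i j * y j)) (∑-*ˡ k (- B i zero) (λ j → tail r j * y j)))
             (cong (_+_ (b * dot (tail i) y)) (sym (ℤ.neg-distribˡ-* (B i zero) (dot (tail r) y))))))
      where
      distribute : ∀ b s a t y → (b * s - a * t) * y ≡ b * (s * y) + - a * (t * y)
      distribute = solve-∀
    lift : (∃ λ y → ¬ (y ≈ᵥ 0ᵥ) × (C ⊙ y) ≈ᵥ 0ᵥ) → Goal
    lift (y , y≢0 , Cy≈0) = x , x≢0 , row
      where
      x : Vec (suc k)
      x = - dot (tail r) y ◂ (b *ᵥ y)
      x≢0 : ¬ (x ≈ᵥ 0ᵥ)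
      x≢0 x≈0 = y≢0 (λ j → cancel j (ℤ.i*j≡0⇒i≡0∨j≡0 b (x≈0 (suc j))))
        where
        cancel : ∀ j → b ≡ 0ℤ ⊎ y j ≡ 0ℤ → y j ≡ 0ℤ
        cancel j (inj₁ b≡0) = contradiction b≡0 b≢0
        cancel j (inj₂ y≡0) = y≡0
      row-value : ∀ i → (B ⊙ x) i ≡ ∑ k (λ j → eliminated i j * y j)
      row-value i = trans (cong (_+_ (B i zero * - dot (tail r) y))
          (trans (∑-cong k (λ j → swap (tail i j) b (y j))) (∑-*ˡ k b (λ j → tail i j * y j))))
        (trans (regroup (B i zero) (dot (tail r) y) (b * dot (tail i) y)) (sym (eliminated-dot i y)))
        where
        swap : ∀ s b y → s * (b * y) ≡ b * (s * y)
        swap = solve-∀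
        regroup : ∀ a t s → a * - t + s ≡ s - a * t
        regroup = solve-∀
      row : (B ⊙ x) ≈ᵥ 0ᵥ
      row i = trans (row-value i) (by-row (r Fin.≟ i))
        where
        by-row : Dec (r ≡ i) → ∑ k (λ j → eliminated i j * y j) ≡ 0ℤ
        by-row (yes refl) = trans (eliminated-dot r y) (ℤ.+-inverseʳ (b * dot (tail r) y))
        by-row (no r≢i)   = subst (λ i → ∑ k (λ j → eliminated i j * y j) ≡ 0ℤ)
                              (Fin.punchIn-punchOut r≢i) (Cy≈0 (punchOut r≢i))

  decide : Dec (∃ λ r → B r zero ≢ 0ℤ) → Goal
  decide (yes (r , b≢0)) = pivot r b≢0
  decide (no all-zero)   = 1ℤ ◂ 0ᵥ , (λ x≈0 → contradiction (x≈0 zero) λ ()) , λ i →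
    trans (cong₂ _+_ (trans (ℤ.*-identityʳ (B i zero)) (column-zero i (B i zero ℤ.≟ 0ℤ)))
                     (trans (∑-cong k (λ j → ℤ.*-zeroʳ (B i (suc j)))) (∑-zero k))) refl
    where
    column-zero : ∀ i → Dec (B i zero ≡ 0ℤ) → B i zero ≡ 0ℤ
    column-zero i (yes b≡0) = b≡0
    column-zero i (no b≢0)  = contradiction (i , b≢0) all-zero

-- For t = r + qp the vector t + i is (r + i) + q·p, so representing M depends only on t modulo p.
translate-pair : ∀ {n} (G : Mat n n) → Symmetric G → ∀ {r p} q → Pair G (r * r + 1ℤ) (r * p) (p * p) →
  ∀ t → t ≡ r + q * p → Pair G (t * t + 1ℤ) (t * p) (p * p)
translate-pair G G-sym {r} {p} q (pair x y xx xy yy) t refl = pair (combination 1ℤ q x y) (combination 0ℤ 1ℤ x y)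
    (trans (⟪⟫-combination G 1ℤ q 1ℤ q x y) (trans (values 1ℤ q 1ℤ q) (norm r p q)))
    (trans (⟪⟫-combination G 1ℤ q 0ℤ 1ℤ x y) (trans (values 1ℤ q 0ℤ 1ℤ) (product′ r p q)))
    (trans (⟪⟫-combination G 0ℤ 1ℤ 0ℤ 1ℤ x y) (trans (values 0ℤ 1ℤ 0ℤ 1ℤ) (square r p)))
  where
  values : ∀ a b c d → a * (c * ⟪ G ⟫ x x + d * ⟪ G ⟫ x y) + b * (c * ⟪ G ⟫ y x + d * ⟪ G ⟫ y y)
           ≡ a * (c * (r * r + 1ℤ) + d * (r * p)) + b * (c * (r * p) + d * (p * p))
  values a b c d = cong₂ _+_ (cong (a *_) (cong₂ (λ u v → c * u + d * v) xx xy))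
                             (cong (b *_) (cong₂ (λ u v → c * u + d * v) (trans (⟪⟫-sym G G-sym y x) xy) yy))
  norm : ∀ r p q → 1ℤ * (1ℤ * (r * r + 1ℤ) + q * (r * p)) + q * (1ℤ * (r * p) + q * (p * p)) ≡ (r + q * p) * (r + q * p) + 1ℤ
  norm = solve-∀
  product′ : ∀ r p q → 1ℤ * (0ℤ * (r * r + 1ℤ) + 1ℤ * (r * p)) + q * (0ℤ * (r * p) + 1ℤ * (p * p)) ≡ (r + q * p) * p
  product′ = solve-∀
  square : ∀ r p → 0ℤ * (0ℤ * (r * r + 1ℤ) + 1ℤ * (r * p)) + 1ℤ * (0ℤ * (r * p) + 1ℤ * (p * p)) ≡ p * p
  square = solve-∀

Lgram-sym : Symmetric Lgram
Lgram-sym = from-yes (Fin.all? (λ i → Fin.all? (λ j → Lgram i j ℤ.≟ Lgram j i)))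

-- Gram data of the vectors t + i and p of ℤ[i].
PlanePair : ℕ → ℤ → Set
PlanePair p t = Pair Lgram (t * t + 1ℤ) (t * + p) (+ p * + p)

reduce-residue : ∀ p .{{_ : ℕ.NonZero p}} → (∀ r → r < p → PlanePair p (+ r)) →
  ∀ t → PlanePair p t
reduce-residue p table t = translate-pair Lgram Lgram-sym {+ (t ℤ.%ℕ p)} {+ p} (t ℤ./ℕ p) (table (t ℤ.%ℕ p) (ℤ.n%ℕd<d t p)) t
                             (ℤ.a≡a%ℕn+[a/ℕn]*n t p)

vec : ℤ → ℤ → ℤ → ℤ → ℤ → Vec 5
vec a b c d e = a ◂ b ◂ c ◂ d ◂ e ◂ empty

-- Explicit vectors for the primes 2, 3 and 7, where respectively the parities, the determinant
-- modulo 3 and `product≢0` are out of reach.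
pairs-2 : ∀ r → r < 2 → PlanePair 2 (+ r)
pairs-2 0 _ = pair (vec (+ 1) (+ 0) (+ 0) (+ 0) (+ 0)) (vec (+ 0) (+ 1) (+ 1) (+ 1) (+ 0)) refl refl refl
pairs-2 1 _ = pair (vec (+ 0) (+ 0) (+ 1) (+ 1) (+ 0)) (vec (+ 0) (+ 1) (+ 1) (+ 1) (+ 0)) refl refl refl
pairs-2 (suc (suc _)) (s≤s (s≤s ()))

pairs-3 : ∀ r → r < 3 → PlanePair 3 (+ r)
pairs-3 0 _ = pair (vec (+ 1) (+ 0) (+ 0) (+ 0) (+ 0)) (vec (+ 0) (+ 1) (+ 2) (+ 2) (+ 1)) refl refl refl
pairs-3 1 _ = pair (vec (+ 0) (+ 0) (+ 1) (+ 1) (+ 0)) (vec (+ 0) (+ 1) (+ 2) (+ 2) (+ 1)) refl refl refl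
pairs-3 2 _ = pair (vec (+ 0) (+ 1) (+ 1) (+ 1) (+ 1)) (vec (+ 0) (+ 1) (+ 2) (+ 2) (+ 1)) refl refl refl
pairs-3 (suc (suc (suc _))) (s≤s (s≤s (s≤s ())))

pairs-7 : ∀ r → r < 7 → PlanePair 7 (+ r)
pairs-7 0 _ = pair (vec (+ 1) (+ 0) (+ 0) (+ 0) (+ 0)) (vec (+ 0) (+ 1) (+ 4) (+ 6) (+ 3)) refl refl refl
pairs-7 1 _ = pair (vec (+ 0) (+ 0) (+ 1) (+ 1) (+ 0)) (vec (+ 0) (+ 1) (+ 4) (+ 6) (+ 3)) refl refl refl
pairs-7 2 _ = pair (vec (+ 0) (+ 0) (+ 1) (+ 2) (+ 1)) (vec (+ 1) (+ 1) (+ 3) (+ 5) (+ 4)) refl refl refl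
pairs-7 3 _ = pair (vec (+ 0) (+ 0) (+ 1) (+ 2) (+ 2)) (vec (+ 1) (+ 1) (+ 3) (+ 5) (+ 4)) refl refl refl
pairs-7 4 _ = pair (vec (+ 1) (+ 1) (+ 2) (+ 3) (+ 2)) (vec (+ 1) (+ 1) (+ 3) (+ 5) (+ 4)) refl refl refl
pairs-7 5 _ = pair (vec (+ 1) (+ 1) (+ 2) (+ 3) (+ 3)) (vec (+ 1) (+ 1) (+ 3) (+ 5) (+ 4)) refl refl refl
pairs-7 6 _ = pair (vec (+ 0) (+ 1) (+ 3) (+ 5) (+ 3)) (vec (+ 0) (+ 1) (+ 4) (+ 6) (+ 3)) refl refl refl
pairs-7 (suc (suc (suc (suc (suc (suc (suc _))))))) (s≤s (s≤s (s≤s (s≤s (s≤s (s≤s (s≤s ())))))))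

∤-offset : ∀ q r .{{_ : ℕ.NonZero r}} → r < 4 → ¬ (+ 4 ∣ + 4 * q + + r)
∤-offset q r r<4 4∣ = contradiction (ℕ.∣⇒≤ (∣⇒∣ᵤ 4∣r)) (ℕ.<⇒≱ r<4)
  where
  4∣r : + 4 ∣ + r
  4∣r = ∣-subst (cancel (+ 4 * q) (+ r)) (∣m∣n⇒∣m-n 4∣ (∣m⇒∣m*n q ∣-refl))
    where
    cancel : ∀ a r → a + r - a ≡ r
    cancel = solve-∀

4∤square+1 : ∀ s → ¬ (+ 4 ∣ s * s + 1ℤ)
4∤square+1 s = by-parity (parity s)
  where
  by-parity : Even s ⊎ Odd s → ¬ (+ 4 ∣ s * s + 1ℤ)
  by-parity (inj₁ (even k refl)) 4∣ = ∤-offset (k * k) 1 (s≤s (s≤s z≤n)) (∣-subst (expand k) 4∣)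
    where
    expand : ∀ k → + 2 * k * (+ 2 * k) + 1ℤ ≡ + 4 * (k * k) + + 1
    expand = solve-∀
  by-parity (inj₂ (odd k refl)) 4∣ = ∤-offset (k * k + k) 2 (s≤s (s≤s (s≤s z≤n))) (∣-subst (expand k) 4∣)
    where
    expand : ∀ k → (1ℤ + + 2 * k) * (1ℤ + + 2 * k) + 1ℤ ≡ + 4 * (k * k + k) + + 2
    expand = solve-∀

module _ {p : ℕ} (p-prime : Prime p) (p≢2 : p ≢ 2) (p≢3 : p ≢ 3) (p≢7 : p ≢ 7) where
  private instance
    p≢0 : ℕ.NonZero p
    p≢0 = prime⇒nonZero p-prime

  private
    h : ℕ
    h = p ℕ./ 2

    prime∤ : ∀ q .{{_ : ℕ.NonTrivial q}} → p ≢ q → ¬ (q ℕ.∣ p)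
    prime∤ q p≢q q∣p with prime⇒irreducible p-prime q∣p
    ... | inj₁ refl = contradiction (ℕ.nonTrivial⇒n>1 1) λ { (s≤s ()) }
    ... | inj₂ q≡p  = p≢q (sym q≡p)

    p≡ : p ≡ suc (2 ℕ.* h)
    p≡ = by-remainder (p ℕ.% 2) (ℕ.m%n<n p 2) (ℕ.m≡m%n+[m/n]*n p 2)
      where
      by-remainder : ∀ r → r < 2 → p ≡ r ℕ.+ h ℕ.* 2 → p ≡ suc (2 ℕ.* h)
      by-remainder 0 _ eq = contradiction (ℕ.divides h eq) (prime∤ 2 p≢2)
      by-remainder 1 _ eq = trans eq (cong suc (ℕ.*-comm h 2))
      by-remainder (suc (suc _)) (s≤s (s≤s ())) _

    +p≡ : + p ≡ 1ℤ + + 2 * + h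
    +p≡ = trans (cong +_ p≡) (cong (_+_ 1ℤ) (ℤ.pos-* 2 h))

    3∣p²-1 : + 3 ∣ + p * + p - 1ℤ
    3∣p²-1 = square-mod-3 (+ p) (λ 3∣p → prime∤ 3 p≢3 (∣⇒∣ᵤ 3∣p))

    2∣p²+1 : + 2 ∣ + p * + p + 1ℤ
    2∣p²+1 = subst (λ z → + 2 ∣ z * z + 1ℤ) (sym +p≡) (divides (+ 2 * (+ h * + h + + h) + 1ℤ) (expand (+ h)))
      where
      expand : ∀ h → (1ℤ + + 2 * h) * (1ℤ + + 2 * h) + 1ℤ ≡ (+ 2 * (h * h + h) + 1ℤ) * + 2
      expand = solve-∀

    2∣p+1 : + 2 ∣ + p + 1ℤ
    2∣p+1 = subst (λ z → + 2 ∣ z + 1ℤ) (sym +p≡) (divides (+ h + 1ℤ) (expand (+ h)))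
      where
      expand : ∀ h → 1ℤ + + 2 * h + 1ℤ ≡ (h + 1ℤ) * + 2
      expand = solve-∀

    4∤2p : ¬ (+ 4 ∣ + 2 * + p)
    4∤2p 4∣2p = ∤-offset (+ h) 2 (s≤s (s≤s (s≤s z≤n))) (∣-subst (trans (cong (+ 2 *_) +p≡) (expand (+ h))) 4∣2p)
      where
      expand : ∀ h → + 2 * (1ℤ + + 2 * h) ≡ + 4 * h + + 2
      expand = solve-∀

  coprime-pair : ∀ t → ¬ (+ p ∣ t * t + 1ℤ) → PlanePair p t
  coprime-pair t p∤ = embedding⇒L-pair (primitive-embedding p-prime {h} p≡ p≢7 t p∤)
    (4∤square+1 t)
    (λ 4∣ → 4∤square+1 (t + + p) (∣-subst (square t (+ p)) 4∣))
    2∣p²+1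
    (∣-subst (det t (+ p)) 3∣p²-1)
    where
    square : ∀ t p → t * t + 1ℤ + + 2 * (t * p) + p * p ≡ (t + p) * (t + p) + 1ℤ
    square = solve-∀
    det : ∀ t p → p * p - 1ℤ ≡ (t * t + 1ℤ) * (p * p) - t * p * (t * p) - 1ℤ
    det = solve-∀

  orthogonal-pair : Pair Lgram (+ p) 0ℤ (+ p)
  orthogonal-pair = embedding⇒L-pair (scaled-embedding (1<p p-prime) (some-discriminant7 p-prime {h} p≡ p≢7))
    (λ 4∣p → 4∤2p (∣n⇒∣m*n (+ 2) 4∣p))
    (λ 4∣ → 4∤2p (∣-subst (double (+ p)) 4∣))
    2∣p+1
    (∣-subst (det (+ p)) 3∣p²-1)
    where
    double : ∀ p → p + + 2 * 0ℤ + p ≡ + 2 * p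
    double = solve-∀
    det : ∀ p → p * p - 1ℤ ≡ p * p - 0ℤ * 0ℤ - 1ℤ
    det = solve-∀

  -- Here p = r² + s² and M = πℤ[i] for π = r + is is similar to ℤ[i].
  singular-pair : ∀ t → + p ∣ t * t + 1ℤ → PlanePair p t
  singular-pair t (divides q t²+1≡qp) = from-reduced (gauss-reduce p (<-wellFounded p) t q
      (trans (cong (_- t * t) (trans (ℤ.*-comm (+ p) q) (sym t²+1≡qp))) (cancel (t * t))))
    where
    cancel : ∀ x → x + 1ℤ - x ≡ 1ℤ
    cancel = solve-∀
    from-reduced : (∃₂ λ x y → + p * x * x + + 2 * t * x * y + q * y * y ≡ 1ℤ) → PlanePair p t
    from-reduced (x , y , one) = rotate orthogonal-pair x y one
     where
     rotate : Pair Lgram (+ p) 0ℤ (+ p) → ∀ x y → + p * x * x + + 2 * t * x * y + q * y * y ≡ 1ℤ →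
              PlanePair p t
     rotate (pair u v xx xy yy) x y one = pair (combination g₁ g₂ u v) (combination r (- y) u v)
        (trans (⟪⟫-combination Lgram g₁ g₂ g₁ g₂ u v) (trans (values g₁ g₂ g₁ g₂)
          (trans (trans (norm (+ p) q t x y) (cong₂ (λ w z → w * (q * + p) + (x * x * + p) * z) one det≡0)) (trans (simplify q (+ p) (x * x * + p)) (sym t²+1≡qp)))))
        (trans (⟪⟫-combination Lgram g₁ g₂ r (- y) u v) (trans (values g₁ g₂ r (- y))
          (trans (trans (cross (+ p) q t x y) (cong₂ (λ w z → w * (t * + p) + (- (x * y) * + p) * z) one det≡0)) (simplify t (+ p) (- (x * y) * + p)))))
        (trans (⟪⟫-combination Lgram r (- y) r (- y) u v) (trans (values r (- y) r (- y))
          (trans (trans (square (+ p) q t x y) (cong₂ (λ w z → w * (+ p * + p) + (y * y * + p) * z) one det≡0)) (simplify (+ p) (+ p) (y * y * + p)))))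
      where
      -- Let π = xp + y(t + i) = r + iy, of norm p by `one`. Then g₁ + ig₂ = (t + i)/π and r - iy =
      -- p/π.
      g₁ g₂ r : ℤ
      g₁ = t * x + q * y
      g₂ = x
      r  = + p * x + t * y
      det≡0 : t * t + 1ℤ - q * + p ≡ 0ℤ
      det≡0 = trans (cong (_- q * + p) t²+1≡qp) (ℤ.+-inverseʳ (q * + p))
      values : ∀ a b c d → a * (c * ⟪ Lgram ⟫ u u + d * ⟪ Lgram ⟫ u v) + b * (c * ⟪ Lgram ⟫ v u + d * ⟪ Lgram ⟫ v v)
               ≡ a * (c * + p + d * 0ℤ) + b * (c * 0ℤ + d * + p)
      values a b c d = cong₂ _+_ (cong (a *_) (cong₂ (λ w z → c * w + d * z) xx xy))
                                 (cong (b *_) (cong₂ (λ w z → c * w + d * z) (trans (⟪⟫-sym Lgram Lgram-sym v u) xy) yy))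
      simplify : ∀ a b z → 1ℤ * (a * b) + z * 0ℤ ≡ a * b
      simplify = solve-∀
      norm : ∀ p q t x y → (t * x + q * y) * ((t * x + q * y) * p + x * 0ℤ) + x * ((t * x + q * y) * 0ℤ + x * p)
             ≡ (p * x * x + + 2 * t * x * y + q * y * y) * (q * p) + (x * x * p) * (t * t + 1ℤ - q * p)
      norm = solve-∀
      cross : ∀ p q t x y → (t * x + q * y) * ((p * x + t * y) * p + - y * 0ℤ) + x * ((p * x + t * y) * 0ℤ + - y * p)
             ≡ (p * x * x + + 2 * t * x * y + q * y * y) * (t * p) + (- (x * y) * p) * (t * t + 1ℤ - q * p)
      cross = solve-∀
      square : ∀ p q t x y → (p * x + t * y) * ((p * x + t * y) * p + - y * 0ℤ) + - y * ((p * x + t * y) * 0ℤ + - y * p)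
             ≡ (p * x * x + + 2 * t * x * y + q * y * y) * (p * p) + (y * y * p) * (t * t + 1ℤ - q * p)
      square = solve-∀

  large-prime-pair : ∀ t → PlanePair p t
  large-prime-pair t = by-divisibility (+ p ∣? t * t + 1ℤ)
    where
    by-divisibility : Dec (+ p ∣ t * t + 1ℤ) → PlanePair p t
    by-divisibility (yes p∣) = singular-pair t p∣
    by-divisibility (no p∤)  = coprime-pair t p∤

prime-pair : ∀ {p} → Prime p → ∀ t → PlanePair p t
prime-pair {p} p-prime = decide (p ℕ.≟ 2) (p ℕ.≟ 3) (p ℕ.≟ 7)
  where
  decide : Dec (p ≡ 2) → Dec (p ≡ 3) → Dec (p ≡ 7) → ∀ t → PlanePair p t
  decide (yes refl) _ _ = reduce-residue 2 pairs-2
  decide (no _) (yes refl) _ = reduce-residue 3 pairs-3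
  decide (no _) (no _) (yes refl) = reduce-residue 7 pairs-7
  decide (no p≢2) (no p≢3) (no p≢7) = large-prime-pair p-prime p≢2 p≢3 p≢7

-- Positivity of L and its vectors of norm 1

module _ (x : Vec 5) where
  private
    x₀ = x 0F
    x₁ = x 1F
    a = x 2F
    b = x 3F
    c = x 4F
    sq : ℤ → ℕ
    sq i = ∣ i ∣ ℕ.* ∣ i ∣

  -- On N it uses 2a² - 2ab + 2b² - 2bc + 3c² = a² + (a - b)² + (b - c)² + 2c², a sum of squares
  -- without denominators.
  L-squares : ℕ
  L-squares = sq x₀ ℕ.+ (sq x₁ ℕ.+ sq x₁ ℕ.+ (sq c ℕ.+ sq c ℕ.+ (sq a ℕ.+ (sq (a - b) ℕ.+ sq (b - c)))))

  L-norm : Q Lgram x ≡ + L-squares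
  L-norm = trans (complete-squares x₀ x₁ a b c)
      (cong₂ _+_ (square-abs x₀) (cong₂ _+_ (cong₂ _+_ (square-abs x₁) (square-abs x₁))
        (cong₂ _+_ (cong₂ _+_ (square-abs c) (square-abs c))
          (cong₂ _+_ (square-abs a) (cong₂ _+_ (square-abs (a - b)) (square-abs (b - c)))))))
    where
    row : ∀ {n} → (p q r s t : ℤ) → (a b c d e : Polynomial n) → Polynomial n
    row p q r s t a b c d e = con p :* a :+ (con q :* b :+ (con r :* c :+ (con s :* d :+ (con t :* e :+ con 0ℤ))))
    complete-squares : ∀ x₀ x₁ a b c → Q Lgram (vec x₀ x₁ a b c) ≡
      x₀ * x₀ + (x₁ * x₁ + x₁ * x₁ + (c * c + c * c + (a * a + ((a - b) * (a - b) + (b - c) * (b - c)))))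
    complete-squares = +-*-Solver.solve 5 (λ x₀ x₁ a b c →
      x₀ :* row (+ 1) 0ℤ 0ℤ 0ℤ 0ℤ x₀ x₁ a b c :+ (x₁ :* row 0ℤ (+ 2) 0ℤ 0ℤ 0ℤ x₀ x₁ a b c :+
        (a :* row 0ℤ 0ℤ (+ 2) ℤ.-1ℤ 0ℤ x₀ x₁ a b c :+ (b :* row 0ℤ 0ℤ ℤ.-1ℤ (+ 2) ℤ.-1ℤ x₀ x₁ a b c :+
          (c :* row 0ℤ 0ℤ 0ℤ ℤ.-1ℤ (+ 3) x₀ x₁ a b c :+ con 0ℤ))))
      := x₀ :* x₀ :+ (x₁ :* x₁ :+ x₁ :* x₁ :+ (c :* c :+ c :* c :+ (a :* a :+ ((a :- b) :* (a :- b) :+ (b :- c) :* (b :- c)))))) refl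

  private
    tail-squares : ℕ
    tail-squares = sq x₁ ℕ.+ sq x₁ ℕ.+ (sq c ℕ.+ sq c ℕ.+ (sq a ℕ.+ (sq (a - b) ℕ.+ sq (b - c))))

  TailZero : Set
  TailZero = x₁ ≡ 0ℤ × a ≡ 0ℤ × b ≡ 0ℤ × c ≡ 0ℤ

  tail-zero : tail-squares ≡ 0 → TailZero
  tail-zero eq₁ = square≡0 x₁ (ℕ.m+n≡0⇒m≡0 (sq x₁) (ℕ.m+n≡0⇒m≡0 (sq x₁ ℕ.+ sq x₁) eq₁)) , a≡0
    , trans (sym (ℤ.neg-involutive b)) (cong -_ (trans (sym (ℤ.+-identityˡ (- b))) (trans (cong (_- b) (sym a≡0)) a-b≡0)))
    , square≡0 c (ℕ.m+n≡0⇒m≡0 (sq c) (ℕ.m+n≡0⇒m≡0 (sq c ℕ.+ sq c) eq₂))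
    where
    eq₂ = ℕ.m+n≡0⇒n≡0 (sq x₁ ℕ.+ sq x₁) eq₁
    eq₃ = ℕ.m+n≡0⇒n≡0 (sq c ℕ.+ sq c) eq₂
    a≡0 = square≡0 a (ℕ.m+n≡0⇒m≡0 (sq a) eq₃)
    a-b≡0 = square≡0 (a - b) (ℕ.m+n≡0⇒m≡0 (sq (a - b)) (ℕ.m+n≡0⇒n≡0 (sq a) eq₃))

  L-anisotropic : L-squares ≡ 0 → x ≈ᵥ 0ᵥ
  L-anisotropic eq = from-tail (tail-zero (ℕ.m+n≡0⇒n≡0 (sq x₀) eq))
    where
    from-tail : TailZero → x ≈ᵥ 0ᵥ
    from-tail (x₁≡0 , a≡0 , b≡0 , c≡0) = 5-cases (square≡0 x₀ (ℕ.m+n≡0⇒m≡0 (sq x₀) eq)) x₁≡0 a≡0 b≡0 c≡0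

  norm-1⇒tail-zero : L-squares ≡ 1 → TailZero
  norm-1⇒tail-zero eq = by-sq (sq x₀) refl
    where
    split : ∀ n m → n ℕ.+ n ℕ.+ m ≡ 1 → n ≡ 0 × m ≡ 1
    split 0 m eq = refl , eq
    split (suc 0) m eq = contradiction (ℕ.suc-injective eq) λ ()
    split (suc (suc n)) m eq = contradiction (ℕ.suc-injective eq) λ ()
    -- Once x₁ = c = 0, the remaining squares are the hexagonal form, which is even.
    hexagonal : tail-squares ≢ 1
    hexagonal eq₁ = 2*≢1 (a * a - a * b + b * b)
        (trans (double a b) (trans (cong (λ z → a * a + ((a - b) * (a - b) + (b - z) * (b - z))) (sym c≡0))
        (trans (cong₂ _+_ (square-abs a) (cong₂ _+_ (square-abs (a - b)) (square-abs (b - c)))) (cong +_ eq₃))))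
      where
      eq₂ = proj₂ (split (sq x₁) _ eq₁)
      c≡0 : c ≡ 0ℤ
      c≡0 = square≡0 c (proj₁ (split (sq c) _ eq₂))
      eq₃ = proj₂ (split (sq c) _ eq₂)
      double : ∀ a b → + 2 * (a * a - a * b + b * b) ≡ a * a + ((a - b) * (a - b) + (b - 0ℤ) * (b - 0ℤ))
      double = solve-∀
    by-sq : ∀ n → sq x₀ ≡ n → TailZero
    by-sq 0       sq≡ = contradiction (trans (cong (ℕ._+ tail-squares) (sym sq≡)) eq) hexagonal
    by-sq (suc n) sq≡ = tail-zero (ℕ.m+n≡0⇒n≡0 n (ℕ.suc-injective (trans (cong (ℕ._+ tail-squares) (sym sq≡)) eq)))

Lgram-lattice : IsLattice Lgram
Lgram-lattice = Lgram-sym , positive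
  where
  positive : ∀ x → ¬ (x ≈ᵥ 0ᵥ) → Q Lgram x ℤ.> + 0
  positive x x≢0 = subst (ℤ._> + 0) (sym (L-norm x)) (ℤ.+<+ (ℕ.n≢0⇒n>0 (λ eq → x≢0 (L-anisotropic x eq))))

-- Vectors of norm 1 are multiples of the first basis vector, so two of them are never orthogonal.
¬L-represents-I₂ : ¬ Represents Lgram I₂
¬L-represents-I₂ (U , U-eq) = contradiction (trans (sym v₀²≡1) (trans (cong (λ z → z * z) v₀≡0) refl)) λ ()
  where
  u v : Vec 5
  u i = U i 0F
  v i = U i 1F
  norm-1 : ∀ w → Q Lgram w ≡ + 1 → TailZero w
  norm-1 w eq = norm-1⇒tail-zero w (ℤ.+-injective (trans (sym (L-norm w)) eq))
  reduce : ∀ w w′ → TailZero w → ⟪ Lgram ⟫ w w′ ≡ w 0F * w′ 0F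
  reduce w w′ (p , q , r , s) rewrite p | q | r | s = expand (w 0F) (w′ 0F) (w′ 1F) (w′ 2F) (w′ 3F) (w′ 4F)
    ((Lgram ⊙ w′) 1F) ((Lgram ⊙ w′) 2F) ((Lgram ⊙ w′) 3F) ((Lgram ⊙ w′) 4F)
    where
    expand : ∀ a b₀ b₁ b₂ b₃ b₄ r₁ r₂ r₃ r₄ →
      a * (+ 1 * b₀ + (+ 0 * b₁ + (+ 0 * b₂ + (+ 0 * b₃ + (+ 0 * b₄ + + 0)))))
      + (+ 0 * r₁ + (+ 0 * r₂ + (+ 0 * r₃ + (+ 0 * r₄ + + 0)))) ≡ a * b₀
    expand = solve-∀
  tail-u = norm-1 u (U-eq 0F 0F)
  tail-v = norm-1 v (U-eq 1F 1F)
  v₀²≡1 : v 0F * v 0F ≡ + 1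
  v₀²≡1 = trans (sym (reduce v v tail-v)) (U-eq 1F 1F)
  v₀≡0 : v 0F ≡ 0ℤ
  v₀≡0 = trans (sym (ℤ.*-identityˡ (v 0F))) (trans (cong (_* v 0F) (sym u₀²≡1)) (trans (ℤ.*-assoc (u 0F) (u 0F) (v 0F))
    (trans (cong (u 0F *_) (trans (sym (reduce u v tail-u)) (U-eq 0F 1F))) (ℤ.*-zeroʳ (u 0F)))))
    where
    u₀²≡1 : u 0F * u 0F ≡ + 1
    u₀²≡1 = trans (sym (reduce u u tail-u)) (U-eq 0F 0F)

-- From prime index to every proper sublattice of I₂

Represented : ∀ {k} → Mat 2 k → Set
Represented B = Represents Lgram (sublatticeGram I₂ B)

I₂-gram : ∀ {k} (B : Mat 2 k) i j → sublatticeGram I₂ B i j ≡ B 0F i * B 0F j + B 1F i * B 1F j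
I₂-gram B i j = expand (B 0F i) (B 1F i) (B 0F j) (B 1F j)
  where
  expand : ∀ a b c d → a * (+ 1 * c + (+ 0 * d + + 0)) + (b * (+ 0 * c + (+ 1 * d + + 0)) + + 0) ≡ a * c + b * d
  expand = solve-∀

-- The condition on M says that it is the Gram matrix of the elements α(t + i) + βq of ℤ[i], so the
-- same combinations of x and y represent it.
pair-represents : ∀ {k t q} → Pair Lgram (t * t + 1ℤ) (t * q) (q * q) → (B : Mat 2 k) (M : Mat k k) (α β : Vec k) →
  (∀ i j → M i j ≡ (t * α i + q * β i) * (t * α j + q * β j) + α i * α j) → Represents Lgram M
pair-represents {k} {t} {q} (pair x y xx xy yy) B M α β M≡ = U , entries
  where
  U : Mat 5 k
  U i j = combination (α j) (β j) x y i
  entries : (transpose U · (Lgram · U)) ≈ₘ M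
  entries i j = trans (⟪⟫-combination Lgram (α i) (β i) (α j) (β j) x y)
    (trans (cong₂ _+_ (cong (α i *_) (cong₂ (λ u v → α j * u + β j * v) xx xy))
                      (cong (β i *_) (cong₂ (λ u v → α j * u + β j * v) (trans (⟪⟫-sym Lgram Lgram-sym y x) xy) yy)))
    (trans (expand (α i) (β i) (α j) (β j) t q) (sym (M≡ i j))))
    where
    expand : ∀ a b c d t q → a * (c * (t * t + 1ℤ) + d * (t * q)) + b * (c * (t * q) + d * (q * q))
             ≡ (t * a + q * b) * (t * c + q * d) + a * c
    expand = solve-∀

module _ {p : ℕ} (p-prime : Prime p) {k : ℕ} (B : Mat 2 k) where

  -- If w₁ is invertible modulo p, the condition says that the first row is t times the second, so
  -- the columns lie in ℤ(t + i) + ℤp. Otherwise p divides the second row, which is the case t = 0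
  -- with the coordinates exchanged.
  congruence-represented : ∀ w₁ w₂ → ¬ ((+ p ∣ w₁) × (+ p ∣ w₂)) → (∀ j → + p ∣ w₁ * B 0F j + w₂ * B 1F j) →
                           Represented B
  congruence-represented w₁ w₂ w≢0 p∣wB = decide (+ p ∣? w₁)
    where
    invertible : (∃ λ n → + p ∣ w₁ * n - 1ℤ) → Represented B
    invertible (n , p∣w₁n-1) = pair-represents {t = t} {+ p} (prime-pair p-prime t) B (sublatticeGram I₂ B) (B 1F) β
        (λ i j → trans (I₂-gram B i j) (cong (_+ B 1F i * B 1F j) (cong₂ _*_ (column i) (column j))))
      where
      t : ℤ
      t = - (n * w₂)
      p∣column : ∀ j → + p ∣ B 0F j - t * B 1F j
      p∣column j = ∣-subst (regroup n w₁ w₂ (B 0F j) (B 1F j))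
        (∣m∣n⇒∣m-n (∣n⇒∣m*n n (p∣wB j)) (∣m⇒∣m*n (B 0F j) p∣w₁n-1))
        where
        regroup : ∀ n w₁ w₂ a b → n * (w₁ * a + w₂ * b) - (w₁ * n - 1ℤ) * a ≡ a - - (n * w₂) * b
        regroup = solve-∀
      β : Vec k
      β j = _∣_.quotient (p∣column j)
      column : ∀ j → B 0F j ≡ t * B 1F j + + p * β j
      column j = trans (split (B 0F j) (t * B 1F j)) (cong (_+_ (t * B 1F j)) (trans (_∣_.equality (p∣column j)) (ℤ.*-comm (β j) (+ p))))
        where
        split : ∀ a b → a ≡ b + (a - b)
        split = solve-∀
    singular : + p ∣ w₁ → Represented B
    singular p∣w₁ = pair-represents {t = 0ℤ} {+ p} (prime-pair p-prime 0ℤ) B (sublatticeGram I₂ B) (B 0F) β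
        (λ i j → trans (I₂-gram B i j) (trans (cong (_+_ (B 0F i * B 0F j)) (cong₂ _*_ (column i) (column j)))
                   (swap (B 0F i) (B 0F j) (+ p * β i) (+ p * β j))))
      where
      p∣row : ∀ j → + p ∣ B 1F j
      p∣row j = by-euclid (euclid p-prime w₂ (B 1F j) (∣-subst (cancel (w₁ * B 0F j) (w₂ * B 1F j))
                  (∣m∣n⇒∣m-n (p∣wB j) (∣m⇒∣m*n (B 0F j) p∣w₁))))
        where
        cancel : ∀ a b → a + b - a ≡ b
        cancel = solve-∀
        by-euclid : (+ p ∣ w₂) ⊎ (+ p ∣ B 1F j) → + p ∣ B 1F j
        by-euclid (inj₁ p∣w₂) = contradiction (p∣w₁ , p∣w₂) w≢0
        by-euclid (inj₂ p∣b)  = p∣b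
      β : Vec k
      β j = _∣_.quotient (p∣row j)
      column : ∀ j → B 1F j ≡ + p * β j
      column j = trans (_∣_.equality (p∣row j)) (ℤ.*-comm (β j) (+ p))
      swap : ∀ a b x y → a * b + x * y ≡ (0ℤ * a + x) * (0ℤ * b + y) + a * b
      swap = solve-∀
    decide : Dec (+ p ∣ w₁) → Represented B
    decide (yes p∣w₁) = singular p∣w₁
    decide (no p∤w₁)  = invertible (inverse-mod p-prime w₁ p∤w₁)

  p∤1 : ¬ (+ p ∣ 1ℤ)
  p∤1 p∣1 = contradiction (ℕ.∣⇒≤ (∣⇒∣ᵤ p∣1)) (ℕ.<⇒≱ (1<p p-prime))

prime[2] : Prime 2
prime[2] = from-yes (prime? 2)

rank-0-represented : (B : Mat 2 0) → Represented B
rank-0-represented B = (λ _ ()) , λ ()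

-- Every vector of ℤ² lies in a sublattice of index 2: one of its coordinates is even, or their sum
-- is.
rank-1-represented : (B : Mat 2 1) → Represented B
rank-1-represented B = decide (parity (B 0F 0F)) (parity (B 1F 0F))
  where
  a = B 0F 0F
  b = B 1F 0F
  decide : Even a ⊎ Odd a → Even b ⊎ Odd b → Represented B
  decide (inj₁ (even k a≡2k)) _ = congruence-represented prime[2] B 1ℤ 0ℤ (λ (2∣1 , _) → p∤1 prime[2] B 2∣1)
    λ { 0F → divides k (trans (cong (λ a → 1ℤ * a + 0ℤ * b) a≡2k) (expand k b)) }
    where
    expand : ∀ k b → 1ℤ * (+ 2 * k) + 0ℤ * b ≡ k * + 2
    expand = solve-∀
  decide (inj₂ _) (inj₁ (even k b≡2k)) = congruence-represented prime[2] B 0ℤ 1ℤ (λ (_ , 2∣1) → p∤1 prime[2] B 2∣1)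
    λ { 0F → divides k (trans (cong (λ b → 0ℤ * a + 1ℤ * b) b≡2k) (expand a k)) }
    where
    expand : ∀ a k → 0ℤ * a + 1ℤ * (+ 2 * k) ≡ k * + 2
    expand = solve-∀
  decide (inj₂ (odd k a≡)) (inj₂ (odd l b≡)) = congruence-represented prime[2] B 1ℤ 1ℤ (λ (2∣1 , _) → p∤1 prime[2] B 2∣1)
    λ { 0F → divides (k + l + 1ℤ) (trans (cong₂ (λ a b → 1ℤ * a + 1ℤ * b) a≡ b≡) (expand k l)) }
    where
    expand : ∀ k l → 1ℤ * (1ℤ + + 2 * k) + 1ℤ * (1ℤ + + 2 * l) ≡ (k + l + 1ℤ) * + 2
    expand = solve-∀

module _ (B : Mat 2 2) where
  private
    a = B 0F 0F
    b = B 0F 1F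
    c = B 1F 0F
    d = B 1F 1F
    δ : ℤ
    δ = a * d - b * c
    ⟨_,_⟩ : ℤ → ℤ → Vec 2
    ⟨ x , y ⟩ = x ◂ y ◂ empty

  det≢0 : InjectiveMap B → δ ≢ 0ℤ
  det≢0 inj δ≡0 = contradiction (inj ⟨ 1ℤ , 0ℤ ⟩ (2-cases (trans (first a b) (first-zero 0F)) (trans (first c d) (first-zero 1F))) 0F) λ ()
    where
    first : ∀ x y → x * 1ℤ + (y * 0ℤ + + 0) ≡ x
    first = solve-∀
    kernel₁ : ⟨ b , - a ⟩ ≈ᵥ 0ᵥ
    kernel₁ = inj ⟨ b , - a ⟩ (2-cases (vanish a b) (trans (minor a b c d) (cong -_ δ≡0)))
      where
      vanish : ∀ a b → a * b + (b * - a + + 0) ≡ 0ℤ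
      vanish = solve-∀
      minor : ∀ a b c d → c * b + (d * - a + + 0) ≡ - (a * d - b * c)
      minor = solve-∀
    kernel₂ : ⟨ d , - c ⟩ ≈ᵥ 0ᵥ
    kernel₂ = inj ⟨ d , - c ⟩ (2-cases (trans (minor a b c d) δ≡0) (vanish c d))
      where
      vanish : ∀ c d → c * d + (d * - c + + 0) ≡ 0ℤ
      vanish = solve-∀
      minor : ∀ a b c d → a * d + (b * - c + + 0) ≡ a * d - b * c
      minor = solve-∀
    first-zero : ∀ i → B i 0F ≡ 0ℤ
    first-zero = 2-cases (trans (sym (ℤ.neg-involutive a)) (cong -_ (kernel₁ 1F)))
                         (trans (sym (ℤ.neg-involutive c)) (cong -_ (kernel₂ 1F)))

  unit-det⇒surjective : ∣ δ ∣ ≡ 1 → SurjectiveMap B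
  unit-det⇒surjective ∣δ∣≡1 v = ⟨ δ * (d * v 0F - b * v 1F) , δ * (a * v 1F - c * v 0F) ⟩
      , 2-cases (trans (first a b c d (v 0F) (v 1F)) (unit (v 0F))) (trans (second a b c d (v 0F) (v 1F)) (unit (v 1F)))
    where
    unit : ∀ z → δ * δ * z ≡ z
    unit z = trans (cong (_* z) (trans (square-abs δ) (cong (λ n → + (n ℕ.* n)) ∣δ∣≡1))) (ℤ.*-identityˡ z)
    first : ∀ a b c d x y → a * ((a * d - b * c) * (d * x - b * y)) + (b * ((a * d - b * c) * (a * y - c * x)) + + 0)
            ≡ (a * d - b * c) * (a * d - b * c) * x
    first = solve-∀
    second : ∀ a b c d x y → c * ((a * d - b * c) * (d * x - b * y)) + (d * ((a * d - b * c) * (a * y - c * x)) + + 0)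
             ≡ (a * d - b * c) * (a * d - b * c) * y
    second = solve-∀

  -- The rows (c, -a) and (d, -b) annihilate B modulo p. If both vanish modulo p, so does B, and (1,
  -- 0) serves.
  prime-det-represented : ∀ {p} → Prime p → + p ∣ δ → Represented B
  prime-det-represented {p} p-prime p∣δ = decide (+ p ∣? a) (+ p ∣? c) (+ p ∣? b) (+ p ∣? d)
    where
    from-first : ¬ ((+ p ∣ c) × (+ p ∣ - a)) → Represented B
    from-first ≢0 = congruence-represented p-prime B c (- a) ≢0
      (2-cases (divides 0ℤ (vanish a c)) (∣-subst (minor a b c d) (∣m⇒∣-m p∣δ)))
      where
      vanish : ∀ a c → c * a + - a * c ≡ 0ℤ
      vanish = solve-∀
      minor : ∀ a b c d → - (a * d - b * c) ≡ c * b + - a * d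
      minor = solve-∀
    from-second : ¬ ((+ p ∣ d) × (+ p ∣ - b)) → Represented B
    from-second ≢0 = congruence-represented p-prime B d (- b) ≢0
      (2-cases (∣-subst (minor a b c d) p∣δ) (divides 0ℤ (vanish b d)))
      where
      vanish : ∀ b d → d * b + - b * d ≡ 0ℤ
      vanish = solve-∀
      minor : ∀ a b c d → a * d - b * c ≡ d * a + - b * c
      minor = solve-∀
    unneg : ∀ {x} → + p ∣ - x → + p ∣ x
    unneg {x} p∣ = ∣-subst (ℤ.neg-involutive x) (∣m⇒∣-m p∣)
    decide : Dec (+ p ∣ a) → Dec (+ p ∣ c) → Dec (+ p ∣ b) → Dec (+ p ∣ d) → Represented B
    decide (no p∤a) _ _ _ = from-first (λ (_ , p∣-a) → p∤a (unneg p∣-a))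
    decide _ (no p∤c) _ _ = from-first (λ (p∣c , _) → p∤c p∣c)
    decide _ _ (no p∤b) _ = from-second (λ (_ , p∣-b) → p∤b (unneg p∣-b))
    decide _ _ _ (no p∤d) = from-second (λ (p∣d , _) → p∤d p∣d)
    decide (yes p∣a) (yes p∣c) (yes p∣b) (yes p∣d) = congruence-represented p-prime B 1ℤ 0ℤ
      (λ (p∣1 , _) → p∤1 p-prime B p∣1)
      (2-cases (∣m∣n⇒∣m+n (∣n⇒∣m*n 1ℤ p∣a) (divides 0ℤ refl)) (∣m∣n⇒∣m+n (∣n⇒∣m*n 1ℤ p∣b) (divides 0ℤ refl)))

prime-divisor : ∀ n .{{_ : ℕ.NonZero n}} → n ≢ 1 → ∃ λ p → Prime p × p ℕ.∣ n
prime-divisor n n≢1 = from-factorisation (factorise n)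
  where
  from-list : ∀ ps → n ≡ ℕ.product ps → All Prime ps → ∃ λ p → Prime p × p ℕ.∣ n
  from-list [] n≡1 _ = contradiction n≡1 n≢1
  from-list (p ∷ ps) n≡ (p-prime ∷ _) = p , p-prime , subst (p ℕ.∣_) (sym n≡) (ℕ.m∣m*n (ℕ.product ps))
  from-factorisation : PrimeFactorisation n → ∃ λ p → Prime p × p ℕ.∣ n
  from-factorisation F = from-list (PrimeFactorisation.factors F) (PrimeFactorisation.isFactorisation F) (PrimeFactorisation.factorsPrime F)

rank-2-represented : (B : Mat 2 2) → InjectiveMap B → ¬ SurjectiveMap B → Represented B
rank-2-represented B inj ¬sur = from-divisor (prime-divisor ∣ δ ∣ {{∣δ∣≢0}} (λ ∣δ∣≡1 → ¬sur (unit-det⇒surjective B ∣δ∣≡1)))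
  where
  δ : ℤ
  δ = B 0F 0F * B 1F 1F - B 0F 1F * B 1F 0F
  ∣δ∣≢0 : ℕ.NonZero ∣ δ ∣
  ∣δ∣≢0 = ℕ.≢-nonZero (λ ∣δ∣≡0 → det≢0 B inj (ℤ.∣i∣≡0⇒i≡0 ∣δ∣≡0))
  from-divisor : (∃ λ p → Prime p × p ℕ.∣ ∣ δ ∣) → Represented B
  from-divisor (p , p-prime , p∣δ) = prime-det-represented B p-prime (∣ᵤ⇒∣ p∣δ)

Lgram-isolation : IsIsolation Lgram I₂
Lgram-isolation = represented , ¬L-represents-I₂
  where
  represented : ∀ k (B : Mat 2 k) → InjectiveMap B → ¬ SurjectiveMap B → Represented B
  represented 0 B _ _ = rank-0-represented B
  represented 1 B _ _ = rank-1-represented B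
  represented 2 B inj ¬sur = rank-2-represented B inj ¬sur
  represented k@(suc (suc (suc _))) B inj _ = absurd (dependent-columns 2 k (s≤s (s≤s (s≤s z≤n))) B)
    where
    absurd : (∃ λ x → ¬ (x ≈ᵥ 0ᵥ) × (B ⊙ x) ≈ᵥ 0ᵥ) → Represented B
    absurd (x , x≢0 , Bx≈0) = contradiction (inj x Bx≈0) x≢0

-- Lattices of rank at most four

anyBelow : ℕ → (ℕ → Bool) → Bool
anyBelow zero    P = false
anyBelow (suc n) P = P n ∨ anyBelow n P

anyBelow-sound : ∀ n {P} → T (anyBelow n P) → ∃ λ i → T (P i)
anyBelow-sound (suc n) {P} t with ∨-sound (P n) t
... | inj₁ tₙ = n , tₙ
... | inj₂ t′ = anyBelow-sound n t′

-- All integers i with w i² ≤ limit; the fuel limit + 2 suffices when w > 0.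
allWeighted : ℕ → ℕ → ℕ → ℕ → (ℤ → Bool) → Bool
allWeighted zero       m w limit P = false
allWeighted (suc fuel) m w limit P =
  not (w ℕ.* (m ℕ.* m) ≤ᵇ limit) ∨ (P (+ m) ∧ P (- + m) ∧ allWeighted fuel (suc m) w limit P)

weightedSquare : ℕ → ℤ → ℕ
weightedSquare w i = w ℕ.* (∣ i ∣ ℕ.* ∣ i ∣)

by-sign : ∀ {P : ℤ → Set} i → P (+ ∣ i ∣) → P (- + ∣ i ∣) → P i
by-sign (+ n)    p₊ p₋ = p₊
by-sign -[1+ n ] p₊ p₋ = p₋

allWeighted-sound : ∀ fuel m w limit P → T (allWeighted fuel m w limit P) →
                    ∀ i → weightedSquare w i ≤ limit → m ≤ ∣ i ∣ → T (P i)
allWeighted-sound (suc fuel) m w limit P t i small m≤i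
  with ∨-sound (not (w ℕ.* (m ℕ.* m) ≤ᵇ limit)) t
... | inj₁ large = contradiction
        (ℕ.≤⇒≤ᵇ (ℕ.≤-trans (ℕ.*-monoʳ-≤ w (ℕ.*-mono-≤ m≤i m≤i)) small))
        (not-sound (w ℕ.* (m ℕ.* m) ≤ᵇ limit) large)
... | inj₂ t′ with ∧-sound (P (+ m)) t′
...   | t₊ , t″ with ∧-sound (P (- + m)) t″ | ℕ.m≤n⇒m<n∨m≡n m≤i
...     | t₋ , rest | inj₁ m<i  = allWeighted-sound fuel (suc m) w limit P rest i small m<i
...     | t₋ , rest | inj₂ refl = by-sign {λ i → T (P i)} i t₊ t₋

allRoots : ℕ → ℕ → ℕ → (ℤ → Bool) → Bool
allRoots zero       m limit P = false
allRoots (suc fuel) m limit P =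
  not (2 ℕ.* (m ℕ.* m) ≤ᵇ limit) ∨
  (((2 ℕ.* (m ℕ.* m) ≡ᵇ limit) ⇒ᵇ P (+ m) ∧ P (- + m)) ∧ allRoots fuel (suc m) limit P)

allRoots-sound : ∀ fuel m limit P → T (allRoots fuel m limit P) →
                 ∀ i → weightedSquare 2 i ≡ limit → m ≤ ∣ i ∣ → T (P i)
allRoots-sound (suc fuel) m limit P t i square m≤i
  with ∨-sound (not (2 ℕ.* (m ℕ.* m) ≤ᵇ limit)) t
... | inj₁ large = contradiction
        (ℕ.≤⇒≤ᵇ (ℕ.≤-trans (ℕ.*-monoʳ-≤ 2 (ℕ.*-mono-≤ m≤i m≤i)) (ℕ.≤-reflexive square)))
        (not-sound (2 ℕ.* (m ℕ.* m) ≤ᵇ limit) large)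
... | inj₂ t′ with ∧-sound ((2 ℕ.* (m ℕ.* m) ≡ᵇ limit) ⇒ᵇ P (+ m) ∧ P (- + m)) t′ | ℕ.m≤n⇒m<n∨m≡n m≤i
...   | _ , rest | inj₁ m<i  = allRoots-sound fuel (suc m) limit P rest i square m<i
...   | here , _ | inj₂ refl = by-sign {λ i → T (P i)} i (proj₁ both) (proj₂ both)
  where
  both = ∧-sound (P (+ m)) (⇒-sound (2 ℕ.* (m ℕ.* m) ≡ᵇ limit) here (ℕ.≡⇒≡ᵇ (weightedSquare 2 i) limit square))

record Coordinates : Set where
  constructor coords
  field
    b₀ b₁ b₂ s : ℤ

-- For y = b₀e + (b₁/2)f₁ + (b₂/2)f₂ + (s/d)g this is the equation ⟨y, y⟩ = n multiplied by 2d.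
NormEquation : ℕ → ℕ → Coordinates → Set
NormEquation d n (coords b₀ b₁ b₂ s) =
  weightedSquare (2 ℕ.* d) b₀ ℕ.+ (weightedSquare d b₁ ℕ.+ (weightedSquare d b₂ ℕ.+ weightedSquare 2 s)) ≡ 2 ℕ.* d ℕ.* n

within : ℕ → ℕ → (ℤ → Bool) → Bool
within w limit = allWeighted (suc (suc limit)) 0 w limit

within-sound : ∀ w limit P → T (within w limit P) → ∀ i rest → weightedSquare w i ℕ.+ rest ≡ limit → T (P i)
within-sound w limit P t i rest eq = allWeighted-sound (suc (suc limit)) 0 w limit P t i
  (subst (weightedSquare w i ≤_) eq (ℕ.m≤m+n (weightedSquare w i) rest)) z≤n

remaining : ∀ a {b c} → a ℕ.+ b ≡ c → b ≡ c ℕ.∸ a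
remaining a {b} eq = trans (sym (ℕ.m+n∸m≡n a b)) (cong (ℕ._∸ a) eq)

opaque
  -- The loops are opaque so that the soundness arguments never run the search; it is evaluated
  -- once, in `all-impossible`.
  loop-s : (Coordinates → Bool) → ℤ → ℤ → ℤ → ℕ → Bool
  loop-s P b₀ b₁ b₂ r = allRoots (suc (suc r)) 0 r λ s → P (coords b₀ b₁ b₂ s)

  loop-b₂ : ℕ → (Coordinates → Bool) → ℤ → ℤ → ℕ → Bool
  loop-b₂ d P b₀ b₁ r = within d r λ b₂ → loop-s P b₀ b₁ b₂ (r ℕ.∸ weightedSquare d b₂)

  loop-b₁ : ℕ → (Coordinates → Bool) → ℤ → ℕ → Bool
  loop-b₁ d P b₀ r = within d r λ b₁ → loop-b₂ d P b₀ b₁ (r ℕ.∸ weightedSquare d b₁)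

  -- The vectors of norm n, in terms of their products with an orthogonal basis of norms 1, 2, 2, d.
  allVectors : ℕ → ℕ → (Coordinates → Bool) → Bool
  allVectors d n P = within (2 ℕ.* d) (2 ℕ.* d ℕ.* n) λ b₀ →
    loop-b₁ d P b₀ (2 ℕ.* d ℕ.* n ℕ.∸ weightedSquare (2 ℕ.* d) b₀)

opaque
  unfolding loop-s
  loop-s-sound : ∀ P b₀ b₁ b₂ r → T (loop-s P b₀ b₁ b₂ r) → ∀ s → weightedSquare 2 s ≡ r → T (P (coords b₀ b₁ b₂ s))
  loop-s-sound P b₀ b₁ b₂ r t s eq = allRoots-sound (suc (suc r)) 0 r (λ s → P (coords b₀ b₁ b₂ s)) t s eq z≤n

opaque
  unfolding loop-b₂
  loop-b₂-sound : ∀ d P b₀ b₁ r → T (loop-b₂ d P b₀ b₁ r) → ∀ b₂ s →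
    weightedSquare d b₂ ℕ.+ weightedSquare 2 s ≡ r → T (P (coords b₀ b₁ b₂ s))
  loop-b₂-sound d P b₀ b₁ r t b₂ s eq = loop-s-sound P b₀ b₁ b₂ (r ℕ.∸ weightedSquare d b₂)
    (within-sound d r (λ b₂ → loop-s P b₀ b₁ b₂ (r ℕ.∸ weightedSquare d b₂)) t b₂ (weightedSquare 2 s) eq)
    s (remaining (weightedSquare d b₂) eq)

opaque
  unfolding loop-b₁
  loop-b₁-sound : ∀ d P b₀ r → T (loop-b₁ d P b₀ r) → ∀ b₁ b₂ s →
    weightedSquare d b₁ ℕ.+ (weightedSquare d b₂ ℕ.+ weightedSquare 2 s) ≡ r → T (P (coords b₀ b₁ b₂ s))
  loop-b₁-sound d P b₀ r t b₁ b₂ s eq = loop-b₂-sound d P b₀ b₁ (r ℕ.∸ weightedSquare d b₁)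
    (within-sound d r (λ b₁ → loop-b₂ d P b₀ b₁ (r ℕ.∸ weightedSquare d b₁)) t b₁ (weightedSquare d b₂ ℕ.+ weightedSquare 2 s) eq)
    b₂ s (remaining (weightedSquare d b₁) eq)

opaque
  unfolding allVectors
  allVectors-sound : ∀ d n P → T (allVectors d n P) → ∀ c → NormEquation d n c → T (P c)
  allVectors-sound d n P t (coords b₀ b₁ b₂ s) eq = loop-b₁-sound d P b₀ (2 ℕ.* d ℕ.* n ℕ.∸ weightedSquare (2 ℕ.* d) b₀)
    (within-sound (2 ℕ.* d) (2 ℕ.* d ℕ.* n) (λ b₀ → loop-b₁ d P b₀ (2 ℕ.* d ℕ.* n ℕ.∸ weightedSquare (2 ℕ.* d) b₀)) t b₀
      (weightedSquare d b₁ ℕ.+ (weightedSquare d b₂ ℕ.+ weightedSquare 2 s)) eq)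
    b₁ b₂ s (remaining (weightedSquare (2 ℕ.* d) b₀) eq)

-- Parameters: p, q are the products of h with f₁, f₂, and m is half the norm of g = 2h - p f₁ - q f₂.
module Search (p q m : ℕ) where

  residue : ℕ → ℤ → ℤ → ℕ → ℕ
  residue k l b r = (+ k * b + l * + r) ℤ.%ℕ 2

  -- Tests whether some k y + l h + … of norm 1 is orthogonal to e, where y has the given coordinates.
  excludes : Coordinates → ℕ → ℤ → Bool
  excludes (coords b₀ b₁ b₂ s) k l =
    -- The vector has products π₁, π₂ in {0, 1} with f₁, f₂ and product ks + lm with g, so its norm
    -- is (π₁ + π₂)/2 + (ks + lm)²/(2m); here π² = π is used.
    weightedSquare 2 (+ k * s + l * + m) ≡ᵇ 2 ℕ.* m ℕ.* (2 ℕ.∸ (residue k l b₁ p ℕ.+ residue k l b₂ q))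

  excluded : Coordinates → Bool
  excluded c = anyBelow 3 λ k → anyBelow 3 λ l → excludes c k (+ l) ∨ excludes c k (- + l)

  product : Coordinates → Coordinates → ℤ
  product (coords b₀ b₁ b₂ s) (coords c₀ c₁ c₂ t) =
    + (2 ℕ.* (2 ℕ.* m)) * (b₀ * c₀) + + (2 ℕ.* m) * (b₁ * c₁ + b₂ * c₂) + + 2 * (s * t)

  -- Since g = 2h - p f₁ - q f₂, the tested number is twice the product with h. This is the
  -- integrality that the rational coordinates alone do not see.
  congruent : Coordinates → Bool
  congruent (coords b₀ b₁ b₂ s) = divisible 2 (s + + p * b₁ + + q * b₂)

  eqℤ : ℤ → ℤ → Bool
  eqℤ a b = ∣ a - b ∣ ≡ᵇ 0

  pair-test : ℕ → Coordinates → Coordinates → Bool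
  pair-test i y x = eqℤ (product x y) (+ (2 ℕ.* (2 ℕ.* m) ℕ.* i)) ⇒ᵇ congruent x ⇒ᵇ excluded x

  vector-test : ℕ → ℕ → Coordinates → Bool
  vector-test n₁ i y = congruent y ⇒ᵇ not (excluded y) ⇒ᵇ allVectors (2 ℕ.* m) n₁ (pair-test i y)

  no-pair : ℕ → ℕ → ℕ → Bool
  no-pair n₁ i n₂ = allVectors (2 ℕ.* m) n₂ (vector-test n₁ i)

-- Gram matrices of proper sublattices of I₂.
data Target : Set where
  [2,1,5] [5,0,5] [2,1,13] [1,0,25] : Target

norm₁ inner norm₂ : Target → ℕ
norm₁ [2,1,5]  = 2
norm₁ [5,0,5]  = 5
norm₁ [2,1,13] = 2
norm₁ [1,0,25] = 1
inner [2,1,5]  = 1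
inner [5,0,5]  = 0
inner [2,1,13] = 1
inner [1,0,25] = 0
norm₂ [2,1,5]  = 5
norm₂ [5,0,5]  = 5
norm₂ [2,1,13] = 13
norm₂ [1,0,25] = 25

-- For q ≤ p ≤ 3 other than p = q = 3 the half-norm m is 18, 17, 16, 14, 13, 10, 9, 8 or 5. The last
-- three, from (p, q) = (3, 0), (3, 1) and (3, 2), get targets of their own.
target : ℕ → Target
target 5 = [2,1,13]
target 8 = [1,0,25]
target 9 = [5,0,5]
target _ = [2,1,5]

-- The subtraction is truncated, so 0 also stands for p² + q² > 18; `target-excluded` rejects the
-- value 0, and those cases are left to `h-excluded`.
half-norm : ℕ → ℕ → ℕ
half-norm p q = 18 ℕ.∸ (p ℕ.* p ℕ.+ q ℕ.* q)

-- The norm of h - k f₁ - l f₂.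
shifted-norm : ℕ → ℕ → ℕ → ℕ → ℤ
shifted-norm p q k l = + (9 ℕ.+ 2 ℕ.* (k ℕ.* k) ℕ.+ 2 ℕ.* (l ℕ.* l)) - + (2 ℕ.* (k ℕ.* p) ℕ.+ 2 ℕ.* (l ℕ.* q))

small-or-negative : ℤ → Bool
small-or-negative (+ 1)     = true
small-or-negative (+ _)     = false
small-or-negative -[1+ _ ]  = true

-- This settles p = 4, where h - 2f₁ has norm 1, and p = q = 3, where h - f₁ - f₂ has norm 1.
h-excluded : ℕ → ℕ → Bool
h-excluded p q = anyBelow 3 λ k → anyBelow 3 λ l → small-or-negative (shifted-norm p q k l)

target-excluded : ℕ → ℕ → ℕ → Target → Bool
target-excluded p q m t = not (m ≡ᵇ 0) ∧ Search.no-pair p q m (norm₁ t) (inner t) (norm₂ t)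

impossible : ℕ → ℕ → Bool
impossible p q = h-excluded p q ∨ target-excluded p q (half-norm p q) (target (half-norm p q))

opaque
  unfolding loop-s allVectors

  -- Fifteen cases: p ≤ 4 by positivity, and q ≤ p after exchanging f₁ and f₂.
  all-impossible : T (allBelow 5 λ p → allBelow (suc p) λ q → impossible p q)
  all-impossible = tt

-- Soundness of the search in a lattice of rank at most four

⟪⟫-zeroʳ : ∀ {n} (G : Mat n n) x {y} → y ≈ᵥ 0ᵥ → ⟪ G ⟫ x y ≡ 0ℤ
⟪⟫-zeroʳ {n} G x {y} y≈0 = trans (⟪⟫-cong G {x} {x} {y} {0ℤ *ᵥ y} (λ _ → refl) (λ i → trans (y≈0 i) refl))
  (trans (⟪⟫-*ʳ G 0ℤ x y) refl)

columns : ∀ {n} → (u₀ u₁ u₂ u₃ u₄ : Vec n) → Mat n 5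
columns u₀ u₁ u₂ u₃ u₄ i 0F = u₀ i
columns u₀ u₁ u₂ u₃ u₄ i 1F = u₁ i
columns u₀ u₁ u₂ u₃ u₄ i 2F = u₂ i
columns u₀ u₁ u₂ u₃ u₄ i 3F = u₃ i
columns u₀ u₁ u₂ u₃ u₄ i 4F = u₄ i

coords-cong : ∀ {a b c d a′ b′ c′ d′} → a ≡ a′ → b ≡ b′ → c ≡ c′ → d ≡ d′ → coords a b c d ≡ coords a′ b′ c′ d′
coords-cong refl refl refl refl = refl

module LowRank {n : ℕ} (n<5 : n < 5) (G : Mat n n) (lattice : IsLattice G) (¬I₂ : ¬ Represents G I₂) where

  G-sym : Symmetric G
  G-sym = proj₁ lattice

  ⟨_,_⟩ : Vec n → Vec n → ℤ
  ⟨_,_⟩ = ⟪ G ⟫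

  comm : ∀ x y → ⟨ x , y ⟩ ≡ ⟨ y , x ⟩
  comm = ⟪⟫-sym G G-sym

  zero? : ∀ {k} (x : Vec k) → Dec (x ≈ᵥ 0ᵥ)
  zero? x = Fin.all? (λ i → x i ℤ.≟ 0ℤ)

  nonnegative : ∀ x → ¬ (⟨ x , x ⟩ ℤ.< 0ℤ)
  nonnegative x <0 = decide (zero? x)
    where
    decide : Dec (x ≈ᵥ 0ᵥ) → ⊥
    decide (yes x≈0) = ℤ.<-irrefl (⟪⟫-zeroʳ G x x≈0) <0
    decide (no x≢0)  = ℤ.<-asym (proj₂ lattice x x≢0) <0

  definite : ∀ x → ⟨ x , x ⟩ ≡ 0ℤ → x ≈ᵥ 0ᵥ
  definite x eq = decide (zero? x)
    where
    decide : Dec (x ≈ᵥ 0ᵥ) → x ≈ᵥ 0ᵥ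
    decide (yes x≈0) = x≈0
    decide (no x≢0)  = contradiction (proj₂ lattice x x≢0) (ℤ.<-irrefl (sym eq))

  no-orthonormal : ∀ x y → ⟨ x , x ⟩ ≡ 1ℤ → ⟨ x , y ⟩ ≡ 0ℤ → ¬ (⟨ y , y ⟩ ≡ 1ℤ)
  no-orthonormal x y xx xy yy = ¬I₂ (U , entries)
    where
    U : Mat n 2
    U i 0F = x i
    U i 1F = y i
    entries : (transpose U · (G · U)) ≈ₘ I₂
    entries 0F 0F = xx
    entries 0F 1F = xy
    entries 1F 0F = trans (comm y x) xy
    entries 1F 1F = yy

  ⟨,⟩-linear₃ : ∀ a b c x y z v → ⟨ v , (a *ᵥ x) +ᵥ ((b *ᵥ y) +ᵥ (c *ᵥ z)) ⟩ ≡ a * ⟨ v , x ⟩ + (b * ⟨ v , y ⟩ + c * ⟨ v , z ⟩)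
  ⟨,⟩-linear₃ a b c x y z v = trans (⟪⟫-+ʳ G v (a *ᵥ x) ((b *ᵥ y) +ᵥ (c *ᵥ z)))
    (cong₂ _+_ (⟪⟫-*ʳ G a v x) (trans (⟪⟫-+ʳ G v (b *ᵥ y) (c *ᵥ z)) (cong₂ _+_ (⟪⟫-*ʳ G b v y) (⟪⟫-*ʳ G c v z))))

  ⟨,⟩-linear₅ : ∀ a b c d e x y z u w v →
    ⟨ v , (a *ᵥ x) +ᵥ ((b *ᵥ y) +ᵥ ((c *ᵥ z) +ᵥ ((d *ᵥ u) +ᵥ (e *ᵥ w)))) ⟩
    ≡ a * ⟨ v , x ⟩ + (b * ⟨ v , y ⟩ + (c * ⟨ v , z ⟩ + (d * ⟨ v , u ⟩ + e * ⟨ v , w ⟩)))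
  ⟨,⟩-linear₅ a b c d e x y z u w v = trans (⟪⟫-+ʳ G v (a *ᵥ x) ((b *ᵥ y) +ᵥ ((c *ᵥ z) +ᵥ ((d *ᵥ u) +ᵥ (e *ᵥ w)))))
    (cong₂ _+_ (⟪⟫-*ʳ G a v x) (trans (⟪⟫-+ʳ G v (b *ᵥ y) ((c *ᵥ z) +ᵥ ((d *ᵥ u) +ᵥ (e *ᵥ w))))
      (cong₂ _+_ (⟪⟫-*ʳ G b v y) (⟨,⟩-linear₃ c d e z u w v))))

  module Frame (e f₁ f₂ h : Vec n) (ee : ⟨ e , e ⟩ ≡ 1ℤ) (ef₁ : ⟨ e , f₁ ⟩ ≡ 0ℤ) (ef₂ : ⟨ e , f₂ ⟩ ≡ 0ℤ)
    (eh : ⟨ e , h ⟩ ≡ 0ℤ) (f₁f₁ : ⟨ f₁ , f₁ ⟩ ≡ + 2) (f₁f₂ : ⟨ f₁ , f₂ ⟩ ≡ 0ℤ) (f₂f₂ : ⟨ f₂ , f₂ ⟩ ≡ + 2)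
    (hh : ⟨ h , h ⟩ ≡ + 9) {p q : ℕ} (f₁h : ⟨ f₁ , h ⟩ ≡ + p) (f₂h : ⟨ f₂ , h ⟩ ≡ + q) where

    f₁e : ⟨ f₁ , e ⟩ ≡ 0ℤ
    f₁e = trans (comm f₁ e) ef₁
    f₂e : ⟨ f₂ , e ⟩ ≡ 0ℤ
    f₂e = trans (comm f₂ e) ef₂
    f₂f₁ : ⟨ f₂ , f₁ ⟩ ≡ 0ℤ
    f₂f₁ = trans (comm f₂ f₁) f₁f₂
    hf₁ : ⟨ h , f₁ ⟩ ≡ + p
    hf₁ = trans (comm h f₁) f₁h
    hf₂ : ⟨ h , f₂ ⟩ ≡ + q
    hf₂ = trans (comm h f₂) f₂h

    shift-h : ℕ → ℕ → Vec n
    shift-h k l = (1ℤ *ᵥ h) +ᵥ ((- + k *ᵥ f₁) +ᵥ (- + l *ᵥ f₂))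

    shift-h-norm : ∀ k l → ⟨ shift-h k l , shift-h k l ⟩ ≡ shifted-norm p q k l
    shift-h-norm k l = trans (⟨,⟩-linear₃ 1ℤ (- + k) (- + l) h f₁ f₂ (shift-h k l))
      (trans (cong₂ (λ a b → 1ℤ * a + b) (with-shift h hh hf₁ hf₂)
        (cong₂ (λ a b → - + k * a + - + l * b) (with-shift f₁ f₁h f₁f₁ f₁f₂) (with-shift f₂ f₂h f₂f₁ f₂f₂)))
      (trans (expand (+ p) (+ q) (+ k) (+ l)) cast))
      where
      with-shift : ∀ v {a b c} → ⟨ v , h ⟩ ≡ a → ⟨ v , f₁ ⟩ ≡ b → ⟨ v , f₂ ⟩ ≡ c →
                   ⟨ shift-h k l , v ⟩ ≡ 1ℤ * a + (- + k * b + - + l * c)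
      with-shift v refl refl refl = trans (comm (shift-h k l) v) (⟨,⟩-linear₃ 1ℤ (- + k) (- + l) h f₁ f₂ v)
      expand : ∀ p q k l →
        1ℤ * (1ℤ * + 9 + (- k * p + - l * q))
          + (- k * (1ℤ * p + (- k * + 2 + - l * 0ℤ)) + - l * (1ℤ * q + (- k * 0ℤ + - l * + 2)))
        ≡ + 9 + + 2 * (k * k) + + 2 * (l * l) - (+ 2 * (k * p) + + 2 * (l * q))
      expand = solve-∀
      twice : ∀ a b → + 2 * (+ a * + b) ≡ + (2 ℕ.* (a ℕ.* b))
      twice a b = trans (cong (+ 2 *_) (sym (ℤ.pos-* a b))) (sym (ℤ.pos-* 2 (a ℕ.* b)))
      cast : + 9 + + 2 * (+ k * + k) + + 2 * (+ l * + l) - (+ 2 * (+ k * + p) + + 2 * (+ l * + q)) ≡ shifted-norm p q k l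
      cast = cong₂ (λ a b → a - b) (cong₂ _+_ (cong (_+_ (+ 9)) (twice k k)) (twice l l)) (cong₂ _+_ (twice k p) (twice l q))

    h-excluded-sound : T (h-excluded p q) → ⊥
    h-excluded-sound t = outer (anyBelow-sound 3 t)
      where
      check : ∀ k l i → ⟨ shift-h k l , shift-h k l ⟩ ≡ i → T (small-or-negative i) → ⊥
      check k l (+ 1) norm≡1 _ = no-orthonormal e (shift-h k l) ee
        (trans (⟨,⟩-linear₃ 1ℤ (- + k) (- + l) h f₁ f₂ e)
          (trans (cong₂ (λ a b → 1ℤ * a + b) eh (cong₂ (λ a b → - + k * a + - + l * b) ef₁ ef₂)) (vanish (+ k) (+ l)))) norm≡1
        where
        vanish : ∀ k l → 1ℤ * 0ℤ + (- k * 0ℤ + - l * 0ℤ) ≡ 0ℤ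
        vanish = solve-∀
      check k l -[1+ _ ] norm<0 _ = nonnegative (shift-h k l) (subst (ℤ._< 0ℤ) (sym norm<0) ℤ.-<+)
      inner′ : ∀ k → (∃ λ l → T (small-or-negative (shifted-norm p q k l))) → ⊥
      inner′ k (l , tl) = check k l (shifted-norm p q k l) (shift-h-norm k l) tl
      outer : (∃ λ k → T (anyBelow 3 λ l → small-or-negative (shifted-norm p q k l))) → ⊥
      outer (k , tk) = inner′ k (anyBelow-sound 3 tk)

    module _ {m : ℕ} (m≢0 : m ≢ 0) (m≡ : + 18 - + p * + p - + q * + q ≡ + m) where
      open Search p q m

      -- Twice the component of h orthogonal to f₁ and f₂.
      g : Vec n
      g = (+ 2 *ᵥ h) +ᵥ ((- + p *ᵥ f₁) +ᵥ (- + q *ᵥ f₂))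

      eg : ⟨ e , g ⟩ ≡ 0ℤ
      eg = trans (⟨,⟩-linear₃ (+ 2) (- + p) (- + q) h f₁ f₂ e)
        (trans (cong₂ (λ a b → + 2 * a + b) eh (cong₂ (λ a b → - + p * a + - + q * b) ef₁ ef₂)) (vanish (+ p) (+ q)))
        where
        vanish : ∀ k l → + 2 * 0ℤ + (- k * 0ℤ + - l * 0ℤ) ≡ 0ℤ
        vanish = solve-∀
      f₁g : ⟨ f₁ , g ⟩ ≡ 0ℤ
      f₁g = trans (⟨,⟩-linear₃ (+ 2) (- + p) (- + q) h f₁ f₂ f₁)
        (trans (cong₂ (λ a b → + 2 * a + b) f₁h (cong₂ (λ a b → - + p * a + - + q * b) f₁f₁ f₁f₂)) (vanish (+ p) (+ q)))
        where
        vanish : ∀ k l → + 2 * k + (- k * + 2 + - l * 0ℤ) ≡ 0ℤ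
        vanish = solve-∀
      f₂g : ⟨ f₂ , g ⟩ ≡ 0ℤ
      f₂g = trans (⟨,⟩-linear₃ (+ 2) (- + p) (- + q) h f₁ f₂ f₂)
        (trans (cong₂ (λ a b → + 2 * a + b) f₂h (cong₂ (λ a b → - + p * a + - + q * b) f₂f₁ f₂f₂)) (vanish (+ p) (+ q)))
        where
        vanish : ∀ k l → + 2 * l + (- k * 0ℤ + - l * + 2) ≡ 0ℤ
        vanish = solve-∀
      hg : ⟨ h , g ⟩ ≡ + m
      hg = trans (⟨,⟩-linear₃ (+ 2) (- + p) (- + q) h f₁ f₂ h)
        (trans (cong₂ (λ a b → + 2 * a + b) hh (cong₂ (λ a b → - + p * a + - + q * b) hf₁ hf₂)) (trans (expand (+ p) (+ q)) m≡))
        where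
        expand : ∀ k l → + 2 * + 9 + (- k * k + - l * l) ≡ + 18 - k * k - l * l
        expand = solve-∀
      gg : ⟨ g , g ⟩ ≡ + 2 * + m
      gg = trans (⟨,⟩-linear₃ (+ 2) (- + p) (- + q) h f₁ f₂ g)
        (trans (cong₂ (λ a b → + 2 * a + b) (trans (comm g h) hg) (cong₂ (λ a b → - + p * a + - + q * b) (trans (comm g f₁) f₁g) (trans (comm g f₂) f₂g)))
               (vanish (+ m) (+ p) (+ q)))
        where
        vanish : ∀ m k l → + 2 * m + (- k * 0ℤ + - l * 0ℤ) ≡ + 2 * m
        vanish = solve-∀

      coordinates : Vec n → Coordinates
      coordinates y = coords ⟨ e , y ⟩ ⟨ f₁ , y ⟩ ⟨ f₂ , y ⟩ ⟨ g , y ⟩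

      -- The component of y orthogonal to e, f₁, f₂ and g, multiplied by 4m to clear denominators.
      remainder : Vec n → Vec n
      remainder y = ((+ 4 * + m) *ᵥ y) +ᵥ ((- (+ 4 * + m * ⟨ e , y ⟩) *ᵥ e) +ᵥ ((- (+ 2 * + m * ⟨ f₁ , y ⟩) *ᵥ f₁)
        +ᵥ ((- (+ 2 * + m * ⟨ f₂ , y ⟩) *ᵥ f₂) +ᵥ (- (+ 2 * ⟨ g , y ⟩) *ᵥ g))))

      remainder-product : ∀ y v {a b c d} → ⟨ v , e ⟩ ≡ a → ⟨ v , f₁ ⟩ ≡ b → ⟨ v , f₂ ⟩ ≡ c → ⟨ v , g ⟩ ≡ d →
        ⟨ v , remainder y ⟩ ≡ + 4 * + m * ⟨ v , y ⟩ + (- (+ 4 * + m * ⟨ e , y ⟩) * a + (- (+ 2 * + m * ⟨ f₁ , y ⟩) * b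
          + (- (+ 2 * + m * ⟨ f₂ , y ⟩) * c + - (+ 2 * ⟨ g , y ⟩) * d)))
      remainder-product y v refl refl refl refl =
        ⟨,⟩-linear₅ (+ 4 * + m) (- (+ 4 * + m * ⟨ e , y ⟩)) (- (+ 2 * + m * ⟨ f₁ , y ⟩)) (- (+ 2 * + m * ⟨ f₂ , y ⟩)) (- (+ 2 * ⟨ g , y ⟩))
          y e f₁ f₂ g v

      +m≢0 : + m ≢ 0ℤ
      +m≢0 eq = m≢0 (ℤ.+-injective eq)

      -- In rank at most 4 the vectors e, f₁, f₂, g and z are linearly dependent. They are pairwise
      -- orthogonal and the first four have nonzero norm, so a relation involves z alone and its
      -- norm vanishes. This is where the bound on the rank enters.
      remainder-zero : ∀ y y′ → ⟨ y′ , remainder y ⟩ ≡ 0ℤ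
      remainder-zero y y′ = from-relation (dependent-columns n 5 n<5 C)
        where
        z : Vec n
        z = remainder y
        C : Mat n 5
        C = columns e f₁ f₂ g z
        ez : ⟨ e , z ⟩ ≡ 0ℤ
        ez = trans (remainder-product y e ee ef₁ ef₂ eg) (vanish (+ m) ⟨ e , y ⟩ ⟨ f₁ , y ⟩ ⟨ f₂ , y ⟩ ⟨ g , y ⟩)
          where
          vanish : ∀ m a b c d → + 4 * m * a + (- (+ 4 * m * a) * 1ℤ + (- (+ 2 * m * b) * 0ℤ + (- (+ 2 * m * c) * 0ℤ + - (+ 2 * d) * 0ℤ))) ≡ 0ℤ
          vanish = solve-∀
        f₁z : ⟨ f₁ , z ⟩ ≡ 0ℤ
        f₁z = trans (remainder-product y f₁ f₁e f₁f₁ f₁f₂ f₁g) (vanish (+ m) ⟨ e , y ⟩ ⟨ f₁ , y ⟩ ⟨ f₂ , y ⟩ ⟨ g , y ⟩)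
          where
          vanish : ∀ m a b c d → + 4 * m * b + (- (+ 4 * m * a) * 0ℤ + (- (+ 2 * m * b) * + 2 + (- (+ 2 * m * c) * 0ℤ + - (+ 2 * d) * 0ℤ))) ≡ 0ℤ
          vanish = solve-∀
        f₂z : ⟨ f₂ , z ⟩ ≡ 0ℤ
        f₂z = trans (remainder-product y f₂ f₂e f₂f₁ f₂f₂ f₂g) (vanish (+ m) ⟨ e , y ⟩ ⟨ f₁ , y ⟩ ⟨ f₂ , y ⟩ ⟨ g , y ⟩)
          where
          vanish : ∀ m a b c d → + 4 * m * c + (- (+ 4 * m * a) * 0ℤ + (- (+ 2 * m * b) * 0ℤ + (- (+ 2 * m * c) * + 2 + - (+ 2 * d) * 0ℤ))) ≡ 0ℤ
          vanish = solve-∀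
        gz : ⟨ g , z ⟩ ≡ 0ℤ
        gz = trans (remainder-product y g (trans (comm g e) eg) (trans (comm g f₁) f₁g) (trans (comm g f₂) f₂g) gg) (vanish (+ m) ⟨ e , y ⟩ ⟨ f₁ , y ⟩ ⟨ f₂ , y ⟩ ⟨ g , y ⟩)
          where
          vanish : ∀ m a b c d → + 4 * m * d + (- (+ 4 * m * a) * 0ℤ + (- (+ 2 * m * b) * 0ℤ + (- (+ 2 * m * c) * 0ℤ + - (+ 2 * d) * (+ 2 * m)))) ≡ 0ℤ
          vanish = solve-∀
        from-relation : (∃ λ x → ¬ (x ≈ᵥ 0ᵥ) × (C ⊙ x) ≈ᵥ 0ᵥ) → ⟨ y′ , z ⟩ ≡ 0ℤ
        from-relation (x , x≢0 , Cx≈0) = trans (comm y′ z) (⟪⟫-zero-left (definite z zz≡0))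
          where
          ⟪⟫-zero-left : z ≈ᵥ 0ᵥ → ⟨ z , y′ ⟩ ≡ 0ℤ
          ⟪⟫-zero-left z≈0 = trans (comm z y′) (⟪⟫-zeroʳ G y′ z≈0)
          relation : ∀ v {a b c d k} → ⟨ v , e ⟩ ≡ a → ⟨ v , f₁ ⟩ ≡ b → ⟨ v , f₂ ⟩ ≡ c → ⟨ v , g ⟩ ≡ d → ⟨ v , z ⟩ ≡ k →
                     a * x 0F + (b * x 1F + (c * x 2F + (d * x 3F + (k * x 4F + + 0)))) ≡ 0ℤ
          relation v refl refl refl refl refl = trans (sym (⟪⟫-⊙ʳ G C v x)) (⟪⟫-zeroʳ G v Cx≈0)
          x₀≡0 : x 0F ≡ 0ℤ
          x₀≡0 = trans (single (x 0F) (x 1F) (x 2F) (x 3F) (x 4F)) (relation e ee ef₁ ef₂ eg ez)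
            where
            single : ∀ a b c d k → a ≡ 1ℤ * a + (0ℤ * b + (0ℤ * c + (0ℤ * d + (0ℤ * k + + 0))))
            single = solve-∀
          x₁≡0 : x 1F ≡ 0ℤ
          x₁≡0 = ℤ.*-cancelˡ-≡ (+ 2) (x 1F) 0ℤ (trans (single (x 0F) (x 1F) (x 2F) (x 3F) (x 4F)) (relation f₁ f₁e f₁f₁ f₁f₂ f₁g f₁z))
            where
            single : ∀ a b c d k → + 2 * b ≡ 0ℤ * a + (+ 2 * b + (0ℤ * c + (0ℤ * d + (0ℤ * k + + 0))))
            single = solve-∀
          x₂≡0 : x 2F ≡ 0ℤ
          x₂≡0 = ℤ.*-cancelˡ-≡ (+ 2) (x 2F) 0ℤ (trans (single (x 0F) (x 1F) (x 2F) (x 3F) (x 4F)) (relation f₂ f₂e f₂f₁ f₂f₂ f₂g f₂z))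
            where
            single : ∀ a b c d k → + 2 * c ≡ 0ℤ * a + (0ℤ * b + (+ 2 * c + (0ℤ * d + (0ℤ * k + + 0))))
            single = solve-∀
          x₃≡0 : x 3F ≡ 0ℤ
          x₃≡0 = cancel (ℤ.i*j≡0⇒i≡0∨j≡0 (+ 2 * + m) (trans (single (+ 2 * + m) (x 0F) (x 1F) (x 2F) (x 3F) (x 4F))
              (relation g (trans (comm g e) eg) (trans (comm g f₁) f₁g) (trans (comm g f₂) f₂g) gg gz)))
            where
            single : ∀ m a b c d k → m * d ≡ 0ℤ * a + (0ℤ * b + (0ℤ * c + (m * d + (0ℤ * k + + 0))))
            single = solve-∀
            cancel : + 2 * + m ≡ 0ℤ ⊎ x 3F ≡ 0ℤ → x 3F ≡ 0ℤ
            cancel (inj₁ 2m≡0) = contradiction (ℤ.*-cancelˡ-≡ (+ 2) (+ m) 0ℤ 2m≡0) +m≢0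
            cancel (inj₂ eq)   = eq
          zz≡0 : ⟨ z , z ⟩ ≡ 0ℤ
          zz≡0 = cancel (ℤ.i*j≡0⇒i≡0∨j≡0 ⟨ z , z ⟩ (trans (single ⟨ z , z ⟩ (x 0F) (x 1F) (x 2F) (x 3F) (x 4F))
              (relation z (trans (comm z e) ez) (trans (comm z f₁) f₁z) (trans (comm z f₂) f₂z) (trans (comm z g) gz) refl)))
            where
            single : ∀ m a b c d k → m * k ≡ 0ℤ * a + (0ℤ * b + (0ℤ * c + (0ℤ * d + (m * k + + 0))))
            single = solve-∀
            cancel : ⟨ z , z ⟩ ≡ 0ℤ ⊎ x 4F ≡ 0ℤ → ⟨ z , z ⟩ ≡ 0ℤ
            cancel (inj₁ eq)   = eq
            cancel (inj₂ x₄≡0) = contradiction (5-cases {λ i → x i ≡ 0ℤ} x₀≡0 x₁≡0 x₂≡0 x₃≡0 x₄≡0) x≢0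

      4m≡ : + 4 * + m ≡ + (2 ℕ.* (2 ℕ.* m))
      4m≡ = trans (assoc (+ m)) (trans (cong (+ 2 *_) (sym (ℤ.pos-* 2 m))) (sym (ℤ.pos-* 2 (2 ℕ.* m))))
        where
        assoc : ∀ m → + 4 * m ≡ + 2 * (+ 2 * m)
        assoc = solve-∀

      -- By `remainder-zero` a vector equals its expansion in the orthogonal basis of norms 1, 2, 2,
      -- 2m; the factor 4m clears the denominators.
      parseval : ∀ x y → product (coordinates x) (coordinates y) ≡ + 4 * + m * ⟨ x , y ⟩
      parseval x y = sym (trans (isolate (+ m) ⟨ x , y ⟩ ⟨ e , x ⟩ ⟨ f₁ , x ⟩ ⟨ f₂ , x ⟩ ⟨ g , x ⟩ ⟨ e , y ⟩ ⟨ f₁ , y ⟩ ⟨ f₂ , y ⟩ ⟨ g , y ⟩)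
          (trans (cong (_+ total) (trans (sym (remainder-product y x (comm x e) (comm x f₁) (comm x f₂) (comm x g))) (remainder-zero y x)))
          (trans (ℤ.+-identityˡ total) cast)))
        where
        total : ℤ
        total = + 4 * + m * (⟨ e , x ⟩ * ⟨ e , y ⟩) + + 2 * + m * (⟨ f₁ , x ⟩ * ⟨ f₁ , y ⟩ + ⟨ f₂ , x ⟩ * ⟨ f₂ , y ⟩) + + 2 * (⟨ g , x ⟩ * ⟨ g , y ⟩)
        isolate : ∀ m w a b c d a′ b′ c′ d′ → + 4 * m * w ≡
          + 4 * m * w + (- (+ 4 * m * a′) * a + (- (+ 2 * m * b′) * b + (- (+ 2 * m * c′) * c + - (+ 2 * d′) * d)))
          + (+ 4 * m * (a * a′) + + 2 * m * (b * b′ + c * c′) + + 2 * (d * d′))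
        isolate = solve-∀
        cast : total ≡ product (coordinates x) (coordinates y)
        cast = cong₂ (λ a b → a * (⟨ e , x ⟩ * ⟨ e , y ⟩) + b * (⟨ f₁ , x ⟩ * ⟨ f₁ , y ⟩ + ⟨ f₂ , x ⟩ * ⟨ f₂ , y ⟩) + + 2 * (⟨ g , x ⟩ * ⟨ g , y ⟩))
                 4m≡ (sym (ℤ.pos-* 2 m))

      sum-of-residues : ∀ π₁ π₂ → π₁ < 2 → π₂ < 2 → ∀ w → + weightedSquare 2 w ≡ + (2 ℕ.* m ℕ.* (2 ℕ.∸ (π₁ ℕ.+ π₂))) →
        product (coords 0ℤ (+ π₁) (+ π₂) w) (coords 0ℤ (+ π₁) (+ π₂) w) ≡ + 4 * + m * 1ℤ
      sum-of-residues π₁ π₂ π₁<2 π₂<2 w eq = trans (cong₂ (λ a b → + (2 ℕ.* (2 ℕ.* m)) * (0ℤ * 0ℤ) + a * (+ π₁ * + π₁ + + π₂ * + π₂) + b)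
          (ℤ.pos-* 2 m) (trans (square-double w) (trans eq (trans (ℤ.pos-* (2 ℕ.* m) _) (cong (_* + (2 ℕ.∸ (π₁ ℕ.+ π₂))) (ℤ.pos-* 2 m))))))
        (cases π₁ π₂ π₁<2 π₂<2)
        where
        square-double : ∀ w → + 2 * (w * w) ≡ + weightedSquare 2 w
        square-double w = trans (cong (+ 2 *_) (square-abs w)) (sym (ℤ.pos-* 2 (∣ w ∣ ℕ.* ∣ w ∣)))
        cases : ∀ π₁ π₂ → π₁ < 2 → π₂ < 2 →
          + (2 ℕ.* (2 ℕ.* m)) * (0ℤ * 0ℤ) + + 2 * + m * (+ π₁ * + π₁ + + π₂ * + π₂) + + 2 * + m * + (2 ℕ.∸ (π₁ ℕ.+ π₂)) ≡ + 4 * + m * 1ℤ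
        cases 0 0 _ _ = case (+ (2 ℕ.* (2 ℕ.* m))) (+ m)
          where
          case : ∀ a m → a * (0ℤ * 0ℤ) + + 2 * m * 0ℤ + + 2 * m * + 2 ≡ + 4 * m * 1ℤ
          case = solve-∀
        cases 0 1 _ _ = case (+ (2 ℕ.* (2 ℕ.* m))) (+ m)
          where
          case : ∀ a m → a * (0ℤ * 0ℤ) + + 2 * m * 1ℤ + + 2 * m * + 1 ≡ + 4 * m * 1ℤ
          case = solve-∀
        cases 1 0 _ _ = case (+ (2 ℕ.* (2 ℕ.* m))) (+ m)
          where
          case : ∀ a m → a * (0ℤ * 0ℤ) + + 2 * m * 1ℤ + + 2 * m * + 1 ≡ + 4 * m * 1ℤ
          case = solve-∀
        cases 1 1 _ _ = case (+ (2 ℕ.* (2 ℕ.* m))) (+ m)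
          where
          case : ∀ a m → a * (0ℤ * 0ℤ) + + 2 * m * + 2 + + 2 * m * + 0 ≡ + 4 * m * 1ℤ
          case = solve-∀
        cases (suc (suc _)) _ (s≤s (s≤s ())) _
        cases _ (suc (suc _)) _ (s≤s (s≤s ()))

      excludes-sound : ∀ y k l → T (excludes (coordinates y) k l) → ⊥
      excludes-sound y k l t = no-orthonormal e w ee ew≡0 ww≡1
        where
        b₀ = ⟨ e , y ⟩
        b₁ = ⟨ f₁ , y ⟩
        b₂ = ⟨ f₂ , y ⟩
        s  = ⟨ g , y ⟩
        t₁ t₂ : ℤ
        t₁ = (+ k * b₁ + l * + p) ℤ./ℕ 2
        t₂ = (+ k * b₂ + l * + q) ℤ./ℕ 2
        π₁ π₂ : ℕ
        π₁ = residue k l b₁ p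
        π₂ = residue k l b₂ q
        w : Vec n
        -- Subtracting multiples of e, f₁ and f₂ brings the products with them down to 0 for e and
        -- to 0 or 1 for f₁ and f₂, the least norm in the class of ky + lh modulo these vectors.
        w = (+ k *ᵥ y) +ᵥ ((- (+ k * b₀) *ᵥ e) +ᵥ ((- t₁ *ᵥ f₁) +ᵥ ((- t₂ *ᵥ f₂) +ᵥ (l *ᵥ h))))
        w-product : ∀ v {a b c d z} → ⟨ v , y ⟩ ≡ z → ⟨ v , e ⟩ ≡ a → ⟨ v , f₁ ⟩ ≡ b → ⟨ v , f₂ ⟩ ≡ c → ⟨ v , h ⟩ ≡ d →
          ⟨ v , w ⟩ ≡ + k * z + (- (+ k * b₀) * a + (- t₁ * b + (- t₂ * c + l * d)))
        w-product v refl refl refl refl refl = ⟨,⟩-linear₅ (+ k) (- (+ k * b₀)) (- t₁) (- t₂) l y e f₁ f₂ h v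
        ew≡0 : ⟨ e , w ⟩ ≡ 0ℤ
        ew≡0 = trans (w-product e refl ee ef₁ ef₂ eh) (vanish (+ k) b₀ t₁ t₂ l)
          where
          vanish : ∀ k b t₁ t₂ l → k * b + (- (k * b) * 1ℤ + (- t₁ * 0ℤ + (- t₂ * 0ℤ + l * 0ℤ))) ≡ 0ℤ
          vanish = solve-∀
        f₁w≡ : ⟨ f₁ , w ⟩ ≡ + π₁
        f₁w≡ = trans (w-product f₁ refl f₁e f₁f₁ f₁f₂ f₁h) (trans (collect (+ k) b₀ b₁ t₁ t₂ l (+ p))
                 (trans (cong (_- t₁ * + 2) (ℤ.a≡a%ℕn+[a/ℕn]*n (+ k * b₁ + l * + p) 2)) (cancel (+ π₁) (t₁ * + 2))))
          where
          collect : ∀ k b₀ b₁ t₁ t₂ l p → k * b₁ + (- (k * b₀) * 0ℤ + (- t₁ * + 2 + (- t₂ * 0ℤ + l * p))) ≡ k * b₁ + l * p - t₁ * + 2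
          collect = solve-∀
          cancel : ∀ r s → r + s - s ≡ r
          cancel = solve-∀
        f₂w≡ : ⟨ f₂ , w ⟩ ≡ + π₂
        f₂w≡ = trans (w-product f₂ refl f₂e f₂f₁ f₂f₂ f₂h) (trans (collect (+ k) b₀ b₂ t₁ t₂ l (+ q))
                 (trans (cong (_- t₂ * + 2) (ℤ.a≡a%ℕn+[a/ℕn]*n (+ k * b₂ + l * + q) 2)) (cancel (+ π₂) (t₂ * + 2))))
          where
          collect : ∀ k b₀ b₂ t₁ t₂ l q → k * b₂ + (- (k * b₀) * 0ℤ + (- t₁ * 0ℤ + (- t₂ * + 2 + l * q))) ≡ k * b₂ + l * q - t₂ * + 2
          collect = solve-∀
          cancel : ∀ r s → r + s - s ≡ r
          cancel = solve-∀
        gw≡ : ⟨ g , w ⟩ ≡ + k * s + l * + m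
        gw≡ = trans (w-product g refl (trans (comm g e) eg) (trans (comm g f₁) f₁g) (trans (comm g f₂) f₂g) (trans (comm g h) hg))
                (collect (+ k) b₀ s t₁ t₂ l (+ m))
          where
          collect : ∀ k b₀ s t₁ t₂ l m → k * s + (- (k * b₀) * 0ℤ + (- t₁ * 0ℤ + (- t₂ * 0ℤ + l * m))) ≡ k * s + l * m
          collect = solve-∀
        coordinates≡ : coordinates w ≡ coords 0ℤ (+ π₁) (+ π₂) (+ k * s + l * + m)
        coordinates≡ = coords-cong ew≡0 f₁w≡ f₂w≡ gw≡
        4m≢0 : ℤ.NonZero (+ 4 * + m)
        4m≢0 = ℤ.≢-nonZero (λ eq → +m≢0 (ℤ.*-cancelˡ-≡ (+ 4) (+ m) 0ℤ eq))
        ww≡1 : ⟨ w , w ⟩ ≡ 1ℤ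
        ww≡1 = ℤ.*-cancelˡ-≡ (+ 4 * + m) ⟨ w , w ⟩ 1ℤ {{4m≢0}} (trans (sym (parseval w w))
          (trans (cong₂ product coordinates≡ coordinates≡)
            (sum-of-residues π₁ π₂ (ℤ.n%ℕd<d (+ k * b₁ + l * + p) 2) (ℤ.n%ℕd<d (+ k * b₂ + l * + q) 2) (+ k * s + l * + m)
              (cong +_ (ℕ.≡ᵇ⇒≡ (weightedSquare 2 (+ k * s + l * + m)) (2 ℕ.* m ℕ.* (2 ℕ.∸ (π₁ ℕ.+ π₂))) t)))))

      excluded-sound : ∀ y → ¬ T (excluded (coordinates y))
      excluded-sound y t = outer (anyBelow-sound 3 t)
        where
        c = coordinates y
        inner′ : ∀ k → (∃ λ l → T (excludes c k (+ l) ∨ excludes c k (- + l))) → ⊥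
        inner′ k (l , tl) = by-sign′ (∨-sound (excludes c k (+ l)) tl)
          where
          by-sign′ : T (excludes c k (+ l)) ⊎ T (excludes c k (- + l)) → ⊥
          by-sign′ (inj₁ t₊) = excludes-sound y k (+ l) t₊
          by-sign′ (inj₂ t₋) = excludes-sound y k (- + l) t₋
        outer : (∃ λ k → T (anyBelow 3 λ l → excludes c k (+ l) ∨ excludes c k (- + l))) → ⊥
        outer (k , tk) = inner′ k (anyBelow-sound 3 tk)

      norm-equation : ∀ y n₁ → ⟨ y , y ⟩ ≡ + n₁ → NormEquation (2 ℕ.* m) n₁ (coordinates y)
      norm-equation y n₁ yy = ℤ.+-injective (begin
          + weightedSquare (2 ℕ.* (2 ℕ.* m)) b₀ + (+ weightedSquare (2 ℕ.* m) b₁ + (+ weightedSquare (2 ℕ.* m) b₂ + + weightedSquare 2 s))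
            ≡⟨ cong₂ _+_ (weighted (2 ℕ.* (2 ℕ.* m)) b₀) (cong₂ _+_ (weighted (2 ℕ.* m) b₁) (cong₂ _+_ (weighted (2 ℕ.* m) b₂) (weighted 2 s))) ⟩
          + (2 ℕ.* (2 ℕ.* m)) * (b₀ * b₀) + (+ (2 ℕ.* m) * (b₁ * b₁) + (+ (2 ℕ.* m) * (b₂ * b₂) + + 2 * (s * s)))
            ≡⟨ regroup (+ (2 ℕ.* (2 ℕ.* m))) (+ (2 ℕ.* m)) (b₀ * b₀) (b₁ * b₁) (b₂ * b₂) (s * s) ⟩
          product (coordinates y) (coordinates y)
            ≡⟨ parseval y y ⟩
          + 4 * + m * ⟨ y , y ⟩
            ≡⟨ cong (+ 4 * + m *_) yy ⟩
          + 4 * + m * + n₁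
            ≡⟨ cong (_* + n₁) 4m≡ ⟩
          + (2 ℕ.* (2 ℕ.* m)) * + n₁
            ≡⟨ sym (ℤ.pos-* (2 ℕ.* (2 ℕ.* m)) n₁) ⟩
          + (2 ℕ.* (2 ℕ.* m) ℕ.* n₁) ∎)
        where
        open ≡-Reasoning
        b₀ = ⟨ e , y ⟩
        b₁ = ⟨ f₁ , y ⟩
        b₂ = ⟨ f₂ , y ⟩
        s  = ⟨ g , y ⟩
        weighted : ∀ a i → + weightedSquare a i ≡ + a * (i * i)
        weighted a i = trans (ℤ.pos-* a (∣ i ∣ ℕ.* ∣ i ∣)) (cong (+ a *_) (sym (square-abs i)))
        regroup : ∀ d d′ x y z t → d * x + (d′ * y + (d′ * z + + 2 * t)) ≡ d * x + d′ * (y + z) + + 2 * t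
        regroup = solve-∀

      congruent-holds : ∀ y → T (congruent (coordinates y))
      congruent-holds y = divisible-complete 1 (⟨ g , y ⟩ + + p * ⟨ f₁ , y ⟩ + + q * ⟨ f₂ , y ⟩)
        (divides ⟨ h , y ⟩ (trans (cong (λ z → z + + p * ⟨ f₁ , y ⟩ + + q * ⟨ f₂ , y ⟩) gy) (cancel ⟨ h , y ⟩ (+ p) (+ q) ⟨ f₁ , y ⟩ ⟨ f₂ , y ⟩)))
        where
        gy : ⟨ g , y ⟩ ≡ + 2 * ⟨ h , y ⟩ + (- + p * ⟨ f₁ , y ⟩ + - + q * ⟨ f₂ , y ⟩)
        gy = trans (comm g y) (trans (⟨,⟩-linear₃ (+ 2) (- + p) (- + q) h f₁ f₂ y)
          (cong₂ (λ a b → + 2 * a + b) (comm y h) (cong₂ (λ a b → - + p * a + - + q * b) (comm y f₁) (comm y f₂))))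
        cancel : ∀ h p q a b → + 2 * h + (- p * a + - q * b) + p * a + q * b ≡ h * + 2
        cancel = solve-∀

      no-pair-sound : ∀ n₁ i n₂ → T (no-pair n₁ i n₂) → ¬ Pair G (+ n₁) (+ i) (+ n₂)
      no-pair-sound n₁ i n₂ t (pair x y xx xy yy) = excluded-sound x
        (⇒-sound (congruent (coordinates x)) (⇒-sound (eqℤ (product (coordinates x) (coordinates y)) target-product)
          (allVectors-sound (2 ℕ.* m) n₁ (pair-test i (coordinates y))
            (⇒-sound (not (excluded (coordinates y))) (⇒-sound (congruent (coordinates y))
              (allVectors-sound (2 ℕ.* m) n₂ (vector-test n₁ i) t (coordinates y) (norm-equation y n₂ yy)) (congruent-holds y))
              (not-complete (excluded (coordinates y)) (excluded-sound y)))
            (coordinates x) (norm-equation x n₁ xx))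
          product-test) (congruent-holds x))
        where
        target-product : ℤ
        target-product = + (2 ℕ.* (2 ℕ.* m) ℕ.* i)
        product-test : T (eqℤ (product (coordinates x) (coordinates y)) target-product)
        product-test = ℕ.≡⇒≡ᵇ _ 0 (cong ∣_∣ (ℤ.i≡j⇒i-j≡0 (trans (parseval x y) (trans (cong (+ 4 * + m *_) xy) cast))))
          where
          cast : + 4 * + m * + i ≡ target-product
          cast = trans (cong (_* + i) 4m≡)
                       (sym (ℤ.pos-* (2 ℕ.* (2 ℕ.* m)) i))

    target-excluded-sound : ∀ m t → (m ≢ 0 → + 18 - + p * + p - + q * + q ≡ + m) →
                            Pair G (+ norm₁ t) (+ inner t) (+ norm₂ t) → ¬ T (target-excluded p q m t)
    target-excluded-sound m t m≡ P te = no-pair-sound m≢0 (m≡ m≢0) (norm₁ t) (inner t) (norm₂ t) (proj₂ split) P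
      where
      split = ∧-sound (not (m ≡ᵇ 0)) te
      m≢0 : m ≢ 0
      m≢0 eq = not-sound (m ≡ᵇ 0) (proj₁ split) (ℕ.≡⇒≡ᵇ m 0 eq)

    half-norm≡ : half-norm p q ≢ 0 → + 18 - + p * + p - + q * + q ≡ + half-norm p q
    half-norm≡ m≢0 = trans (regroup (+ 18) (+ p * + p) (+ q * + q))
        (trans (cong (_-_ (+ 18)) (sym (cong₂ _+_ (ℤ.pos-* p p) (ℤ.pos-* q q)))) (truncated 18 (p ℕ.* p ℕ.+ q ℕ.* q) m≢0))
      where
      regroup : ∀ c x y → c - x - y ≡ c - (x + y)
      regroup = solve-∀
      truncated : ∀ a b → a ℕ.∸ b ≢ 0 → + a - + b ≡ + (a ℕ.∸ b)
      truncated a b a∸b≢0 = trans (ℤ.m-n≡m⊖n a b) (ℤ.⊖-≥ {a} {b} (ℕ.≰⇒≥ (λ a≤b → a∸b≢0 (ℕ.m≤n⇒m∸n≡0 a≤b))))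

    impossible-sound : (∀ t → Pair G (+ norm₁ t) (+ inner t) (+ norm₂ t)) → ¬ T (impossible p q)
    impossible-sound targets t = by-cases (∨-sound (h-excluded p q) {target-excluded p q (half-norm p q) (target (half-norm p q))} t)
      where
      by-cases : T (h-excluded p q) ⊎ T (target-excluded p q (half-norm p q) (target (half-norm p q))) → ⊥
      by-cases (inj₁ th) = h-excluded-sound th
      by-cases (inj₂ tp) = target-excluded-sound (half-norm p q) (target (half-norm p q)) half-norm≡ (targets (target (half-norm p q))) tp

-- From an isolation of I₂ to the excluded configurations

basis₂ : ℤ → ℤ → ℤ → ℤ → Mat 2 2
basis₂ a b c d 0F 0F = a
basis₂ a b c d 0F 1F = b
basis₂ a b c d 1F 0F = c
basis₂ a b c d 1F 1F = d

module _ (a b c d : ℤ) where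
  private
    δ : ℤ
    δ = a * d - b * c

  basis₂-injective : δ ≢ 0ℤ → InjectiveMap (basis₂ a b c d)
  basis₂-injective δ≢0 x Bx≈0 = 2-cases (cancel (x 0F) (trans (first a b c d (x 0F) (x 1F)) (cong₂ (λ r s → d * r - b * s) (Bx≈0 0F) (Bx≈0 1F) ∙ vanish d b)))
                                        (cancel (x 1F) (trans (second a b c d (x 0F) (x 1F)) (cong₂ (λ r s → a * s - c * r) (Bx≈0 0F) (Bx≈0 1F) ∙ vanish a c)))
    where
    _∙_ = trans
    vanish : ∀ x y → x * 0ℤ - y * 0ℤ ≡ 0ℤ
    vanish = solve-∀
    first : ∀ a b c d x y → (a * d - b * c) * x ≡ d * (a * x + (b * y + + 0)) - b * (c * x + (d * y + + 0))
    first = solve-∀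
    second : ∀ a b c d x y → (a * d - b * c) * y ≡ a * (c * x + (d * y + + 0)) - c * (a * x + (b * y + + 0))
    second = solve-∀
    cancel : ∀ z → δ * z ≡ 0ℤ → z ≡ 0ℤ
    cancel z eq = by-factor (ℤ.i*j≡0⇒i≡0∨j≡0 δ eq)
      where
      by-factor : δ ≡ 0ℤ ⊎ z ≡ 0ℤ → z ≡ 0ℤ
      by-factor (inj₁ δ≡0) = contradiction δ≡0 δ≢0
      by-factor (inj₂ z≡0) = z≡0

  basis₂-surjective⇒unit : SurjectiveMap (basis₂ a b c d) → ∣ δ ∣ ≡ 1
  basis₂-surjective⇒unit sur = from-preimages (sur e₁) (sur e₂)
    where
    e₁ e₂ : Vec 2
    e₁ = 1ℤ ◂ 0ℤ ◂ empty
    e₂ = 0ℤ ◂ 1ℤ ◂ empty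
    from-preimages : (∃ λ x → (basis₂ a b c d ⊙ x) ≈ᵥ e₁) → (∃ λ y → (basis₂ a b c d ⊙ y) ≈ᵥ e₂) → ∣ δ ∣ ≡ 1
    from-preimages (x , Bx) (y , By) = ℕ.m*n≡1⇒m≡1 ∣ δ ∣ ∣ δ′ ∣ (trans (sym (ℤ.abs-* δ δ′)) (cong ∣_∣ product≡1))
      where
      δ′ : ℤ
      δ′ = x 0F * y 1F - y 0F * x 1F
      multiplicative : ∀ a b c d x₀ x₁ y₀ y₁ → (a * d - b * c) * (x₀ * y₁ - y₀ * x₁)
        ≡ (a * x₀ + (b * x₁ + + 0)) * (c * y₀ + (d * y₁ + + 0)) - (a * y₀ + (b * y₁ + + 0)) * (c * x₀ + (d * x₁ + + 0))
      multiplicative = solve-∀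
      product≡1 : δ * δ′ ≡ 1ℤ
      product≡1 = trans (multiplicative a b c d (x 0F) (x 1F) (y 0F) (y 1F))
        (cong₂ _-_ (cong₂ _*_ (Bx 0F) (By 1F)) (cong₂ _*_ (By 0F) (Bx 1F)))

module LowerBound {n : ℕ} (n<5 : n < 5) (G : Mat n n) (lattice : IsLattice G) (isolation : IsIsolation G I₂) where
  open LowRank n<5 G lattice (proj₂ isolation)

  proper-pair : ∀ a b c d → a * d - b * c ≢ 0ℤ → ∣ a * d - b * c ∣ ≢ 1 →
                Pair G (a * a + c * c) (a * b + c * d) (b * b + d * d)
  proper-pair a b c d δ≢0 δ≢1 = from-representation (proj₁ isolation 2 (basis₂ a b c d) (basis₂-injective a b c d δ≢0)
      (λ sur → δ≢1 (basis₂-surjective⇒unit a b c d sur)))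
    where
    gram : ∀ a b c d → a * (1ℤ * b + (0ℤ * d + + 0)) + (c * (0ℤ * b + (1ℤ * d + + 0)) + + 0) ≡ a * b + c * d
    gram = solve-∀
    from-representation : Represents G (sublatticeGram I₂ (basis₂ a b c d)) → Pair G (a * a + c * c) (a * b + c * d) (b * b + d * d)
    from-representation (U , U-eq) = pair (λ i → U i 0F) (λ i → U i 1F) (trans (U-eq 0F 0F) (gram a a c c))
      (trans (U-eq 0F 1F) (gram a b c d)) (trans (U-eq 1F 1F) (gram b b d d))

  targets : ∀ t → Pair G (+ norm₁ t) (+ inner t) (+ norm₂ t)
  targets [2,1,5]  = proper-pair (+ 1) (+ 2) (+ 1) -[1+ 0 ] (λ ()) (λ ())
  targets [5,0,5]  = proper-pair (+ 2) -[1+ 0 ] (+ 1) (+ 2) (λ ()) (λ ())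
  targets [2,1,13] = proper-pair (+ 1) (+ 3) (+ 1) -[1+ 1 ] (λ ()) (λ ())
  targets [1,0,25] = proper-pair (+ 1) (+ 0) (+ 0) (+ 5) (λ ()) (λ ())

  -- A norm-2 vector f with ⟨ e , f ⟩ = ±1 would give the norm-1 vector f ∓ e orthogonal to e.
  orthogonal-to-unit : ∀ e f → ⟨ e , e ⟩ ≡ 1ℤ → ⟨ f , f ⟩ ≡ + 2 → ⟨ e , f ⟩ ≡ 0ℤ
  orthogonal-to-unit e f ee ff = by-value ⟨ e , f ⟩ refl
    where
    w : ℤ → Vec n
    w b = combination 1ℤ (- b) f e
    ww : ∀ b → ⟨ e , f ⟩ ≡ b → ⟨ w b , w b ⟩ ≡ + 2 - b * b
    ww b ef = trans (⟪⟫-combination G 1ℤ (- b) 1ℤ (- b) f e)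
      (trans (cong₂ (λ x y → 1ℤ * x + - b * y) (cong₂ (λ x y → 1ℤ * x + - b * y) ff (trans (comm f e) ef)) (cong₂ (λ x y → 1ℤ * x + - b * y) ef ee)) (expand b))
      where
      expand : ∀ b → 1ℤ * (1ℤ * + 2 + - b * b) + - b * (1ℤ * b + - b * 1ℤ) ≡ + 2 - b * b
      expand = solve-∀
    ew : ∀ b → ⟨ e , f ⟩ ≡ b → ⟨ e , w b ⟩ ≡ 0ℤ
    ew b ef = trans (⟪⟫-+ʳ G e (1ℤ *ᵥ f) (- b *ᵥ e)) (trans (cong₂ _+_ (trans (⟪⟫-*ʳ G 1ℤ e f) (cong (1ℤ *_) ef)) (trans (⟪⟫-*ʳ G (- b) e e) (cong (- b *_) ee))) (vanish b))
      where
      vanish : ∀ b → 1ℤ * b + - b * 1ℤ ≡ 0ℤ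
      vanish = solve-∀
    by-value : ∀ b → ⟨ e , f ⟩ ≡ b → ⟨ e , f ⟩ ≡ 0ℤ
    by-value (+ 0) ef = ef
    by-value (+ 1) ef = contradiction (ww (+ 1) ef) (no-orthonormal e (w (+ 1)) ee (ew (+ 1) ef))
    by-value -[1+ 0 ] ef = contradiction (ww -[1+ 0 ] ef) (no-orthonormal e (w -[1+ 0 ]) ee (ew -[1+ 0 ] ef))
    by-value b@(+ (suc (suc k))) ef = contradiction (subst (ℤ._< 0ℤ) (sym (trans (ww b ef) (negative k))) ℤ.-<+) (nonnegative (w b))
      where
      negative : ∀ k → + 2 - + (suc (suc k)) * + (suc (suc k)) ≡ -[1+ 1 ℕ.+ 4 ℕ.* k ℕ.+ k ℕ.* k ]
      negative k = trans (cong (λ z → + 2 - z * z) (ℤ.pos-+ 2 k)) (trans (expand (+ k)) (cong -_ cast))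
        where
        expand : ∀ k → + 2 - (+ 2 + k) * (+ 2 + k) ≡ - (+ 2 + + 4 * k + k * k)
        expand = solve-∀
        cast : + 2 + + 4 * + k + + k * + k ≡ + (2 ℕ.+ 4 ℕ.* k ℕ.+ k ℕ.* k)
        cast = cong₂ (λ x y → + 2 + x + y) (sym (ℤ.pos-* 4 k)) (sym (ℤ.pos-* k k))
    by-value b@(-[1+ suc k ]) ef = contradiction (subst (ℤ._< 0ℤ) (sym (trans (ww b ef) (negative k))) ℤ.-<+) (nonnegative (w b))
      where
      negative : ∀ k → + 2 - -[1+ suc k ] * -[1+ suc k ] ≡ -[1+ 1 ℕ.+ 4 ℕ.* k ℕ.+ k ℕ.* k ]
      negative k = trans (cong (λ z → + 2 - + z) (square k)) refl
        where
        square : ∀ k → suc (suc k) ℕ.* suc (suc k) ≡ 2 ℕ.+ (2 ℕ.+ 4 ℕ.* k ℕ.+ k ℕ.* k)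
        square = ℕ-Ring.solve-∀

  record Signed (e f₁ f₂ h : Vec n) : Set where
    constructor signed
    field
      f₁′ : Vec n
      ef  : ⟨ e , f₁′ ⟩ ≡ 0ℤ
      ff  : ⟨ f₁′ , f₁′ ⟩ ≡ + 2
      ff₂ : ⟨ f₁′ , f₂ ⟩ ≡ 0ℤ
      p   : ℕ
      fh  : ⟨ f₁′ , h ⟩ ≡ + p

  choose-sign : ∀ e f₁ f₂ h → ⟨ e , f₁ ⟩ ≡ 0ℤ → ⟨ f₁ , f₁ ⟩ ≡ + 2 → ⟨ f₁ , f₂ ⟩ ≡ 0ℤ → Signed e f₁ f₂ h
  choose-sign e f₁ f₂ h ef ff ff₂ = by-value ⟨ f₁ , h ⟩ refl
    where
    neg : Vec n
    neg = -[1+ 0 ] *ᵥ f₁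
    by-value : ∀ b → ⟨ f₁ , h ⟩ ≡ b → Signed e f₁ f₂ h
    by-value (+ p) fh = signed f₁ ef ff ff₂ p fh
    by-value -[1+ p ] fh = signed neg (trans (⟪⟫-*ʳ G -[1+ 0 ] e f₁) (cong (-[1+ 0 ] *_) ef))
      (trans (⟪⟫-*ˡ G -[1+ 0 ] f₁ neg) (cong (-[1+ 0 ] *_) (trans (⟪⟫-*ʳ G -[1+ 0 ] f₁ f₁) (cong (-[1+ 0 ] *_) ff))))
      (trans (⟪⟫-*ˡ G -[1+ 0 ] f₁ f₂) (cong (-[1+ 0 ] *_) ff₂))
      (suc p) (trans (⟪⟫-*ˡ G -[1+ 0 ] f₁ h) (trans (cong (-[1+ 0 ] *_) fh) (ℤ.-1*i≡-i -[1+ p ])))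

  -- The vector 2h - pf has norm 36 - 2p², which is negative from p = 5 on.
  product-bound : ∀ f h p → ⟨ f , f ⟩ ≡ + 2 → ⟨ h , h ⟩ ≡ + 9 → ⟨ f , h ⟩ ≡ + p → p < 5
  product-bound f h p ff hh fh = ℕ.≰⇒> (λ 5≤p → nonnegative w (subst (ℤ._< 0ℤ) (sym ww) (negative 5≤p)))
    where
    w : Vec n
    w = combination (+ 2) (- + p) h f
    ww : ⟨ w , w ⟩ ≡ + 36 - + (2 ℕ.* (p ℕ.* p))
    ww = trans (⟪⟫-combination G (+ 2) (- + p) (+ 2) (- + p) h f)
      (trans (cong₂ (λ x y → + 2 * x + - + p * y) (cong₂ (λ x y → + 2 * x + - + p * y) hh (trans (comm h f) fh)) (cong₂ (λ x y → + 2 * x + - + p * y) fh ff))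
      (trans (expand (+ p)) (cong (_-_ (+ 36)) (trans (cong (+ 2 *_) (sym (ℤ.pos-* p p))) (sym (ℤ.pos-* 2 (p ℕ.* p)))))))
      where
      expand : ∀ p → + 2 * (+ 2 * + 9 + - p * p) + - p * (+ 2 * p + - p * + 2) ≡ + 36 - + 2 * (p * p)
      expand = solve-∀
    negative : 5 ≤ p → + 36 - + (2 ℕ.* (p ℕ.* p)) ℤ.< 0ℤ
    negative 5≤p = subst (ℤ._< 0ℤ) (sym (ℤ.m-n≡m⊖n 36 (2 ℕ.* (p ℕ.* p))))
      (subst (36 ℤ.⊖ (2 ℕ.* (p ℕ.* p)) ℤ.<_) (ℤ.n⊖n≡0 36) (ℤ.⊖-monoʳ->-< 36 36<))
      where
      36< : 36 < 2 ℕ.* (p ℕ.* p)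
      36< = ℕ.<-≤-trans (ℕ.m<m+n 36 (s≤s z≤n)) (ℕ.*-monoʳ-≤ 2 (ℕ.*-mono-≤ 5≤p 5≤p))

  contradictory : Pair G (+ 1) (+ 0) (+ 9) → Pair G (+ 2) (+ 0) (+ 2) → ⊥
  contradictory (pair e h ee eh hh) (pair f₁ f₂ ff₁ f₁f₂ ff₂) =
      signs (choose-sign e f₁ f₂ h (orthogonal-to-unit e f₁ ee ff₁) ff₁ f₁f₂)
    where
    ordered : ∀ f₁ f₂ p q → ⟨ e , f₁ ⟩ ≡ 0ℤ → ⟨ e , f₂ ⟩ ≡ 0ℤ → ⟨ f₁ , f₁ ⟩ ≡ + 2 → ⟨ f₁ , f₂ ⟩ ≡ 0ℤ → ⟨ f₂ , f₂ ⟩ ≡ + 2 →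
              ⟨ f₁ , h ⟩ ≡ + p → ⟨ f₂ , h ⟩ ≡ + q → q ≤ p → ⊥
    ordered f₁ f₂ p q ef₁ ef₂ ff₁ f₁f₂ ff₂ f₁h f₂h q≤p =
      Frame.impossible-sound e f₁ f₂ h ee ef₁ ef₂ eh ff₁ f₁f₂ ff₂ hh {p} {q} f₁h f₂h targets
        (allBelow-sound (suc p) {impossible p} (allBelow-sound 5 {λ p → allBelow (suc p) (impossible p)} all-impossible p (product-bound f₁ h p ff₁ hh f₁h)) q (s≤s q≤p))
    signs : Signed e f₁ f₂ h → ⊥
    signs (signed f₁ ef₁ ff₁ f₁f₂ p f₁h) = signs′ (choose-sign e f₂ f₁ h (orthogonal-to-unit e f₂ ee ff₂) ff₂ (trans (comm f₂ f₁) f₁f₂))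
      where
      signs′ : Signed e f₂ f₁ h → ⊥
      signs′ (signed f₂ ef₂ ff₂ f₂f₁ q f₂h) = by-order (ℕ.≤-total q p)
        where
        by-order : q ≤ p ⊎ p ≤ q → ⊥
        by-order (inj₁ q≤p) = ordered f₁ f₂ p q ef₁ ef₂ ff₁ (trans (comm f₁ f₂) f₂f₁) ff₂ f₁h f₂h q≤p
        by-order (inj₂ p≤q) = ordered f₂ f₁ q p ef₂ ef₁ ff₂ f₂f₁ ff₁ f₂h f₁h p≤q

  absurd : ⊥
  absurd = contradictory (proper-pair (+ 1) (+ 0) (+ 0) (+ 3) (λ ()) (λ ())) (proper-pair (+ 1) (+ 1) (+ 1) -[1+ 0 ] (λ ()) (λ ()))

low-rank-not-isolation : ∀ n → n < 5 → (G : Mat n n) → IsLattice G → ¬ IsIsolation G I₂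
low-rank-not-isolation n n<5 G lattice isolation = LowerBound.absurd n<5 G lattice isolation

theorem3p1 : IsLattice Lgram × IsIsolation Lgram I₂
    × (∀ (n : ℕ) → n < 5 → (G : Mat n n) → IsLattice G → ¬ IsIsolation G I₂)
    × IsoEq I₂ 5
theorem3p1 = Lgram-lattice , Lgram-isolation , low-rank-not-isolation
           , (Lgram , Lgram-lattice , Lgram-isolation) , low-rank-not-isolation
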